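{- Let $r,\ell,k$ be integers with $r\ge 3$, $1\le \ell\le r$ and $k\ge 1+r-\ell$. If it is not the case that both $\ell=1$ and $k\ge 2r$, then $$\mathrm{cov}(r,\ell,k)=1+\Bigl\lfloor \frac{k-r+\ell-1}{\ell}\Bigr\rfloor .$$ If $\ell=1$ and $k\ge 2r$, then $$1+\Bigl\lfloor \frac{k-r+\ell-1}{\ell}\Bigr\rfloor\le \mathrm{cov}(r,\ell,k)\le 2+\Bigl\lfloor \frac{k-r+\ell-1}{\ell}\Bigr\rfloor .$$
   Context: For $1\le\ell\le r$, a hypergraph is complete $r$-uniform $(r,\ell)$-partite if its vertex set $V$ is partitioned into $r$ nonempty classes $V_1\cup\dots\cup V_r$ and its edge set consists of all $r$-element subsets of $V$ that intersect each class in at most $\ell$ vertices. A $k$-coloring of a hypergraph is an assignment of a color from $[k]=\{1,\dots,k\}$ to each edge (not all $k$ colors need be used). A coloring is spanning if every vertex is incident to edges of every color used in the coloring. For an edge-colored hypergraph $H$, let $H_i$ be the subhypergraph on vertex set $V(H)$ consisting of the edges of color $i$. A hypergraph is connected if it has only one vertex or any two distinct vertices can be connected by a sequence of edges each intersecting the next; every hypergraph is uniquely partitioned into connected components. A monochromatic component of $H$ is (the vertex set of) a connected component of $H_i$ for some color $i$. $\mathrm{cov}(r,\ell,k)$ is the minimum integer $m$ such that for every complete $r$-uniform $(r,\ell)$-partite hypergraph and every spanning $k$-coloring of its edges, the vertex set can be covered by at most $m$ monochromatic components. -}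

module Defs where

open import Data.Nat using (ℕ; _≤_; _∸_; _+_; _/_; NonZero)
open import Data.Fin using (Fin; _≟_)
open import Data.Fin.Subset using (Subset; _∈_; _∩_; ∣_∣; Nonempty)
open import Data.List using (List; length)
open import Data.List.Relation.Unary.All using (All)
open import Data.List.Relation.Unary.Any using (Any)
open import Data.Product using (Σ-syntax; ∃-syntax; _×_)
open import Data.Vec using (tabulate)
open import Function.Bundles using (_⇔_)
open import Level using (0ℓ)
open import Relation.Binary.Construct.Closure.ReflexiveTransitive using (Star)
open import Relation.Binary.PropositionalEquality using (_≡_)
open import Relation.Nullary.Decidable using (does)
open import Relation.Unary using (Pred)

-- Hypergraphs on the vertex set Fin n, given by their edge sets.
Hypergraph : ℕ → Set₁
Hypergraph n = Pred (Subset n) 0ℓ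

module _ {n : ℕ} (H : Hypergraph n) where

  ShareEdge : Fin n → Fin n → Set
  ShareEdge x y = ∃[ e ] H e × x ∈ e × y ∈ e

  -- A sequence of edges, each intersecting the next, from x to y: the
  -- intermediate vertices of the path lie in the consecutive intersections.
  -- The empty path makes every vertex connected to itself, so a vertex lying
  -- in no edge forms a component on its own.
  ConnectedTo : Fin n → Fin n → Set
  ConnectedTo = Star ShareEdge

  IsComponent : Subset n → Set
  IsComponent C = ∃[ x ] ∀ y → y ∈ C ⇔ ConnectedTo x y

  -- The argument H e is irrelevant so that the colour depends only on the
  -- edge and not on the proof that it is one.
  Colouring : ℕ → Set
  Colouring k = (e : Subset n) → .(H e) → Fin k

module _ {n k : ℕ} {H : Hypergraph n} (c : Colouring H k) where

  OfColour : Fin k → Hypergraph n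
  OfColour i e = Σ[ p ∈ H e ] c e p ≡ i

  -- Only the colours actually used are required to occur at every vertex.
  Spanning : Set
  Spanning = ∀ i → (∃[ e ] OfColour i e) → ∀ v → ∃[ e ] v ∈ e × OfColour i e

  MonochromaticComponent : Subset n → Set
  MonochromaticComponent C = ∃[ i ] IsComponent (OfColour i) C

  CoverableBy≤ : ℕ → Set
  CoverableBy≤ m = Σ[ Cs ∈ List (Subset n) ]
    length Cs ≤ m × All MonochromaticComponent Cs × (∀ v → Any (v ∈_) Cs)

record Partition (n r : ℕ) : Set where
  field
    classOf : Fin n → Fin r

  class : Fin r → Subset n
  class i = tabulate λ v → does (classOf v ≟ i)

  field
    class-nonempty : ∀ i → Nonempty (class i)

-- The complete r-uniform (r,ℓ)-partite hypergraph with the given classes.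
CompletePartite : ∀ {n r} → ℕ → Partition n r → Hypergraph n
CompletePartite {r = r} ℓ P e = ∣ e ∣ ≡ r × (∀ i → ∣ e ∩ class i ∣ ≤ ℓ)
  where open Partition P

AlwaysCoverableBy≤ : (r ℓ k m : ℕ) → Set
AlwaysCoverableBy≤ r ℓ k m =
  ∀ {n} (P : Partition n r) (c : Colouring (CompletePartite ℓ P) k) →
  Spanning c → CoverableBy≤ c m

-- cov(r,ℓ,k) is the minimum of the upward closed set of all m satisfying
-- AlwaysCoverableBy≤ r ℓ k m. Membership in this set is not evidently
-- decidable, so the minimum is not available as a function into ℕ; instead
-- M ≤ cov, cov ≤ M and cov = M are expressed as conditions on M.
_≤cov[_,_,_] : (M r ℓ k : ℕ) → Set
M ≤cov[ r , ℓ , k ] = ∀ m → AlwaysCoverableBy≤ r ℓ k m → M ≤ m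

cov[_,_,_]≤_ : (r ℓ k M : ℕ) → Set
cov[ r , ℓ , k ]≤ M = AlwaysCoverableBy≤ r ℓ k M

cov[_,_,_]≡_ : (r ℓ k M : ℕ) → Set
cov[ r , ℓ , k ]≡ M = AlwaysCoverableBy≤ r ℓ k M × M ≤cov[ r , ℓ , k ]

-- ⌊(k - r + ℓ - 1) / ℓ⌋. Adding ℓ before subtracting keeps _∸_ from
-- truncating when k < r; it is exact as soon as k ≥ 1 + r - ℓ.
quot : (r ℓ k : ℕ) .{{_ : NonZero ℓ}} → ℕ
quot r ℓ k = (k + ℓ ∸ r ∸ 1) / ℓ

{-# OPTIONS --safe #-}
module Submission where

-- Replace every vertex by the vector of the labels of its components in the k colours; every
-- edge agrees in some coordinate. For the upper bound take an edge e agreeing in as few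
-- coordinates as possible. Because the colouring spans, dropping a vertex x from e strictly
-- increases the number of agreements (by the colours "lost" at x), and different x lose
-- different colours, so some x in each class lose few. Components in the lost colours of
-- such x, with one or two in colours common to e, number at most 1 + quot r ℓ k; a vertex z
-- left out by them could replace such an x in e, and z ∷ e ∖ x would agree too rarely. When e
-- agrees in one coordinate only, one more colour lost by dropping two vertices is needed,
-- which breaks down for r = 3, ℓ = 1. There, if no k − 1 components of distinct colours
-- cover, vertices left out by majority components combine to a transversal with no common
-- colour; for k ≤ 5 the sharper bound follows from a finite case analysis.
-- For the lower bound, vertices of one class are given arbitrary sets of at most quot r ℓ k
-- colours in which they avoid the one large component.

open import Data.Bool using (if_then_else_)
open import Data.Empty using (⊥; ⊥-elim)
open import Data.Fin using (Fin; zero; suc; fromℕ<; remQuot; combine; finToFun; funToFin)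
open import Data.Fin.Patterns
import Data.Fin.Properties as Fin
open import Data.Fin.Subset using (Subset; inside; outside; ∣_∣; _∩_) renaming (_∈_ to _∈ₛ_)
open import Data.Fin.Subset.Properties using (anySubset?; x∈p∩q⁺; x∈p∩q⁻) renaming (_∈?_ to _∈ₛ?_)
open import Data.List
  using (List; []; _∷_; _++_; length; map; filter; concat; concatMap; tabulate; allFin; upTo; foldr; cartesianProduct)
import Data.List as List
open import Data.List.Membership.Propositional using (_∈_; _∉_; find; lose)
open import Data.List.Membership.Propositional.Properties
open import Data.List.Properties
  using (length-++; filter-all; filter-accept; filter-reject; length-map; length-tabulate; length-take)
open import Data.List.Relation.Binary.Disjoint.Propositional using (Disjoint)
open import Data.List.Relation.Binary.Permutation.Propositional
  using (_↭_; ↭-refl; ↭-sym; ↭-trans; ↭-reflexive; prep; swap; ↭⇒↭ₛ)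
open import Data.List.Relation.Binary.Permutation.Propositional.Properties using (↭-length; filter-↭)
open import Data.List.Relation.Binary.Permutation.Setoid.Properties using (Unique-resp-↭)
open import Data.List.Relation.Binary.Subset.Propositional using (_⊆_)
open import Data.List.Relation.Unary.All using (All; []; _∷_)
import Data.List.Relation.Unary.All as All
import Data.List.Relation.Unary.All.Properties as All
open import Data.List.Relation.Unary.AllPairs using (AllPairs; []; _∷_)
import Data.List.Relation.Unary.AllPairs as AllPairs
import Data.List.Relation.Unary.AllPairs.Properties as AllPairs
open import Data.List.Relation.Unary.Any using (Any; here; there)
import Data.List.Relation.Unary.Any as Any
import Data.List.Relation.Unary.Any.Properties as Any
open import Data.List.Relation.Unary.Unique.Propositional using (Unique)
import Data.List.Relation.Unary.Unique.Propositional.Properties as Unique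
open import Data.Nat
open import Data.Nat.DivMod using (m/n*n≤m; m≡m%n+[m/n]*n; m%n<n; n/1≡n)
open import Data.Nat.Induction using (<-wellFounded)
open import Data.Nat.Properties
open import Data.Nat.Solver using (module +-*-Solver)
open import Data.Product using (∃; ∃-syntax; _×_; _,_; proj₁; proj₂)
import Data.Product.Properties as Product
open import Data.Sum using (_⊎_; inj₁; inj₂)
open import Data.Vec using (Vec; []; _∷_)
import Data.Vec as Vec
open import Data.Vec.Properties using (lookup∘tabulate; lookup⇒[]=; []=⇒lookup; ≡-dec)
open import Function using (_∘_; id; mk⇔; module Equivalence)
open import Induction.WellFounded using (Acc; acc)
open import Relation.Binary using (DecidableEquality)
open import Relation.Binary.Construct.Closure.ReflexiveTransitive using (Star; ε; _◅_; _◅◅_)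
open import Relation.Binary.PropositionalEquality
open import Relation.Nullary using (¬_; Dec; yes; no; contradiction; ¬?; does)
open import Relation.Nullary.Decidable
  using (_×-dec_; _⊎-dec_; _→-dec_; toWitness; decidable-stable; dec-true; dec-false; map′)
open import Algebra.Properties.CommutativeMonoid.Sum +-0-commutativeMonoid
  using (sum-cong-≗) renaming (sum to ∑)
open import Defs

-- Upper bounds are refutations of `NoCover`: components are chosen so that the vertex they leave
-- out is useless in every exchange. A minimal edge has a common colour and loses `1 + g x` colours
-- at each of its r vertices, all of them distinct, so `k ≤ r + q * ℓ` forces the excesses `g x` to
-- sum to less than `q * ℓ`. In a full class the least of the ℓ excesses is at most their average,
-- so the least excesses of all full classes sum to at most q - 1. Out of q + 1 components two
-- remain free. One lost colour per vertex stays uncovered. This is harmless if two common colours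
-- are given up for it. With a single common colour only one is given up, and the second free
-- component clears the uncovered colour at one vertex only, the pivot. At any other vertex the
-- surviving colour is attacked by exchanging the pivot as well, and a fourth vertex is needed to
-- keep the counted colours distinct. For ℓ ≥ 2 and r = 3 no two classes are full, so only the pivot
-- occurs. The obstacle in the lower bound is that the colouring has to span. Tags prescribe the
-- colours of certain transversals for this purpose, but only where no small component grows.

private variable
  A B : Set

-- Lists and finite sums

unique-⊆⇒length≤ : {xs ys : List A} → Unique xs → xs ⊆ ys → length xs ≤ length ys
unique-⊆⇒length≤ {xs = []} _ _ = z≤n
unique-⊆⇒length≤ {xs = x ∷ xs} (x∉xs ∷ u) s with ∈-∃++ (s (here refl))
... | as , bs , refl = begin
  suc (length xs)               ≤⟨ s≤s (unique-⊆⇒length≤ u shrink) ⟩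
  suc (length (as ++ bs))       ≡⟨ cong suc (length-++ as) ⟩
  suc (length as + length bs)   ≡⟨ +-suc (length as) (length bs) ⟨
  length as + length (x ∷ bs)   ≡⟨ length-++ as ⟨
  length (as ++ x ∷ bs)         ∎
  where
  open ≤-Reasoning
  shrink : xs ⊆ as ++ bs
  shrink {y} y∈xs with ∈-++⁻ as (s (there y∈xs))
  ... | inj₁ y∈as = ∈-++⁺ˡ y∈as
  ... | inj₂ (here refl) = contradiction refl (All.lookup x∉xs y∈xs)
  ... | inj₂ (there y∈bs) = ∈-++⁺ʳ as y∈bs

unique⇒length≤ : ∀ {n} {xs : List (Fin n)} → Unique xs → length xs ≤ n
unique⇒length≤ {n} {xs} u =
  subst (length xs ≤_) (length-tabulate id) (unique-⊆⇒length≤ u (λ {i} _ → ∈-allFin i))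

shorter⇒missing : ∀ {n} (xs : List (Fin n)) → length xs < n → ∃[ i ] i ∉ xs
shorter⇒missing {n} xs short with Fin.any? (λ i → ¬? (i ∈? xs))
  where open import Data.List.Membership.DecPropositional Fin._≟_ using (_∈?_)
... | yes found = found
... | no none = contradiction all (<⇒≱ short)
  where
  open import Data.List.Membership.DecPropositional Fin._≟_ using (_∈?_)
  all : n ≤ length xs
  all = subst (_≤ length xs) (length-tabulate id)
    (unique-⊆⇒length≤ (Unique.allFin⁺ n) λ {i} _ → decidable-stable (i ∈? xs) λ i∉ → none (i , i∉))

sumOf : (A → ℕ) → List A → ℕ
sumOf g [] = 0
sumOf g (x ∷ xs) = g x + sumOf g xs

sumOf-const-1 : (xs : List A) → sumOf (λ _ → 1) xs ≡ length xs
sumOf-const-1 [] = refl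
sumOf-const-1 (x ∷ xs) = cong suc (sumOf-const-1 xs)

sumOf-+ : (g h : A → ℕ) (xs : List A) → sumOf (λ x → g x + h x) xs ≡ sumOf g xs + sumOf h xs
sumOf-+ g h [] = refl
sumOf-+ g h (x ∷ xs) rewrite sumOf-+ g h xs = solve 4
  (λ a b c d → a :+ b :+ (c :+ d) := a :+ c :+ (b :+ d)) refl (g x) (h x) (sumOf g xs) (sumOf h xs)
  where open +-*-Solver

sumOf-mono : {g h : A → ℕ} (xs : List A) → (∀ {x} → x ∈ xs → g x ≤ h x) → sumOf g xs ≤ sumOf h xs
sumOf-mono [] _ = z≤n
sumOf-mono (x ∷ xs) le = +-mono-≤ (le (here refl)) (sumOf-mono xs (le ∘ there))

length-concatMap : (f : A → List B) (xs : List A) → length (concatMap f xs) ≡ sumOf (length ∘ f) xs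
length-concatMap f [] = refl
length-concatMap f (x ∷ xs) = trans (length-++ (f x)) (cong (length (f x) +_) (length-concatMap f xs))

length-concat-tabulate : ∀ {n} (f : Fin n → List A) → length (concat (tabulate f)) ≡ ∑ (length ∘ f)
length-concat-tabulate {n = zero} f = refl
length-concat-tabulate {n = suc n} f =
  trans (length-++ (f zero)) (cong (length (f zero) +_) (length-concat-tabulate (f ∘ suc)))

length*≤sumOf : {g : A → ℕ} {m : ℕ} (xs : List A) → (∀ {x} → x ∈ xs → m ≤ g x) → length xs * m ≤ sumOf g xs
length*≤sumOf [] _ = z≤n
length*≤sumOf (x ∷ xs) le = +-mono-≤ (le (here refl)) (length*≤sumOf xs (le ∘ there))

minimiser : (g : A → ℕ) {z : A} (xs : List A) → z ∈ xs → ∃[ x ] x ∈ xs × (∀ {y} → y ∈ xs → g x ≤ g y)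
minimiser g (x ∷ []) _ = x , here refl , λ { (here refl) → ≤-refl }
minimiser g (x ∷ xs@(_ ∷ _)) _ with minimiser g xs (here refl)
... | y , y∈ , min with ≤-total (g x) (g y)
... | inj₁ gx≤ = x , here refl , λ { (here refl) → ≤-refl ; (there z∈) → ≤-trans gx≤ (min z∈) }
... | inj₂ gy≤ = y , there y∈ , λ { (here refl) → gy≤ ; (there z∈) → min z∈ }

∑-mono : ∀ {n} {f g : Fin n → ℕ} → (∀ i → f i ≤ g i) → ∑ f ≤ ∑ g
∑-mono {zero} le = z≤n
∑-mono {suc n} le = +-mono-≤ (le zero) (∑-mono (le ∘ suc))

∑-zero : ∀ n → ∑ {n} (λ _ → 0) ≡ 0
∑-zero zero = refl
∑-zero (suc n) = ∑-zero n

∑-* : ∀ {n} c (f : Fin n → ℕ) → c * ∑ f ≡ ∑ (λ i → c * f i)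
∑-* {zero} c f = *-zeroʳ c
∑-* {suc n} c f = trans (*-distribˡ-+ c (f zero) _) (cong (c * f zero +_) (∑-* c (f ∘ suc)))

∑-single : ∀ {n} (j : Fin n) (f g : Fin n → ℕ) (c : ℕ) →
  f j ≡ c + g j → (∀ i → i ≢ j → f i ≡ g i) → ∑ f ≡ c + ∑ g
∑-single {suc n} zero f g c at off = trans
  (cong₂ _+_ at (sum-cong-≗ {n = n} λ i → off (suc i) λ ())) (+-assoc c (g zero) _)
∑-single {suc n} (suc j) f g c at off = trans
  (cong₂ _+_ (off zero λ ()) (∑-single j (f ∘ suc) (g ∘ suc) c at λ i i≢j → off (suc i) (i≢j ∘ Fin.suc-injective)))
  (solve 3 (λ a b d → a :+ (b :+ d) := b :+ (a :+ d)) refl (g zero) c (∑ (g ∘ suc)))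
  where open +-*-Solver

module Fibres {r : ℕ} (cls : A → Fin r) where

  fibre : List A → Fin r → List A
  fibre xs j = filter (λ v → cls v Fin.≟ j) xs

  ∈-fibre⁺ : ∀ {x xs} → x ∈ xs → x ∈ fibre xs (cls x)
  ∈-fibre⁺ x∈ = ∈-filter⁺ (λ v → cls v Fin.≟ _) x∈ refl

  ∈-fibre⁻ : ∀ {x xs j} → x ∈ fibre xs j → x ∈ xs × cls x ≡ j
  ∈-fibre⁻ {j = j} = ∈-filter⁻ (λ v → cls v Fin.≟ j)

  sumOf-fibres : (g : A → ℕ) (xs : List A) → ∑ (λ j → sumOf g (fibre xs j)) ≡ sumOf g xs
  sumOf-fibres g [] = ∑-zero r
  sumOf-fibres g (x ∷ xs) = trans
    (∑-single (cls x) _ _ (g x)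
      (cong (sumOf g) (filter-accept (λ v → cls v Fin.≟ cls x) refl))
      (λ j j≢ → cong (sumOf g) (filter-reject (λ v → cls v Fin.≟ j) (≢-sym j≢))))
    (cong (g x +_) (sumOf-fibres g xs))

  length-fibres : (xs : List A) → ∑ (λ j → length (fibre xs j)) ≡ length xs
  length-fibres xs = begin
    ∑ (λ j → length (fibre xs j))              ≡⟨ sum-cong-≗ {n = r} (λ j → sumOf-const-1 (fibre xs j)) ⟨
    ∑ (λ j → sumOf (λ _ → 1) (fibre xs j))     ≡⟨ sumOf-fibres _ xs ⟩
    sumOf (λ _ → 1) xs                         ≡⟨ sumOf-const-1 xs ⟩
    length xs                                  ∎
    where open ≡-Reasoning

  -- Serves as an exchange property: it finds a class in which an edge has a vertex to offer and a
  -- smaller list still has room.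
  larger-fibre : (xs ys : List A) → length ys < length xs → ∃[ j ] length (fibre ys j) < length (fibre xs j)
  larger-fibre xs ys ys<xs with Fin.any? (λ j → length (fibre ys j) <? length (fibre xs j))
  ... | yes found = found
  ... | no none = contradiction
    (subst₂ _≤_ (length-fibres xs) (length-fibres ys) (∑-mono λ j → ≮⇒≥ λ lt → none (j , lt)))
    (<⇒≱ ys<xs)

module Removal (_≟_ : DecidableEquality A) where

  infixl 6 _∖_
  _∖_ : List A → A → List A
  xs ∖ x = filter (λ y → ¬? (y ≟ x)) xs

  ∈-∖⁺ : ∀ {x y xs} → y ∈ xs → y ≢ x → y ∈ xs ∖ x
  ∈-∖⁺ {x} = ∈-filter⁺ (λ y → ¬? (y ≟ x))

  ∈-∖⁻ : ∀ {x y xs} → y ∈ xs ∖ x → y ∈ xs × y ≢ x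
  ∈-∖⁻ {x} = ∈-filter⁻ (λ y → ¬? (y ≟ x))

  ∖-↭ : ∀ {x xs} → Unique xs → x ∈ xs → xs ↭ x ∷ xs ∖ x
  ∖-↭ {x} (x∉ ∷ u) (here refl) = prep x (↭-sym (↭-reflexive
    (trans (filter-reject (λ y → ¬? (y ≟ x)) (λ x≢x → x≢x refl)) (filter-all (λ y → ¬? (y ≟ x)) (All.map ≢-sym x∉)))))
  ∖-↭ {x} {y ∷ _} (y∉ ∷ u) (there x∈) = ↭-trans (prep y (∖-↭ u x∈)) (↭-trans (swap y x ↭-refl) (prep x (↭-reflexive
    (sym (filter-accept (λ z → ¬? (z ≟ x)) (All.lookup y∉ x∈))))))

-- Vertices as vectors of component labels

Unique-↭ : {xs ys : List A} → xs ↭ ys → Unique xs → Unique ys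
Unique-↭ {A = A} p = Unique-resp-↭ (setoid A) (↭⇒↭ₛ p)
  where open import Data.List.Relation.Binary.Permutation.Propositional using (↭⇒↭ₛ)

∃∈∉ : ∀ {n} {xs ys : List (Fin n)} → Unique ys → length xs < length ys → ∃[ y ] y ∈ ys × y ∉ xs
∃∈∉ {xs = xs} {ys} u short with All.all? (_∈? xs) ys
  where open import Data.List.Membership.DecPropositional Fin._≟_ using (_∈?_)
... | yes all = contradiction (unique-⊆⇒length≤ u (All.lookup all)) (<⇒≱ short)
... | no ¬all = find (All.¬All⇒Any¬ (_∈? xs) ys ¬all)
  where open import Data.List.Membership.DecPropositional Fin._≟_ using (_∈?_)

concatMap-unique : (f : A → List B) {xs : List A} → Unique xs → (∀ {x} → x ∈ xs → Unique (f x)) →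
  (∀ {x y} → x ∈ xs → y ∈ xs → x ≢ y → Disjoint (f x) (f y)) → Unique (concatMap f xs)
concatMap-unique f [] uf dis = []
concatMap-unique f {x ∷ xs} (x∉ ∷ u) uf dis = Unique.++⁺ (uf (here refl))
  (concatMap-unique f u (uf ∘ there) λ p q → dis (there p) (there q))
  λ { (i∈ , i∈′) → let (y , y∈ , i∈fy) = find (∈-concatMap⁻ f {xs} i∈′)
                   in dis (here refl) (there y∈) (All.lookup x∉ y∈) (i∈ , i∈fy) }

headOr : A → List A → A
headOr d [] = d
headOr d (x ∷ _) = x

headOr∈ : ∀ {d : A} {x xs} → x ∈ xs → headOr d xs ∈ xs
headOr∈ {xs = _ ∷ _} _ = here refl

tail : List A → List A
tail [] = []
tail (_ ∷ xs) = xs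

length-tail : (xs : List A) → length (tail xs) ≡ pred (length xs)
length-tail [] = refl
length-tail (_ ∷ xs) = refl

∈-tail : ∀ {d x : A} {xs} → x ∈ xs → x ≡ headOr d xs ⊎ x ∈ tail xs
∈-tail (here refl) = inj₁ refl
∈-tail (there x∈) = inj₂ x∈

module Labelling {n r k : ℕ} (cls : Fin n → Fin r) (lab : Fin k → Fin n → Fin n) (ℓ : ℕ) where

  open Fibres cls public
  open Removal {A = Fin n} Fin._≟_ public

  V : Set
  V = Fin n

  -- An edge is a list without repetitions, so that exchanging a vertex is a list operation;
  -- `Edge-↭` makes the order immaterial.
  Edge : List V → Set
  Edge e = length e ≡ r × Unique e × (∀ j → length (fibre e j) ≤ ℓ)

  Edge-↭ : ∀ {e f} → e ↭ f → Edge e → Edge f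
  Edge-↭ p (len , u , le) = trans (sym (↭-length p)) len , Unique-↭ p u ,
    λ j → subst (_≤ ℓ) (↭-length (filter-↭ _ p)) (le j)

  fibre-∷-≡ : ∀ {x j} Y → cls x ≡ j → length (fibre (x ∷ Y) j) ≡ suc (length (fibre Y j))
  fibre-∷-≡ {j = j} Y eq = cong length (filter-accept (λ v → cls v Fin.≟ j) eq)

  fibre-∷-≢ : ∀ {x j} Y → cls x ≢ j → length (fibre (x ∷ Y) j) ≡ length (fibre Y j)
  fibre-∷-≢ {j = j} Y neq = cong length (filter-reject (λ v → cls v Fin.≟ j) neq)

  fibre-≤-∷ : ∀ x Y j → length (fibre Y j) ≤ length (fibre (x ∷ Y) j)
  fibre-≤-∷ x Y j with cls x Fin.≟ j
  ... | yes eq = n≤1+n _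
  ... | no neq = ≤-refl

  Edge-∷ : ∀ {x z Y} → Edge (x ∷ Y) → z ∉ Y → cls z ≡ cls x ⊎ length (fibre Y (cls z)) < ℓ → Edge (z ∷ Y)
  Edge-∷ {x} {z} {Y} (len , _ ∷ u , le) z∉ room = len , All.¬Any⇒All¬ Y z∉ ∷ u , bound room
    where
    bound : cls z ≡ cls x ⊎ length (fibre Y (cls z)) < ℓ → ∀ j → length (fibre (z ∷ Y) j) ≤ ℓ
    bound room j with cls z Fin.≟ j
    bound _ j | no _ = ≤-trans (fibre-≤-∷ x Y j) (le j)
    bound (inj₁ eq) _ | yes refl = subst (_≤ ℓ) (fibre-∷-≡ Y (sym eq)) (le (cls z))
    bound (inj₂ lt) _ | yes refl = lt

  Edge-replace : ∀ {x z e} → Edge e → x ∈ e → z ∉ e → cls z ≡ cls x ⊎ length (fibre e (cls z)) < ℓ →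
    Edge (z ∷ e ∖ x)
  Edge-replace {x} {z} {e} E@(_ , u , _) x∈ z∉ room =
    Edge-∷ (Edge-↭ e↭ E) (z∉ ∘ proj₁ ∘ ∈-∖⁻) (shrink room)
    where
    e↭ : e ↭ x ∷ e ∖ x
    e↭ = ∖-↭ u x∈
    shrink : _ ⊎ length (fibre e (cls z)) < ℓ → _ ⊎ length (fibre (e ∖ x) (cls z)) < ℓ
    shrink (inj₁ eq) = inj₁ eq
    shrink (inj₂ lt) = inj₂ (≤-<-trans
      (≤-trans (fibre-≤-∷ x (e ∖ x) (cls z)) (≤-reflexive (↭-length (filter-↭ _ (↭-sym e↭))))) lt)

  transversal-edge : 1 ≤ ℓ → (u : Fin r → V) → (∀ j → cls (u j) ≡ j) → Edge (tabulate u)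
  transversal-edge 1≤ℓ u cls-u = length-tabulate u , uniq ,
    λ j → ≤-trans (unique-⊆⇒length≤ (Unique.filter⁺ (λ v → cls v Fin.≟ j) uniq) (only j)) 1≤ℓ
    where
    uniq : Unique (tabulate u)
    uniq = Unique.tabulate⁺ λ {i} {j} eq → trans (sym (cls-u i)) (trans (cong cls eq) (cls-u j))
    only : ∀ j {x} → x ∈ fibre (tabulate u) j → x ∈ u j ∷ []
    only j x∈ with ∈-fibre⁻ {xs = tabulate u} x∈
    ... | x∈u , clsx with ∈-tabulate⁻ x∈u
    ... | i , refl = here (cong u (trans (sym (cls-u i)) clsx))

  Mono : Fin k → List V → Set
  Mono i xs = ∀ {x y} → x ∈ xs → y ∈ xs → lab i x ≡ lab i y

  mono? : ∀ i xs → Dec (Mono i xs)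
  mono? i xs with All.all? (λ x → All.all? (λ y → lab i x Fin.≟ lab i y) xs) xs
  ... | yes all = yes λ x∈ y∈ → All.lookup (All.lookup all x∈) y∈
  ... | no ¬all = no λ m → ¬all (All.tabulate λ x∈ → All.tabulate λ y∈ → m x∈ y∈)

  Mono-⊆ : ∀ {i xs ys} → xs ⊆ ys → Mono i ys → Mono i xs
  Mono-⊆ s m x∈ y∈ = m (s x∈) (s y∈)

  Mono-glue : ∀ {i xs ys zs u} → Mono i xs → Mono i ys → u ∈ xs → u ∈ ys →
    (∀ {x} → x ∈ zs → x ∈ xs ⊎ x ∈ ys) → Mono i zs
  Mono-glue {i} {zs = zs} {u} mx my u∈x u∈y cover x∈ y∈ = trans (to-u x∈) (sym (to-u y∈))
    where
    to-u : ∀ {x} → x ∈ zs → lab i x ≡ lab i u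
    to-u x∈ with cover x∈
    ... | inj₁ p = mx p u∈x
    ... | inj₂ p = my p u∈y

  common : List V → List (Fin k)
  common xs = filter (λ i → mono? i xs) (allFin k)

  ∈-common⁺ : ∀ {i xs} → Mono i xs → i ∈ common xs
  ∈-common⁺ {i} {xs} m = ∈-filter⁺ (λ i → mono? i xs) (∈-allFin i) m

  ∈-common⁻ : ∀ {i} xs → i ∈ common xs → Mono i xs
  ∈-common⁻ xs i∈ = proj₂ (∈-filter⁻ (λ i → mono? i xs) {xs = allFin k} i∈)

  common-unique : ∀ xs → Unique (common xs)
  common-unique xs = Unique.filter⁺ (λ i → mono? i xs) (Unique.allFin⁺ k)

  -- A component is named by its colour and any one of its vertices, so several pairs may name the
  -- same one.
  Component : Set
  Component = Fin k × V

  Misses : V → List Component → Set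
  Misses v L = ∀ c → c ∈ L → lab (proj₁ c) v ≢ lab (proj₁ c) (proj₂ c)

  Misses-⊆ : ∀ {v L L′} → L ⊆ L′ → Misses v L′ → Misses v L
  Misses-⊆ s miss c c∈ = miss c (s c∈)

  NoCover : ℕ → Set
  NoCover m = ∀ L → length L ≤ m → ∃[ v ] Misses v L

  NoCover-≤ : ∀ {m m′} → m ≤ m′ → NoCover m′ → NoCover m
  NoCover-≤ m≤ nc L len = nc L (≤-trans len m≤)

  EveryEdgeMono : Set
  EveryEdgeMono = ∀ {e} → Edge e → ∃[ i ] Mono i e

  -- Two distinct vertices with equal labels stand for the statement that colour i is used: a path
  -- between them contains an edge of that colour.
  SpanningLabels : Set
  SpanningLabels = ∀ {i u v} → lab i u ≡ lab i v → u ≢ v → ∀ w → ∃[ e ] Edge e × w ∈ e × Mono i e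

  Minimal : List V → Set
  Minimal e = Edge e × (∀ {f} → Edge f → length (common e) ≤ length (common f))

  -- Descent on the number of common colours. A better edge is obtained only under a double
  -- negation, which is enough because the goal is `⊥`.
  minimal-edge : ∀ {e} → Edge e → (∀ {e} → Minimal e → ⊥) → ⊥
  minimal-edge {e} E no-min = go (<-wellFounded (length (common e))) E
    where
    go : ∀ {e} → Acc _<_ (length (common e)) → Edge e → ⊥
    go (acc rs) E = no-min (E , λ Ef → ≮⇒≥ λ lt → go (rs lt) Ef)

  lost : List V → V → List (Fin k)
  lost e x = filter (λ i → ¬? (mono? i e)) (common (e ∖ x))

  ∈-lost⁺ : ∀ {i e x} → Mono i (e ∖ x) → ¬ Mono i e → i ∈ lost e x
  ∈-lost⁺ {e = e} {x} m ¬m = ∈-filter⁺ (λ i → ¬? (mono? i e)) (∈-common⁺ {xs = e ∖ x} m) ¬m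

  ∈-lost⁻ : ∀ {i} e x → i ∈ lost e x → Mono i (e ∖ x) × ¬ Mono i e
  ∈-lost⁻ e x i∈ with ∈-filter⁻ (λ i → ¬? (mono? i e)) {xs = common (e ∖ x)} i∈
  ... | p , q = ∈-common⁻ (e ∖ x) p , q

  lost-unique : ∀ e x → Unique (lost e x)
  lost-unique e x = Unique.filter⁺ (λ i → ¬? (mono? i e)) (common-unique (e ∖ x))

  Mono-∖⇒ : ∀ {i} e x → Mono i (e ∖ x) → i ∈ common e ⊎ i ∈ lost e x
  Mono-∖⇒ {i} e x m with mono? i e
  ... | yes me = inj₁ (∈-common⁺ {xs = e} me)
  ... | no ¬me = inj₂ (∈-lost⁺ {e = e} m ¬me)

  module NoSingleComponent (edge-mono : EveryEdgeMono) (spanning : SpanningLabels) (3≤r : 3 ≤ r)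
    (nocover : NoCover 1) where

    -- A vertex v outside the component of Y in colour a lies on an edge f that agrees in a, so all
    -- of f is outside that component. As f is larger than Y, some class holds more of f than of Y,
    -- and a vertex of f in that class can be added to Y.
    escape : ∀ {a x Y} → Edge (x ∷ Y) → Mono a Y →
      ∃[ w ] Edge (w ∷ Y) × (∀ {y} → y ∈ Y → lab a w ≢ lab a y)
    -- Y needs two vertices to show that colour a is used; r ≥ 3 provides them.
    escape {Y = []} (len , _) _ = contradiction 3≤r (<⇒≱ (subst (_< 3) len (s≤s (s≤s z≤n))))
    escape {Y = _ ∷ []} (len , _) _ = contradiction 3≤r (<⇒≱ (subst (_< 3) len (s≤s (s≤s (s≤s z≤n)))))
    escape {a} {x} {Y@(y₀ ∷ y₁ ∷ _)} E@(len , _ ∷ (y₀∉ ∷ _) , _) m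
      with nocover ((a , y₀) ∷ []) ≤-refl
    ... | v , miss with spanning (m (here refl) (there (here refl))) (All.lookup y₀∉ (here refl)) v
    ... | f , (lenf , _ , le) , v∈f , mf with larger-fibre f Y (≤-reflexive (trans len (sym lenf)))
    ... | j , lt with fibre f j in eq
    ... | w ∷ _ with ∈-fibre⁻ {xs = f} {j} (subst (w ∈_) (sym eq) (here refl))
    ... | w∈f , refl = w , Edge-∷ E (λ w∈Y → far w∈Y refl) (inj₂ (≤-trans lt (subst (λ l → length l ≤ ℓ) eq (le j)))) , far
      where
      far : ∀ {y} → y ∈ Y → lab a w ≢ lab a y
      far y∈ eq = miss _ (here refl) (trans (mf v∈f w∈f) (trans eq (m y∈ (here refl))))

    -- A third vertex of `e` lies in both remainders and glues them together, so a colour lost at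
    -- both x and y would be common to all of `e`.
    lost-disjoint : ∀ {e x y} → Edge e → x ≢ y → Disjoint (lost e x) (lost e y)
    lost-disjoint {e} {x} {y} (len , u , _) x≢y (p , q)
      with ∃∈∉ {xs = x ∷ y ∷ []} u (subst (3 ≤_) (sym len) 3≤r)
    ... | v , v∈ , v∉ = proj₂ (∈-lost⁻ e x p) (Mono-glue (proj₁ (∈-lost⁻ e x p)) (proj₁ (∈-lost⁻ e y q))
        (∈-∖⁺ v∈ (v∉ ∘ here)) (∈-∖⁺ v∈ (v∉ ∘ there ∘ here)) split)
      where
      split : ∀ {z} → z ∈ e → z ∈ e ∖ x ⊎ z ∈ e ∖ y
      split {z} z∈ with z Fin.≟ x
      ... | yes refl = inj₂ (∈-∖⁺ z∈ x≢y)
      ... | no z≢x = inj₁ (∈-∖⁺ z∈ z≢x)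

    -- Exchange x for a vertex that escapes a common colour a of `e`. If nothing were lost at x, the
    -- new edge would retain only common colours of `e` other than a, against minimality.
    lost-nonempty : ∀ {e x} → Minimal e → x ∈ e → ∃[ i ] i ∈ lost e x
    lost-nonempty {e} {x} (E@(_ , u , _) , min) x∈ with lost e x in eq
    ... | i ∷ _ = i , here refl
    ... | [] with edge-mono E
    ... | a , ma with escape (Edge-↭ (∖-↭ u x∈) E) (Mono-⊆ (proj₁ ∘ ∈-∖⁻) ma)
    ... | w , Ew , far with Mono-y
      where
      Mono-y : ∃[ y ] y ∈ e ∖ x
      Mono-y with ∃∈∉ {xs = x ∷ []} u (subst (2 ≤_) (sym (proj₁ E)) (≤-trans (s≤s (s≤s z≤n)) 3≤r))
      ... | y , y∈ , y∉ = y , ∈-∖⁺ y∈ (y∉ ∘ here)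
    ... | y , y∈ = contradiction (min Ew) (<⇒≱ (unique-⊆⇒length≤
        {xs = a ∷ common (w ∷ e ∖ x)} {ys = common e}
        (All.¬Any⇒All¬ _ (λ a∈ → far y∈ (∈-common⁻ (w ∷ e ∖ x) a∈ (here refl) (there y∈))) ∷ common-unique (w ∷ e ∖ x)) sub))
      where
      sub : ∀ {i} → i ∈ a ∷ common (w ∷ e ∖ x) → i ∈ common e
      sub (here refl) = ∈-common⁺ {xs = e} ma
      sub {i} (there i∈) with Mono-∖⇒ e x (Mono-⊆ there (∈-common⁻ (w ∷ e ∖ x) i∈))
      ... | inj₁ p = p
      ... | inj₂ p with subst (i ∈_) eq p
      ... | ()

-- The upper bound for r ≥ 4 or ℓ ≥ 2

module General {n r k : ℕ} (cls : Fin n → Fin r) (lab : Fin k → Fin n → Fin n) (ℓ : ℕ) where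

  open Labelling cls lab ℓ

  Full : List V → Fin r → Set
  Full e j = length (fibre e j) ≡ ℓ

  -- The pivot is the vertex that gives way to a newcomer in a class that is not full. The counting
  -- must pay for its components: it is the cheapest vertex of a full class or, if no class is full,
  -- the cheapest of all r ≥ ℓ vertices.
  Pivot : (V → ℕ) → List V → V → Set
  Pivot g e y =
    (Full e (cls y) × (∀ {x} → x ∈ e → cls x ≡ cls y → g y ≤ g x)) ⊎
    ((∀ j → length (fibre e j) < ℓ) × (∀ {x} → x ∈ e → g y ≤ g x))

  compsAt : V → List (Fin k) → List Component
  compsAt p = map (_, p)

  misses-compsAt : ∀ {z p is i} → Misses z (compsAt p is) → i ∈ is → lab i z ≢ lab i p
  misses-compsAt {p = p} miss i∈ = miss _ (∈-map⁺ (_, p) i∈)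

  -- One lost colour is left out, which is what brings the number of components down to q + 1.
  tail-lost : List V → V → List Component
  tail-lost e x = compsAt (headOr x (e ∖ x)) (tail (lost e x))

  lost-excess : List V → V → ℕ
  lost-excess e x = pred (length (lost e x))

  tail-lost-short : ∀ e x → length (tail-lost e x) ≤ lost-excess e x
  tail-lost-short e x = ≤-reflexive (trans (length-map _ (tail (lost e x))) (length-tail (lost e x)))

  first-lost : List V → V → Fin k → Component
  first-lost e y o = headOr o (lost e y) , headOr y (e ∖ y)

  -- The second component is the one that tail-lost leaves out at y.
  base-at : List V → V → V → Fin k → List Component
  base-at e y p o = (o , p) ∷ first-lost e y o ∷ []

  lost-component : ∀ {e y p o i} → i ∈ lost e y →
    (i , headOr y (e ∖ y)) ∈ base-at e y p o ++ tail-lost e y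
  lost-component {e} {y} {p} {o} {i} i∈ with ∈-tail {d = o} i∈
  ... | inj₁ refl = there (here refl)
  ... | inj₂ i∈′ = there (there (∈-map⁺ (_, headOr y (e ∖ y)) i∈′))

  Misses-++ : ∀ {v L L′} → Misses v L → Misses v L′ → Misses v (L ++ L′)
  Misses-++ {L = L} m m′ c c∈ with ∈-++⁻ L c∈
  ... | inj₁ p = m c p
  ... | inj₂ p = m′ c p

  module Counting (edge-mono : EveryEdgeMono) (spanning : SpanningLabels) (3≤r : 3 ≤ r)
    (1≤ℓ : 1 ≤ ℓ) (ℓ≤r : ℓ ≤ r) (q : ℕ) (k≤ : k ≤ r + q * ℓ) (nocover : NoCover (suc q)) where

    nocover₁ : NoCover 1
    nocover₁ = NoCover-≤ (s≤s z≤n) nocover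

    open NoSingleComponent edge-mono spanning 3≤r nocover₁

    -- Strictness is due to a common colour of `e`, which is counted along with the disjoint lists
    -- `O x`.
    excess<qℓ : ∀ {e} → Edge e → (O : V → List (Fin k)) (g : V → ℕ) →
      (∀ {x} → x ∈ e → suc (g x) ≤ length (O x)) →
      (∀ {x} → x ∈ e → Unique (O x)) →
      (∀ {x y} → x ∈ e → y ∈ e → x ≢ y → Disjoint (O x) (O y)) →
      (∀ {x} → x ∈ e → Disjoint (common e) (O x)) →
      sumOf g e < q * ℓ
    excess<qℓ {e} E@(len , u , _) O g g< uO dis disT = +-cancelˡ-≤ r _ _ (begin
      r + suc (sumOf g e)                        ≡⟨ +-suc r _ ⟩
      suc (r + sumOf g e)                        ≤⟨ s≤s (≤-reflexive (cong (_+ sumOf g e) (sym (trans (sumOf-const-1 e) len)))) ⟩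
      suc (sumOf (λ _ → 1) e + sumOf g e)        ≡⟨ cong suc (sumOf-+ (λ _ → 1) g e) ⟨
      1 + sumOf (λ x → suc (g x)) e              ≤⟨ +-mono-≤ 1≤t (sumOf-mono e g<) ⟩
      length (common e) + sumOf (length ∘ O) e   ≡⟨ cong (length (common e) +_) (length-concatMap O e) ⟨
      length (common e) + length (concatMap O e) ≡⟨ length-++ (common e) ⟨
      length (common e ++ concatMap O e)         ≤⟨ unique⇒length≤ uniq ⟩
      k                                          ≤⟨ k≤ ⟩
      r + q * ℓ                                  ∎)
      where
      open ≤-Reasoning
      1≤t : 1 ≤ length (common e)
      1≤t = ∈-length (∈-common⁺ {xs = e} (proj₂ (edge-mono E)))
      uniq : Unique (common e ++ concatMap O e)
      uniq = Unique.++⁺ (common-unique e) (concatMap-unique O u uO dis)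
        λ { (i∈ , i∈′) → let (x , x∈ , i∈O) = find (∈-concatMap⁻ O {e} i∈′) in disT x∈ (i∈ , i∈O) }

    full-fibre : ∀ {e j} → Full e j → ∃[ x ] x ∈ fibre e j
    full-fibre {e} {j} full with fibre e j
    ... | x ∷ _ = x , here refl
    ... | [] = contradiction 1≤ℓ (<⇒≱ (≤-reflexive (cong suc (sym full))))

    pivot : ∀ {e} → Edge e → (g : V → ℕ) → ∃[ y ] y ∈ e × Pivot g e y
    pivot {e} (len , _ , le) g with Fin.any? (λ j → length (fibre e j) ≟ ℓ)
    pivot {e} (len , _ , le) g | yes (j , full) with minimiser g (fibre e j) (proj₂ (full-fibre {e} {j} full))
    ... | y , y∈ , min with ∈-fibre⁻ {xs = e} {j} y∈
    ... | y∈e , refl = y , y∈e , inj₁ (full , λ {x} x∈ eq →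
      min (subst (λ j → x ∈ fibre e j) eq (∈-fibre⁺ x∈)))
    pivot {[]} (len , _) g | no _ = contradiction 3≤r (<⇒≱ (subst (_< 3) len (s≤s z≤n)))
    pivot {x ∷ e} (len , _ , le) g | no none with minimiser g (x ∷ e) (here refl)
    ... | y , y∈ , min = y , y∈ , inj₂ ((λ j → ≤∧≢⇒< (le j) (λ full → none (j , full))) , min)

    -- Choosing x in each full class with g x minimal, the lists comp x have total length less
    -- than q; a vertex left out by them and by two more components can replace such an x.
    replaceable : ∀ {e} → Edge e → (g : V → ℕ) (comp : V → List Component) →
      (∀ {x} → x ∈ e → length (comp x) ≤ g x) → sumOf g e < q * ℓ →
      ∀ {y} → y ∈ e → Pivot g e y → (base : List Component) → length base ≡ 2 →
      ∃[ z ] ∃[ x ] x ∈ e × Misses z base × Misses z (comp y) × Misses z (comp x) ×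
        (cls z ≡ cls x ⊎ length (fibre e (cls z)) < ℓ) ×
        (x ≡ y ⊎ (cls x ≢ cls y × Full e (cls x) × Full e (cls y)))
    replaceable {e} E@(len , _ , le) g comp comp≤ g< {y} y∈ (inj₂ (room , min)) base base≡2
      with nocover (base ++ comp y) (begin
        length (base ++ comp y)      ≡⟨ length-++ base ⟩
        length base + length (comp y) ≤⟨ +-mono-≤ (≤-reflexive base≡2) (comp≤ y∈) ⟩
        suc (suc (g y))              ≤⟨ s≤s (*-cancelʳ-< ℓ (g y) q (begin-strict
          g y * ℓ                      ≡⟨ *-comm (g y) ℓ ⟩
          ℓ * g y                      ≤⟨ *-monoˡ-≤ (g y) ℓ≤r ⟩
          r * g y                      ≡⟨ cong (_* g y) len ⟨
          length e * g y               ≤⟨ length*≤sumOf e min ⟩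
          sumOf g e                    <⟨ g< ⟩
          q * ℓ                        ∎)) ⟩
        suc q                        ∎)
      where open ≤-Reasoning
    ... | z , miss = z , y , y∈ , Misses-⊆ ∈-++⁺ˡ miss , Misses-⊆ (∈-++⁺ʳ base) miss , Misses-⊆ (∈-++⁺ʳ base) miss ,
      inj₂ (room (cls z)) , inj₁ refl
    replaceable {e} E@(len , _ , le) g comp comp≤ g< {y} y∈ (inj₁ (full-y , min)) base base≡2 = result
      where
      open ≤-Reasoning
      -- The factor ℓ replaces a division: in a full class the cheapest of ℓ vertices costs at most
      -- an ℓ-th of the whole class. A class that is not full contributes nothing, because the pivot
      -- gives way there.
      Pick : Fin r → List Component → Set
      Pick j ρ = (ℓ * length ρ ≤ sumOf g (fibre e j)) × (cls y ≡ j → ρ ≡ comp y) ×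
        (Full e j → ∃[ x ] x ∈ e × cls x ≡ j × ρ ≡ comp x × (x ≡ y ⊎ cls x ≢ cls y))
      light : ∀ {j x} → x ∈ e → Full e j → (∀ {v} → v ∈ fibre e j → g x ≤ g v) →
        ℓ * length (comp x) ≤ sumOf g (fibre e j)
      light {j} {x} x∈ full min = begin
        ℓ * length (comp x)         ≤⟨ *-monoʳ-≤ ℓ (comp≤ x∈) ⟩
        ℓ * g x                     ≡⟨ cong (_* g x) full ⟨
        length (fibre e j) * g x    ≤⟨ length*≤sumOf (fibre e j) min ⟩
        sumOf g (fibre e j)         ∎
      pick : ∀ j → ∃ (Pick j)
      pick j with cls y Fin.≟ j
      ... | yes refl = comp y ,
        light y∈ full-y (λ v∈ → let (v∈e , eq) = ∈-fibre⁻ {xs = e} v∈ in min v∈e eq) ,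
        (λ _ → refl) , λ _ → y , y∈ , refl , refl , inj₁ refl
      ... | no ≢j with length (fibre e j) ≟ ℓ
      ... | no ¬full = [] , ≤-trans (≤-reflexive (*-zeroʳ ℓ)) z≤n , (λ eq → contradiction eq ≢j) ,
        λ full → contradiction full ¬full
      ... | yes full with minimiser g (fibre e j) (proj₂ (full-fibre {e} {j} full))
      ... | x , x∈ , min-x with ∈-fibre⁻ {xs = e} x∈
      ... | x∈e , refl = comp x , light x∈e full min-x , (λ eq → contradiction eq ≢j) ,
        λ _ → x , x∈e , refl , refl , inj₂ (≢-sym ≢j)
      ρ : Fin r → List Component
      ρ = proj₁ ∘ pick
      few : ∑ (length ∘ ρ) < q
      few = *-cancelˡ-< ℓ _ q (begin-strict
        ℓ * ∑ (length ∘ ρ)               ≡⟨ ∑-* ℓ (length ∘ ρ) ⟩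
        ∑ (λ j → ℓ * length (ρ j))       ≤⟨ ∑-mono (λ j → proj₁ (proj₂ (pick j))) ⟩
        ∑ (λ j → sumOf g (fibre e j))    ≡⟨ sumOf-fibres g e ⟩
        sumOf g e                        <⟨ g< ⟩
        q * ℓ                            ≡⟨ *-comm q ℓ ⟩
        ℓ * q                            ∎)
      L : List Component
      L = base ++ concat (tabulate ρ)
      short : length L ≤ suc q
      short = begin
        length L                                       ≡⟨ length-++ base ⟩
        length base + length (concat (tabulate ρ))     ≡⟨ cong₂ _+_ base≡2 (length-concat-tabulate ρ) ⟩
        suc (suc (∑ (length ∘ ρ)))                     ≤⟨ s≤s few ⟩
        suc q                                          ∎
      in-L : ∀ {j c} → c ∈ ρ j → c ∈ L
      in-L {j} c∈ = ∈-++⁺ʳ base (∈-concat⁺′ c∈ (∈-tabulate⁺ {f = ρ} j))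
      in-L-comp-y : ∀ {c} → c ∈ comp y → c ∈ L
      in-L-comp-y {c} c∈ = in-L {cls y} (subst (c ∈_) (sym (proj₁ (proj₂ (proj₂ (pick (cls y)))) refl)) c∈)
      result : _
      result with nocover L short
      ... | z , miss with length (fibre e (cls z)) ≟ ℓ
      ... | no ¬full = z , y , y∈ , Misses-⊆ ∈-++⁺ˡ miss , Misses-⊆ in-L-comp-y miss , Misses-⊆ in-L-comp-y miss ,
        inj₂ (≤∧≢⇒< (le (cls z)) ¬full) , inj₁ refl
      ... | yes full with proj₂ (proj₂ (proj₂ (pick (cls z)))) full
      ... | x , x∈ , cls-x , ρ≡ , other = z , x , x∈ , Misses-⊆ ∈-++⁺ˡ miss , Misses-⊆ in-L-comp-y miss ,
        Misses-⊆ (λ {c} c∈ → in-L {cls z} (subst (c ∈_) (sym ρ≡) c∈)) miss , inj₁ (sym cls-x) , far other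
        where
        far : x ≡ y ⊎ cls x ≢ cls y → _
        far (inj₁ eq) = inj₁ eq
        far (inj₂ neq) = inj₂ (neq , subst (Full e) (sym cls-x) full , full-y)

    lost-excess<qℓ : ∀ {e} → Minimal e → sumOf (lost-excess e) e < q * ℓ
    lost-excess<qℓ {e} M@(E , _) = excess<qℓ E (lost e) (lost-excess e) grow (λ {x} _ → lost-unique e x)
      (λ _ _ → lost-disjoint E) λ {x} _ (p , q) → proj₂ (∈-lost⁻ e x q) (∈-common⁻ e p)
      where
      grow : ∀ {x} → x ∈ e → suc (lost-excess e x) ≤ length (lost e x)
      grow {x} x∈ with lost e x | lost-nonempty M x∈
      ... | _ ∷ _ | _ = ≤-refl

    another : ∀ {e} → Edge e → ∀ x → ∃[ y ] y ∈ e ∖ x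
    another (len , u , _) x with ∃∈∉ {xs = x ∷ []} u (subst (2 ≤_) (sym len) (≤-trans (s≤s (s≤s z≤n)) 3≤r))
    ... | y , y∈ , y∉ = y , ∈-∖⁺ y∈ (y∉ ∘ here)

    -- The new edge keeps colours of `e` or gains colours lost at x, and z misses the components of
    -- all the latter but the first. The default of `headOr` does no harm: the second alternative
    -- arises only when `lost e x` contains i.
    survivor : ∀ {e x z i} → Edge e → Mono i (z ∷ e ∖ x) →
      Misses z (tail-lost e x) → i ∈ common e ⊎ i ≡ headOr i (lost e x)
    survivor {e} {x} {z} {i} E m miss with Mono-∖⇒ e x (Mono-⊆ there m)
    ... | inj₁ p = inj₁ p
    ... | inj₂ p with ∈-tail {d = i} p
    ... | inj₁ eq = inj₂ eq
    ... | inj₂ i∈ = contradiction (m (here refl) (there (headOr∈ (proj₂ (another E x)))))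
      (misses-compsAt miss i∈)

    edge-vertex : ∀ {e} → Edge e → ∃[ p ] p ∈ e
    edge-vertex E with another E (headOr′ E)
      where
      headOr′ : ∀ {e} → Edge e → V
      headOr′ {x ∷ _} _ = x
      headOr′ {[]} (len , _) = contradiction 3≤r (<⇒≱ (subst (_< 3) len (s≤s z≤n)))
    ... | p , p∈ = p , proj₁ (∈-∖⁻ p∈)

    -- The vertex z gives up both a and b, while at most one lost colour is gained, so the new edge
    -- has fewer common colours than `e`.
    two-common : ∀ {e a b T} → Minimal e → common e ≡ a ∷ b ∷ T → ⊥
    two-common {e} {a} {b} {T} M@(E , min) eq with edge-vertex E | pivot E (lost-excess e)
    ... | p , p∈ | y , y∈ , piv
      with replaceable E (lost-excess e) (tail-lost e) (λ {x} _ → tail-lost-short e x) (lost-excess<qℓ M)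
             y∈ piv ((a , p) ∷ (b , p) ∷ []) refl
    ... | z , x , x∈ , miss , _ , missx , room , _
      = contradiction (min Ef) (<⇒≱ (subst (λ T′ → length (common f) < length T′) (sym eq)
          (s≤s (unique-⊆⇒length≤ (common-unique f) sub))))
      where
      f : List V
      f = z ∷ e ∖ x
      common-a : ∀ {i} → i ∈ a ∷ b ∷ T → Mono i e
      common-a i∈ = ∈-common⁻ e (subst (_ ∈_) (sym eq) i∈)
      z∉ : z ∉ e
      z∉ z∈ = miss _ (here refl) (common-a (here refl) z∈ p∈)
      Ef : Edge f
      Ef = Edge-replace E x∈ z∉ room
      off : ∀ {i} → i ∈ (a ∷ b ∷ T) → (i , p) ∈ (a , p) ∷ (b , p) ∷ [] → ¬ Mono i f
      off i∈T i∈ m with another E x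
      ... | v , v∈ = miss _ i∈ (trans (m (here refl) (there v∈)) (common-a i∈T (proj₁ (∈-∖⁻ v∈)) p∈))
      sub : ∀ {i} → i ∈ common f → i ∈ headOr a (lost e x) ∷ T
      sub {i} i∈ with ∈-common⁻ f i∈
      ... | m with survivor E m missx
      sub {i} i∈ | m | inj₂ i≡ with lost e x | lost-nonempty M x∈
      ... | _ ∷ _ | _ = here i≡
      sub {i} i∈ | m | inj₁ i∈T with subst (i ∈_) eq i∈T
      ... | here refl = ⊥-elim (off (here refl) (here refl) m)
      ... | there (here refl) = ⊥-elim (off (there (here refl)) (there (here refl)) m)
      ... | there (there i∈T′) = there i∈T′

    -- Minimal edges with a single common colour

    module OneCommon {e o p} (M : Minimal e) (only : common e ≡ o ∷ []) (p∈ : p ∈ e) where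

      E : Edge e
      E = proj₁ M

      mono-o : Mono o e
      mono-o = ∈-common⁻ e (subst (o ∈_) (sym only) (here refl))

      common⇒o : ∀ {i} → i ∈ common e → i ≡ o
      common⇒o i∈ with subst (_ ∈_) only i∈
      ... | here eq = eq

      misses⇒∉ : ∀ {y z} → Misses z (base-at e y p o) → z ∉ e
      misses⇒∉ miss z∈ = miss _ (here refl) (mono-o z∈ p∈)

      misses-o : ∀ {y z v} → Misses z (base-at e y p o) → v ∈ e → lab o z ≢ lab o v
      misses-o miss v∈ eq = miss _ (here refl) (trans eq (mono-o v∈ p∈))

      -- The new edge must have a common colour, but z misses o and every colour lost at y:
      -- `base-at` accounts for the first of these and `tail-lost` for the rest.
      not-at-pivot : ∀ {y z} → y ∈ e → Misses z (base-at e y p o) → Misses z (tail-lost e y) →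
        cls z ≡ cls y ⊎ length (fibre e (cls z)) < ℓ → ⊥
      not-at-pivot {y} {z} y∈ missb missy room
        with edge-mono (Edge-replace E y∈ (misses⇒∉ missb) room) | another E y
      ... | i , m | v , v∈ with Mono-∖⇒ e y (Mono-⊆ there m)
      ... | inj₁ i∈ with common⇒o i∈
      ... | refl = misses-o missb (proj₁ (∈-∖⁻ v∈)) (m (here refl) (there v∈))
      not-at-pivot {y} {z} y∈ missb missy room | i , m | v , v∈ | inj₂ i∈ =
        Misses-++ missb missy _ (lost-component {e} {y} {p} {o} i∈) (m (here refl) (there (headOr∈ v∈)))

      -- Replacing a vertex other than the pivot presupposes two full classes, hence at least four
      -- vertices in `e`.
      triple : 2 ≤ ℓ → r < 4 → ⊥
      triple 2≤ℓ r<4 with pivot E (lost-excess e)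
      ... | y , y∈ , piv
        with replaceable E (lost-excess e) (tail-lost e) (λ {x} _ → tail-lost-short e x) (lost-excess<qℓ M)
               y∈ piv (base-at e y p o) refl
      ... | z , x , x∈ , missb , missy , missx , room , inj₁ refl = not-at-pivot y∈ missb missy room
      ... | z , x , x∈ , missb , missy , missx , room , inj₂ (x≢y , full-x , full-y) = <⇒≱ r<4 (begin
        4                                                          ≤⟨ +-mono-≤ 2≤ℓ 2≤ℓ ⟩
        ℓ + ℓ                                                      ≡⟨ cong₂ _+_ full-x full-y ⟨
        length (fibre e (cls x)) + length (fibre e (cls y))        ≡⟨ length-++ (fibre e (cls x)) ⟨
        length (fibre e (cls x) ++ fibre e (cls y))                ≤⟨ unique-⊆⇒length≤ uniq sub ⟩
        length e                                                   ≡⟨ proj₁ E ⟩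
        r                                                          ∎)
        where
        open ≤-Reasoning
        uniq : Unique (fibre e (cls x) ++ fibre e (cls y))
        uniq = Unique.++⁺ (Unique.filter⁺ _ (proj₁ (proj₂ E))) (Unique.filter⁺ _ (proj₁ (proj₂ E)))
          λ { (v∈ , v∈′) → x≢y (trans (sym (proj₂ (∈-fibre⁻ {xs = e} v∈))) (proj₂ (∈-fibre⁻ {xs = e} v∈′))) }
        sub : fibre e (cls x) ++ fibre e (cls y) ⊆ e
        sub v∈ with ∈-++⁻ (fibre e (cls x)) v∈
        ... | inj₁ q = proj₁ (∈-fibre⁻ {xs = e} q)
        ... | inj₂ q = proj₁ (∈-fibre⁻ {xs = e} q)

      module Large (4≤r : 4 ≤ r) (y : V) (y∈ : y ∈ e) where

        -- The components of lost colours at x do not suffice here; for 4 ≤ r also the colours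
        -- shared by e ∖ x ∖ y alone can be charged to x without counting a colour twice.
        owned : V → List (Fin k)
        owned x with x Fin.≟ y
        ... | yes _ = lost e y
        ... | no _ = filter (λ i → ¬? (mono? i (e ∖ y))) (common (e ∖ x ∖ y))

        owned-y : owned y ≡ lost e y
        owned-y with y Fin.≟ y
        ... | yes _ = refl
        ... | no neq = contradiction refl neq

        ∈-owned⁺ : ∀ {x i} → x ≢ y → Mono i (e ∖ x ∖ y) → ¬ Mono i (e ∖ y) → i ∈ owned x
        ∈-owned⁺ {x} {i} x≢y m ¬m with x Fin.≟ y
        ... | yes eq = contradiction eq x≢y
        ... | no _ = ∈-filter⁺ (λ i → ¬? (mono? i (e ∖ y))) (∈-common⁺ {xs = e ∖ x ∖ y} m) ¬m

        ∈-owned⁻ : ∀ {x i} → x ≢ y → i ∈ owned x → Mono i (e ∖ x ∖ y) × ¬ Mono i (e ∖ y)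
        ∈-owned⁻ {x} {i} x≢y i∈ with x Fin.≟ y
        ... | yes eq = contradiction eq x≢y
        ... | no _ with ∈-filter⁻ (λ i → ¬? (mono? i (e ∖ y))) {xs = common (e ∖ x ∖ y)} i∈
        ... | q , ¬m = ∈-common⁻ (e ∖ x ∖ y) q , ¬m

        owned-unique : ∀ x → Unique (owned x)
        owned-unique x with x Fin.≟ y
        ... | yes _ = lost-unique e y
        ... | no _ = Unique.filter⁺ _ (common-unique (e ∖ x ∖ y))

        fourth : ∀ x x′ → ∃[ v ] v ∈ e × v ≢ x × v ≢ x′ × v ≢ y
        fourth x x′ with ∃∈∉ {xs = x ∷ x′ ∷ y ∷ []} (proj₁ (proj₂ E)) (subst (4 ≤_) (sym (proj₁ E)) 4≤r)
        ... | v , v∈ , v∉ = v , v∈ , v∉ ∘ here , v∉ ∘ there ∘ here , v∉ ∘ there ∘ there ∘ here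

        ∈-∖∖⁺ : ∀ {x v} → v ∈ e → v ≢ x → v ≢ y → v ∈ e ∖ x ∖ y
        ∈-∖∖⁺ {x} v∈ v≢x = ∈-∖⁺ {xs = e ∖ x} (∈-∖⁺ v∈ v≢x)

        ∖∖⊆∖ : ∀ {x} → e ∖ x ∖ y ⊆ e ∖ y
        ∖∖⊆∖ {x} w∈ = let (w∈′ , w≢y) = ∈-∖⁻ {xs = e ∖ x} w∈ in ∈-∖⁺ (proj₁ (∈-∖⁻ {x = x} {xs = e} w∈′)) w≢y

        -- A colour lost at x that also agreed on `e` without y would be lost at both x and y.
        lost⊆owned : ∀ {x} → lost e x ⊆ owned x
        lost⊆owned {x} {i} i∈ = by-cases (x Fin.≟ y)
          where
          by-cases : Dec (x ≡ y) → i ∈ owned x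
          by-cases (yes refl) = subst (i ∈_) (sym owned-y) i∈
          by-cases (no x≢y) with ∈-lost⁻ e x i∈
          ... | m , ¬m = ∈-owned⁺ x≢y (Mono-⊆ (proj₁ ∘ ∈-∖⁻) m)
            λ my → lost-disjoint E x≢y (i∈ , ∈-lost⁺ {e = e} my ¬m)

        -- A vertex other than x, x′ and y glues the two remainders, so a colour owned by both would
        -- agree on all of `e` except y. Here 4 ≤ r enters.
        owned-disjoint : ∀ {x x′} → x ≢ x′ → Disjoint (owned x) (owned x′)
        owned-disjoint {x} {x′} x≢x′ {i} (i∈ , i∈′) = by-cases (x Fin.≟ y) (x′ Fin.≟ y)
          where
          by-cases : Dec (x ≡ y) → Dec (x′ ≡ y) → ⊥
          by-cases (yes refl) (yes refl) = x≢x′ refl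
          by-cases (yes refl) (no x′≢) = proj₂ (∈-owned⁻ x′≢ i∈′) (proj₁ (∈-lost⁻ e y (subst (i ∈_) owned-y i∈)))
          by-cases (no x≢) (yes refl) = proj₂ (∈-owned⁻ x≢ i∈) (proj₁ (∈-lost⁻ e y (subst (i ∈_) owned-y i∈′)))
          by-cases (no x≢) (no x′≢) with ∈-owned⁻ x≢ i∈ | ∈-owned⁻ x′≢ i∈′ | fourth x x′
          ... | m , ¬m | m′ , _ | v , v∈ , v≢x , v≢x′ , v≢y =
            ¬m (Mono-glue m m′ (∈-∖∖⁺ v∈ v≢x v≢y) (∈-∖∖⁺ v∈ v≢x′ v≢y) split)
            where
            split : ∀ {w} → w ∈ e ∖ y → w ∈ e ∖ x ∖ y ⊎ w ∈ e ∖ x′ ∖ y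
            split {w} w∈ with ∈-∖⁻ w∈ | w Fin.≟ x
            ... | w∈e , w≢y | yes refl = inj₂ (∈-∖∖⁺ w∈e x≢x′ w≢y)
            ... | w∈e , w≢y | no w≢x = inj₁ (∈-∖∖⁺ w∈e w≢x w≢y)

        common-owned-disjoint : ∀ x → Disjoint (common e) (owned x)
        common-owned-disjoint x {i} (i∈ , i∈′) = by-cases (x Fin.≟ y)
          where
          by-cases : Dec (x ≡ y) → ⊥
          by-cases (yes refl) = proj₂ (∈-lost⁻ e y (subst (i ∈_) owned-y i∈′)) (∈-common⁻ e i∈)
          by-cases (no x≢) = proj₂ (∈-owned⁻ x≢ i∈′) (Mono-⊆ (proj₁ ∘ ∈-∖⁻) (∈-common⁻ e i∈))

        owned-excess : V → ℕ
        owned-excess x = pred (length (owned x))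

        owned-excess<qℓ : sumOf owned-excess e < q * ℓ
        owned-excess<qℓ = excess<qℓ E owned owned-excess grow (λ {x} _ → owned-unique x)
          (λ _ _ → owned-disjoint) (λ {x} _ → common-owned-disjoint x)
          where
          grow : ∀ {x} → x ∈ e → suc (owned-excess x) ≤ length (owned x)
          grow {x} x∈ with owned x | lost⊆owned (proj₂ (lost-nonempty M x∈))
          ... | _ ∷ _ | _ = ≤-refl

        excess≤ : ∀ x → lost-excess e x ≤ owned-excess x
        excess≤ x = pred-mono-≤ (unique-⊆⇒length≤ (lost-unique e x) lost⊆owned)

        -- Since `owned` depends on y, it cannot be used to choose y. Choosing by `lost-excess` is
        -- enough: passing to `owned` leaves the value at y unchanged and never lowers another.
        owned-pivot : Pivot (lost-excess e) e y → Pivot owned-excess e y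
        owned-pivot (inj₁ (full , min)) = inj₁ (full , λ {x} x∈ eq → begin
          owned-excess y    ≡⟨ cong (pred ∘ length) owned-y ⟩
          lost-excess e y   ≤⟨ min x∈ eq ⟩
          lost-excess e x   ≤⟨ excess≤ x ⟩
          owned-excess x    ∎)
          where open ≤-Reasoning
        owned-pivot (inj₂ (room , min)) = inj₂ (room , λ {x} x∈ → begin
          owned-excess y    ≡⟨ cong (pred ∘ length) owned-y ⟩
          lost-excess e y   ≤⟨ min x∈ ⟩
          lost-excess e x   ≤⟨ excess≤ x ⟩
          owned-excess x    ∎)
          where open ≤-Reasoning

        open Removal {A = Fin k} Fin._≟_ using () renaming (_∖_ to _-_; ∖-↭ to -↭; ∈-∖⁺ to ∈-⁺)

        -- The colour spared at x is the first one lost there: x owns it, and minimality guarantees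
        -- that it exists.
        others comp : V → List Component
        others x = compsAt (headOr x (e ∖ x ∖ y)) (owned x - headOr o (lost e x))
        comp x = if does (x Fin.≟ y) then tail-lost e y else others x

        comp-y : comp y ≡ tail-lost e y
        comp-y = cong (if_then tail-lost e y else others y) (dec-true (y Fin.≟ y) refl)

        comp-≢ : ∀ {x} → x ≢ y → comp x ≡ others x
        comp-≢ {x} x≢y = cong (if_then tail-lost e y else others x) (dec-false (x Fin.≟ y) x≢y)

        comp-short : ∀ {x} → x ∈ e → length (comp x) ≤ owned-excess x
        comp-short {x} x∈ = by-cases (x Fin.≟ y)
          where
          open ≤-Reasoning
          h : Fin k
          h = headOr o (lost e x)
          by-cases : Dec (x ≡ y) → length (comp x) ≤ owned-excess x
          by-cases (yes refl) = begin
            length (comp y)          ≡⟨ cong length comp-y ⟩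
            length (tail-lost e y)   ≤⟨ tail-lost-short e y ⟩
            lost-excess e y          ≡⟨ cong (pred ∘ length) owned-y ⟨
            owned-excess y           ∎
          by-cases (no x≢y) = begin
            length (comp x)                 ≡⟨ trans (cong length (comp-≢ x≢y)) (length-map _ (owned x - h)) ⟩
            length (owned x - h)            ≡⟨ cong pred (↭-length (-↭ (owned-unique x)
                                                 (lost⊆owned (headOr∈ (proj₂ (lost-nonempty M x∈)))))) ⟨
            owned-excess x                  ∎

        contradict : Pivot (lost-excess e) e y → ⊥
        contradict piv with replaceable E owned-excess comp comp-short owned-excess<qℓ
               y∈ (owned-pivot piv) (base-at e y p o) refl
        ... | z , x , x∈ , missb , missy , missx , room , inj₁ refl =
          not-at-pivot y∈ missb (subst (Misses z) comp-y missy) room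
        ... | z , x , x∈ , missb , missy , missx , room , inj₂ (cx≢cy , _)
          with edge-mono (Edge-replace E x∈ (misses⇒∉ missb) room) | fourth x x
        ... | i , m | v , v∈ , v≢x , _ , v≢y = second-colour
          where
          x≢y : x ≢ y
          x≢y refl = cx≢cy refl
          y∈∖ : y ∈ e ∖ x
          y∈∖ = ∈-∖⁺ y∈ (≢-sym x≢y)
          v∈∖ : v ∈ e ∖ x ∖ y
          v∈∖ = ∈-∖∖⁺ v∈ v≢x v≢y
          -- `W` is what remains of the new edge when the pivot gives way too. The only colour in
          -- which it can agree is the one spared at x.
          W : List V
          W = z ∷ e ∖ x ∖ y
          missed : ∀ {c} → Mono c W → c ∈ owned x → c ≡ headOr o (lost e x)
          missed {c} mc c∈ with c Fin.≟ headOr o (lost e x)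
          ... | yes eq = eq
          ... | no neq = ⊥-elim (misses-compsAt (subst (Misses z) (comp-≢ x≢y) missx) (∈-⁺ c∈ neq)
            (mc (here refl) (there (headOr∈ v∈∖))))
          ¬o : ¬ Mono o W
          ¬o mo = misses-o missb v∈ (mo (here refl) (there v∈∖))
          owned-colour : ∀ {c} → Mono c W → c ∈ owned x
          owned-colour {c} mc with mono? c (e ∖ y)
          ... | no ¬my = ∈-owned⁺ x≢y (Mono-⊆ there mc) ¬my
          ... | yes my with Mono-∖⇒ e y my
          ... | inj₁ c∈ with common⇒o c∈
          ... | refl = ⊥-elim (¬o mc)
          owned-colour {c} mc | yes my | inj₂ c∈ =
            ⊥-elim (Misses-++ missb (subst (Misses z) comp-y missy) _ (lost-component {e} {y} {p} {o} c∈)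
              (trans (mc (here refl) (there v∈∖)) (my (∖∖⊆∖ {x} v∈∖) (headOr∈ (∖∖⊆∖ {x} v∈∖)))))
          the-colour : ∀ {c} → Mono c W → c ≡ headOr o (lost e x)
          the-colour mc = missed mc (owned-colour mc)
          mW : Mono i W
          mW = Mono-⊆ (λ { (here refl) → here refl ; (there w∈) → there (proj₁ (∈-∖⁻ w∈)) }) m
          EW : Edge (y ∷ W)
          EW = Edge-↭ (↭-trans (prep z (∖-↭ (Unique.filter⁺ _ (proj₁ (proj₂ E))) y∈∖)) (swap z y ↭-refl))
            (Edge-replace E x∈ (misses⇒∉ missb) room)
          -- Exchanging y for a vertex that escapes the colour i of `W` yields an edge whose common
          -- colour would again be the spared one, that is, i itself.
          second-colour : ⊥
          second-colour with escape EW mW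
          ... | w , Ew , far with edge-mono Ew
          ... | c , mc with trans (the-colour (Mono-⊆ there mc)) (sym (the-colour mW))
          ... | refl = far (here refl) (mc (here refl) (there (here refl)))

      many : 4 ≤ r → ⊥
      many 4≤r with pivot E (lost-excess e)
      ... | y , y∈ , piv = Large.contradict 4≤r y y∈ piv

    one-common : ∀ {e} → Minimal e → ∃[ o ] common e ≡ o ∷ []
    one-common {e} M with common e in eq | ∈-common⁺ {xs = e} (proj₂ (edge-mono (proj₁ M)))
    ... | o ∷ [] | _ = o , refl
    ... | _ ∷ _ ∷ _ | _ = ⊥-elim (two-common M eq)

    not-uncoverable : 4 ≤ r ⊎ 2 ≤ ℓ → ∀ {e} → Edge e → ⊥
    not-uncoverable big E = minimal-edge E λ M → go big M (one-common M) (edge-vertex (proj₁ M))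
      where
      go : 4 ≤ r ⊎ 2 ≤ ℓ → ∀ {e} → Minimal e → (∃[ o ] common e ≡ o ∷ []) → (∃[ p ] p ∈ e) → ⊥
      go big M (o , only) (p , p∈) with 4 ≤? r | big
      ... | yes 4≤r | _ = OneCommon.many M only p∈ 4≤r
      ... | no 4≰r | inj₁ 4≤r = 4≰r 4≤r
      ... | no 4≰r | inj₂ 2≤ℓ = OneCommon.triple M only p∈ 2≤ℓ (≰⇒> 4≰r)

-- Three classes, ℓ = 1

module Tripartite {n k : ℕ} (cls : Fin n → Fin 3) (lab : Fin k → Fin n → Fin n) where

  Same : Fin k → Fin n → Fin n → Set
  Same i x y = lab i x ≡ lab i y

  same? : ∀ i x y → Dec (Same i x y)
  same? i x y = lab i x Fin.≟ lab i y

  record Transversal (a b c : Fin n) : Set where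
    constructor transversal
    field
      a≢b : cls a ≢ cls b
      b≢c : cls b ≢ cls c
      a≢c : cls a ≢ cls c

  open Transversal public

  rotate : ∀ {a b c} → Transversal a b c → Transversal b c a
  rotate t = transversal (b≢c t) (≢-sym (a≢c t)) (≢-sym (a≢b t))

  exchange : ∀ {a b c} → Transversal a b c → Transversal b a c
  exchange t = transversal (≢-sym (a≢b t)) (a≢c t) (b≢c t)

  replace : ∀ {a b c w} → Transversal a b c → cls w ≡ cls a → Transversal w b c
  replace t eq = transversal (a≢b t ∘ trans (sym eq)) (b≢c t) (a≢c t ∘ trans (sym eq))

  some-class : ∀ {a b c} → Transversal a b c → ∀ z → cls z ≡ cls a ⊎ cls z ≡ cls b ⊎ cls z ≡ cls c
  some-class {a} {b} {c} t z with cls z Fin.≟ cls a | cls z Fin.≟ cls b | cls z Fin.≟ cls c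
  ... | yes p | _ | _ = inj₁ p
  ... | no _ | yes p | _ = inj₂ (inj₁ p)
  ... | no _ | no _ | yes p = inj₂ (inj₂ p)
  ... | no p | no q | no s = contradiction (unique⇒length≤ four) λ { (s≤s (s≤s (s≤s ()))) }
    where
    four : AllPairs _≢_ (cls z ∷ cls a ∷ cls b ∷ cls c ∷ [])
    four = (p ∷ q ∷ s ∷ []) ∷ (a≢b t ∷ a≢c t ∷ []) ∷ (b≢c t ∷ []) ∷ [] ∷ []

  -- All that is used about edges here. `shared-again` comes from letting the third vertex escape
  -- colour i, `into-class` from spanning together with the fact that every edge meets all three
  -- classes.
  record Facts : Set where
    field
      shared : ∀ {a b c} → Transversal a b c → ∃[ i ] Same i a b × Same i b c
      shared-again : ∀ {a b c i} → Transversal a b c → Same i a b → ∃[ j ] j ≢ i × Same j a b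
      into-class : ∀ {a b c i} → Transversal a b c → Same i a b → ∀ x j → ∃[ w ] cls w ≡ j × Same i w x

  record OneShared (a b c : Fin n) (o : Fin k) : Set where
    field
      trans′ : Transversal a b c
      o-ab : Same o a b
      o-bc : Same o b c
      only : ∀ {i} → Same i a b → Same i b c → i ≡ o

  rotate₁ : ∀ {a b c o} → OneShared a b c o → OneShared b c a o
  rotate₁ M = record
    { trans′ = rotate trans′ ; o-ab = o-bc ; o-bc = sym (trans o-ab o-bc)
    ; only = λ bc ca → only (sym (trans bc ca)) bc }
    where open OneShared M

  exchange₁ : ∀ {a b c o} → OneShared a b c o → OneShared b a c o
  exchange₁ M = record
    { trans′ = exchange trans′ ; o-ab = sym o-ab ; o-bc = trans o-ab o-bc
    ; only = λ ba ac → only (sym ba) (trans ba ac) }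
    where open OneShared M

  -- If two of a, b, c agree in colour i, the result is one of these two; otherwise the choice of a
  -- is arbitrary.
  majority : Fin n → Fin n → Fin n → Fin k → Fin n
  majority a b c i = if does (same? i b c) then b else a

  module _ {a b c z : Fin n} {i : Fin k} (miss : ¬ Same i z (majority a b c i)) where

    misses-bc : Same i b c → ¬ Same i z b
    misses-bc bc zb with same? i b c
    ... | yes _ = miss zb
    ... | no ¬bc = ¬bc bc

    misses-ab : Same i a b → ¬ Same i z a
    misses-ab ab za with same? i b c
    ... | yes _ = miss (trans za ab)
    ... | no _ = miss za

    misses-ac : Same i a c → ¬ Same i z a
    misses-ac ac za with same? i b c
    ... | yes bc = miss (trans za (trans ac (sym bc)))
    ... | no _ = miss za

  module AlmostAllColours (facts : Facts)
    (nocover : ∀ p (choice : Fin k → Fin n) → ∃[ v ] ∀ i → i ≢ p → ¬ Same i v (choice i))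
    (nocover₂ : ∀ i x y → ∃[ v ] ¬ Same i v x × ¬ Same i v y) where

    open Facts facts
    open OneShared

    -- Otherwise take z missing the majority components in all colours but p, and let it replace the
    -- vertex of its class. The other two do not agree in p, and wherever they agree z is off their
    -- component, so the new transversal has no common colour.
    pair-shared : ∀ {a b c o} → OneShared a b c o → ∀ p → Same p a b ⊎ Same p b c ⊎ Same p a c
    pair-shared {a} {b} {c} {o} M p with same? p a b | same? p b c | same? p a c
    ... | yes s | _ | _ = inj₁ s
    ... | no _ | yes s | _ = inj₂ (inj₁ s)
    ... | no _ | no _ | yes s = inj₂ (inj₂ s)
    ... | no ¬ab | no ¬bc | no ¬ac with nocover p (majority a b c)
    ... | z , miss with some-class (trans′ M) z
    ... | inj₁ za with shared (replace (trans′ M) za)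
    ... | i , zb , bc = ⊥-elim (misses-bc (miss i λ { refl → ¬bc bc }) bc zb)
    pair-shared {a} {b} {c} {o} M p | no ¬ab | no ¬bc | no ¬ac | z , miss | inj₂ (inj₁ zb)
      with shared (replace (exchange (trans′ M)) zb)
    ... | i , za , ac = ⊥-elim (misses-ac (miss i λ { refl → ¬ac ac }) ac za)
    pair-shared {a} {b} {c} {o} M p | no ¬ab | no ¬bc | no ¬ac | z , miss | inj₂ (inj₂ zc)
      with shared (replace (rotate (rotate (trans′ M))) zc)
    ... | i , za , ab = ⊥-elim (misses-ab (miss i λ { refl → ¬ab ab }) ab za)

    -- The components of the majority labels in all colours but p miss a vertex w, which must
    -- then lie in the class of a.
    record MajoritySwap (a b c : Fin n) (p : Fin k) : Set where
      field
        w : Fin n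
        w-class : cls w ≡ cls a
        w-shared : OneShared w b c p
        at-bc : ∀ {i} → i ≢ p → Same i b c → ¬ Same i w c
        at-ac : ∀ {i} → i ≢ p → Same i a c → ¬ Same i a b → Same i w b
        at-ab : ∀ {i} → i ≢ p → Same i a b → ¬ Same i b c → Same i w c

    -- A transversal with w can have no common colour but p, since w avoids all other majority
    -- components. As p joins b and c without a, w must replace a, and p becomes the single common
    -- colour. Where a agrees with just one of b and c, `pair-shared` forces w to agree with the
    -- other.
    majority-swap : ∀ {a b c o p} → OneShared a b c o → Same p b c → ¬ Same p a b → MajoritySwap a b c p
    majority-swap {a} {b} {c} {o} {p} M bc ¬ab with nocover p (majority a b c)
    ... | w , miss with some-class (trans′ M) w
    ... | inj₂ (inj₁ wb) with shared (replace (exchange (trans′ M)) wb)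
    ... | i , wa , ac = ⊥-elim (misses-ac (miss i λ { refl → ¬ab (trans ac (sym bc)) }) ac wa)
    majority-swap {a} {b} {c} {o} {p} M bc ¬ab | w , miss | inj₂ (inj₂ wc)
      with shared (replace (rotate (rotate (trans′ M))) wc)
    ... | i , wa , ab = ⊥-elim (misses-ab (miss i λ { refl → ¬ab ab }) ab wa)
    majority-swap {a} {b} {c} {o} {p} M bc ¬ab | w , miss | inj₁ wa = record
      { w = w ; w-class = wa ; w-shared = M′
      ; at-bc = λ i≢p bc′ wc → misses-bc (miss _ i≢p) bc′ (trans wc (sym bc′))
      ; at-ac = ac-case ; at-ab = ab-case }
      where
      tri : Transversal w b c
      tri = replace (trans′ M) wa
      is-p : ∀ {i} → Same i w b → Same i b c → i ≡ p
      is-p {i} wb bc′ with i Fin.≟ p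
      ... | yes eq = eq
      ... | no i≢p = ⊥-elim (misses-bc (miss i i≢p) bc′ wb)
      M′ : OneShared w b c p
      M′ with shared tri
      ... | i , wb , bc′ with is-p wb bc′
      ... | refl = record { trans′ = tri ; o-ab = wb ; o-bc = bc′ ; only = is-p }
      ac-case : ∀ {i} → i ≢ p → Same i a c → ¬ Same i a b → Same i w b
      ac-case {i} i≢p ac ¬ab′ with pair-shared M′ i
      ... | inj₁ wb = wb
      ... | inj₂ (inj₁ bc′) = ⊥-elim (¬ab′ (trans ac (sym bc′)))
      ... | inj₂ (inj₂ wc) = ⊥-elim (misses-ac (miss i i≢p) ac (trans wc (sym ac)))
      ab-case : ∀ {i} → i ≢ p → Same i a b → ¬ Same i b c → Same i w c
      ab-case {i} i≢p ab ¬bc with pair-shared M′ i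
      ... | inj₁ wb = ⊥-elim (misses-ab (miss i i≢p) ab (trans wb (sym ab)))
      ... | inj₂ (inj₁ bc′) = ⊥-elim (¬bc bc′)
      ... | inj₂ (inj₂ wc) = wc

    -- Two swaps at a and three swaps at b lead to a transversal with no common colour.
    two-twice : ∀ {a b c o p p′ q q′} → OneShared a b c o →
      p ≢ o → p′ ≢ o → p ≢ p′ → Same p b c → Same p′ b c →
      q ≢ o → q′ ≢ o → q ≢ q′ → Same q a c → Same q′ a c → ⊥
    two-twice {a} {b} {c} {o} {p} {p′} {q} {q′} M p≢o p′≢o p≢p′ bc-p bc-p′ q≢o q′≢o q≢q′ ac-q ac-q′ =
      contradict (shared (transversal
        (λ eq → a≢b (trans′ M) (trans (sym cls-w₂) (trans eq cls-y₃)))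
        (λ eq → b≢c (trans′ M) (trans (sym cls-y₃) eq))
        (λ eq → a≢c (trans′ M) (trans (sym cls-w₂) eq))))
      where
      not-ab : ∀ {i} → i ≢ o → Same i b c → ¬ Same i a b
      not-ab i≢o bc ab = i≢o (only M ab bc)
      not-ba : ∀ {i} → i ≢ o → Same i a c → ¬ Same i b a
      not-ba i≢o ac ba = i≢o (only M (sym ba) (trans ba ac))
      -- The numbers of swaps are a matter of parity. In a colour joining only a and b, swaps at a
      -- lead to c and back to b, so two of them end away from c. In colour p, swaps at b lead to a,
      -- c, a, so three of them end away from c. The last swap fixes the exceptional colour of each
      -- side, p for `W₂` and o for `Y₃`, and each exception is handled by the other side.
      module W₁ = MajoritySwap (majority-swap M bc-p′ (not-ab p′≢o bc-p′))
      module W₂ = MajoritySwap (majority-swap W₁.w-shared bc-p λ wb → W₁.at-bc p≢p′ bc-p (trans wb bc-p))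
      module Y₁ = MajoritySwap (majority-swap (exchange₁ M) ac-q (not-ba q≢o ac-q))
      module Y₂ = MajoritySwap (majority-swap Y₁.w-shared ac-q′ λ ya → Y₁.at-bc (≢-sym q≢q′) ac-q′ (trans ya ac-q′))
      ac-o : Same o a c
      ac-o = trans (o-ab M) (o-bc M)
      module Y₃ = MajoritySwap (majority-swap Y₂.w-shared ac-o λ ya → Y₂.at-bc (≢-sym q′≢o) ac-o (trans ya ac-o))
      cls-w₂ : cls W₂.w ≡ cls a
      cls-w₂ = trans W₂.w-class W₁.w-class
      cls-y₃ : cls Y₃.w ≡ cls b
      cls-y₃ = trans Y₃.w-class (trans Y₂.w-class Y₁.w-class)
      y₃-at-ac : ∀ {i} → i ≢ o → Same i a c → ¬ Same i Y₃.w c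
      y₃-at-ac = Y₃.at-bc
      y₃-at-p : ¬ Same p Y₃.w c
      y₃-at-p y₃c = ¬ac (trans (sym y₃a) y₃c)
        where
        ¬ba : ¬ Same p b a
        ¬ba ba = not-ab p≢o bc-p (sym ba)
        ¬ac : ¬ Same p a c
        ¬ac ac = ¬ba (trans bc-p (sym ac))
        y₁a : Same p Y₁.w a
        y₁a = Y₁.at-ac (λ { refl → ¬ac ac-q }) bc-p ¬ba
        y₂c : Same p Y₂.w c
        y₂c = Y₂.at-ab (λ { refl → ¬ac ac-q′ }) y₁a ¬ac
        y₃a : Same p Y₃.w a
        y₃a = Y₃.at-ac p≢o y₂c λ y₂a → ¬ac (trans (sym y₂a) y₂c)
      w₂-at-ab : ∀ {i} → Same i a b → ¬ Same i b c → ¬ Same i W₂.w c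
      w₂-at-ab {i} ab ¬bc w₂c = ¬bc (trans (sym w₂b) w₂c)
        where
        w₁c : Same i W₁.w c
        w₁c = W₁.at-ab (λ { refl → ¬bc bc-p′ }) ab ¬bc
        w₂b : Same i W₂.w b
        w₂b = W₂.at-ac (λ { refl → ¬bc bc-p }) w₁c λ w₁b → ¬bc (trans (sym w₁b) w₁c)
      contradict : (∃[ i ] Same i W₂.w Y₃.w × Same i Y₃.w c) → ⊥
      contradict (i , wy , yc) with i Fin.≟ p | pair-shared M i | same? i b c
      ... | yes refl | _ | _ = y₃-at-p yc
      ... | no i≢p | _ | yes bc = W₂.at-bc i≢p bc (trans wy yc)
      ... | no i≢p | inj₁ ab | no ¬bc = w₂-at-ab ab ¬bc (trans wy yc)
      ... | no i≢p | inj₂ (inj₁ bc) | no ¬bc = ¬bc bc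
      ... | no i≢p | inj₂ (inj₂ ac) | no ¬bc = y₃-at-ac (λ { refl → ¬bc (o-bc M) }) ac yc

    -- Here the vertex z′ that completes the contradictory transversal comes from a third
    -- component of colour o.
    exactly-two : ∀ {a b c o h} → OneShared a b c o → h ≢ o → Same h a b →
      (∀ {i} → Same i a b → i ≢ o → i ≡ h) → ⊥
    exactly-two {a} {b} {c} {o} {h} M h≢o ab-h ab-only =
      with-p (shared-again (rotate (rotate (trans′ M))) (sym (trans (o-ab M) (o-bc M))))
      where
      ¬bc-h : ¬ Same h b c
      ¬bc-h bc = h≢o (only M ab-h bc)
      with-p : ∃[ p ] p ≢ o × Same p c a → ⊥
      with-p (p , p≢o , ca-p) = contradict (shared (transversal
          (λ eq → a≢b (trans′ M) (sym (trans (sym Y.w-class) (trans eq W.w-class))))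
          (λ eq → a≢c (trans′ M) (trans (sym W.w-class) (trans eq cls-z′)))
          (λ eq → b≢c (trans′ M) (trans (sym Y.w-class) (trans eq cls-z′)))))
        where
        ac-p : Same p a c
        ac-p = sym ca-p
        ¬ba-p : ¬ Same p b a
        ¬ba-p ba = p≢o (only M (sym ba) (trans ba ac-p))
        p≢h : p ≢ h
        p≢h refl = ¬ba-p (sym ab-h)
        module Y = MajoritySwap (majority-swap (exchange₁ M) ac-p ¬ba-p)
        module Z = MajoritySwap (majority-swap (rotate₁ (rotate₁ M)) ab-h λ ca → ¬bc-h (trans (sym ab-h) (sym ca)))
        Mz : OneShared a b Z.w h
        Mz = rotate₁ Z.w-shared
        -- Colour p joins c and a without b, so the swap at c moves to the component of b. This
        -- makes p available for a swap at a in the triple a, b, z.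
        zb-p : Same p Z.w b
        zb-p = Z.at-ab p≢h ca-p (¬ba-p ∘ sym)
        module W = MajoritySwap (majority-swap Mz (sym zb-p) (¬ba-p ∘ sym))
        fresh : ∃[ v ] ¬ Same o v a × ¬ Same o v Z.w
        fresh = nocover₂ o a Z.w
        z′-all : ∃[ v ] cls v ≡ cls c × Same o v (proj₁ fresh)
        z′-all = into-class (trans′ M) (o-ab M) (proj₁ fresh) (cls c)
        z′ : Fin n
        z′ = proj₁ z′-all
        cls-z′ : cls z′ ≡ cls c
        cls-z′ = proj₁ (proj₂ z′-all)
        z′≁a : ¬ Same o z′ a
        z′≁a eq = proj₁ (proj₂ fresh) (trans (sym (proj₂ (proj₂ z′-all))) eq)
        z′≁z : ¬ Same o z′ Z.w
        z′≁z eq = proj₂ (proj₂ fresh) (trans (sym (proj₂ (proj₂ z′-all))) eq)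
        tri-z′ : Transversal a b z′
        tri-z′ = rotate (replace (rotate (rotate (trans′ M))) cls-z′)
        -- Of the two colours shared by a and b, z′ avoids o. So h is the single common colour of a,
        -- b, z′, and `pair-shared` applies to them.
        only-h : ∀ {i} → Same i a b → Same i b z′ → i ≡ h
        only-h {i} ab bz = ab-only ab λ { refl → z′≁a (sym (trans ab bz)) }
        Mz′ : OneShared a b z′ h
        Mz′ with shared tri-z′
        ... | i , ab , bz with only-h ab bz
        ... | refl = record { trans′ = tri-z′ ; o-ab = ab ; o-bc = bz ; only = only-h }
        contradict : (∃[ i ] Same i Y.w W.w × Same i W.w z′) → ⊥
        contradict (i , yw , wz′) with i Fin.≟ o | i Fin.≟ h | i Fin.≟ p
        ... | yes refl | _ | _ = z′≁z (trans (sym wz′) (W.at-ab (≢-sym p≢o) (o-ab M)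
          λ bz → Z.at-bc (≢-sym h≢o) (o-ab M) (sym bz)))
        ... | no _ | yes refl | _ = W.at-bc (≢-sym p≢h) (o-bc Mz)
          (trans wz′ (trans (sym (o-bc Mz′)) (o-bc Mz)))
        ... | no _ | no _ | yes refl = ¬ba-p (trans (sym zb-p) (trans (sym w~z)
            (trans (sym yw) (o-ab Y.w-shared))))
          where
          w~z : Same p W.w Z.w
          w~z = trans (o-ab W.w-shared) (o-bc W.w-shared)
        ... | no i≢o | no i≢h | no i≢p with pair-shared M i
        ... | inj₁ ab = i≢h (ab-only ab i≢o)
        ... | inj₂ (inj₁ bc) = ¬ab (trans (sym ya) (trans yw wb))
          where
          ¬ab : ¬ Same i a b
          ¬ab ab = i≢o (only M ab bc)
          ya : Same i Y.w a
          ya = Y.at-ac i≢p bc (¬ab ∘ sym)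
          za : Same i Z.w a
          za = Z.at-ac i≢h (sym bc) λ ca → ¬ab (sym (trans bc ca))
          wb : Same i W.w b
          wb = W.at-ac i≢p (sym za) ¬ab
        ... | inj₂ (inj₂ ac) with pair-shared Mz′ i
        ... | inj₁ ab = i≢h (ab-only ab i≢o)
        ... | inj₂ (inj₁ bz′) = w≁b (trans wz′ (sym bz′))
          where
          ¬ab : ¬ Same i a b
          ¬ab ab = i≢o (only M ab (trans (sym ab) ac))
          zb : Same i Z.w b
          zb = Z.at-ab i≢h (sym ac) ¬ab
          w≁b : ¬ Same i W.w b
          w≁b wb = W.at-bc i≢p (sym zb) (trans wb (sym zb))
        ... | inj₂ (inj₂ az′) = Y.at-bc i≢p ac (trans yw (trans wz′ (trans (sym az′) ac)))

    -- Every pair shares a colour besides o. The split is on whether the pairs b, c and c, a each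
    -- share a second such colour.
    impossible : ∀ {a b c o} → OneShared a b c o → ⊥
    impossible {a} {b} {c} {o} M
      with shared-again (rotate (trans′ M)) (o-bc M)
         | shared-again (rotate (rotate (trans′ M))) (sym (trans (o-ab M) (o-bc M)))
    ... | p , p≢o , bc-p | q , q≢o , ca-q
      with Fin.any? (λ p′ → ¬? (p′ Fin.≟ o) ×-dec ¬? (p Fin.≟ p′) ×-dec same? p′ b c)
         | Fin.any? (λ q′ → ¬? (q′ Fin.≟ o) ×-dec ¬? (q Fin.≟ q′) ×-dec same? q′ c a)
    ... | yes (p′ , p′≢o , p≢p′ , bc-p′) | yes (q′ , q′≢o , q≢q′ , ca-q′) =
      two-twice M p≢o p′≢o p≢p′ bc-p bc-p′ q≢o q′≢o q≢q′ (sym ca-q) (sym ca-q′)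
    ... | no none | _ = exactly-two (rotate₁ M) p≢o bc-p (single none)
      where
      single : ¬ (∃[ p′ ] p′ ≢ o × p ≢ p′ × Same p′ b c) → ∀ {i} → Same i b c → i ≢ o → i ≡ p
      single none {i} bc i≢o = sym (decidable-stable (p Fin.≟ i) λ p≢i → none (i , i≢o , p≢i , bc))
    ... | yes _ | no none = exactly-two (rotate₁ (rotate₁ M)) q≢o ca-q (single none)
      where
      single : ¬ (∃[ q′ ] q′ ≢ o × q ≢ q′ × Same q′ c a) → ∀ {i} → Same i c a → i ≢ o → i ≡ q
      single none {i} ca i≢o = sym (decidable-stable (q Fin.≟ i) λ q≢i → none (i , i≢o , q≢i , ca))

-- Certified case analysis for at most five colours

-- A vertex is recorded by a code for its class and, for each colour, a code for its
-- component. A certificate repeatedly adds a vertex that escapes few components (leave),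
-- or has a class d and a component of colour i not in a short list (avoid), until no
-- vertex can be added consistently.
module Refutation (K budget : ℕ) where

  Codes : Set
  Codes = Vec ℕ K

  Row : Set
  Row = ℕ × Codes

  State : Set
  State = List Row

  data Move : Set where
    leave : List (Fin K × ℕ) → Move
    avoid : ℕ → Fin K → List ℕ → Move

  data Certificate : Set where
    node : Move → List (Row × Certificate) → Certificate

  agreements : ∀ {m} → Vec ℕ m → Vec ℕ m → ℕ
  agreements [] [] = 0
  agreements (a ∷ v) (b ∷ w) = (if does (a ≟ b) then 1 else 0) + agreements v w

  Agree₃ : ∀ {m} → Vec ℕ m → Vec ℕ m → Vec ℕ m → Set
  Agree₃ [] [] [] = ⊥
  Agree₃ (a ∷ v) (b ∷ w) (c ∷ x) = (a ≡ b × b ≡ c) ⊎ Agree₃ v w x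

  -- The number two expresses `shared-again`: a colour shared by vertices of different classes is
  -- never the only one.
  PairOK : Row → Row → Set
  PairOK (c , v) (d , w) = c ≡ d ⊎ 2 ≤ agreements v w

  TripleOK : Row → Row → Row → Set
  TripleOK (c , v) (d , w) (e , x) = c ≡ d ⊎ c ≡ e ⊎ d ≡ e ⊎ Agree₃ v w x

  Consistent : Row → State → Set
  Consistent row st = All (PairOK row) st × All (λ r → All (TripleOK row r) st) st

  classes : Move → List ℕ
  classes (leave _) = upTo 3
  classes (avoid d _ _) = d ∷ []

  forbidden : Move → List (Fin K × ℕ)
  forbidden (leave L) = L
  forbidden (avoid _ i as) = map (i ,_) as

  Allowed : Move → Row → Set
  Allowed mv (c , v) = c ∈ classes mv × (∀ i → (i , Vec.lookup v i) ∉ forbidden mv)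

  Realised : State → Fin K → ℕ → Set
  Realised st i a = Any (λ (c , v) → Vec.lookup v i ≡ a) st

  -- The move `avoid` rests on `into-class`, so colour i must already join two recorded vertices of
  -- different classes, and a recorded vertex of class d is needed to give the code d a meaning.
  Valid : Move → State → Set
  Valid (leave L) st = length L ≤ budget × All (λ (i , a) → Realised st i a) L
  Valid (avoid d i as) st = length as ≤ budget × All (Realised st i) as × Any (λ r → proj₁ r ≡ d) st ×
    Any (λ (c , v) → Any (λ (e , w) → c ≢ e × Vec.lookup v i ≡ Vec.lookup w i) st) st

  fresh : State → Fin K → ℕ
  fresh st i = foldr (λ (c , v) m → suc (Vec.lookup v i) ⊔ m) 0 st

  open import Data.List.Membership.DecPropositional (Product.≡-dec (Fin._≟_ {K}) _≟_) using (_∈?_)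

  codes : Move → State → Fin K → List ℕ
  codes mv st i = filter (λ a → ¬? ((i , a) ∈? forbidden mv)) (upTo (suc (fresh st i)))

  vectors : ∀ {m} → (Fin m → List ℕ) → List (Vec ℕ m)
  vectors {zero} as = [] ∷ []
  vectors {suc m} as = concatMap (λ a → map (a ∷_) (vectors (as ∘ suc))) (as zero)

  candidates : Move → State → List Row
  candidates mv st = concatMap (λ c → map (c ,_) (vectors (codes mv st))) (classes mv)

  -- A leaf is a node without children: its move leaves no consistent candidate.
  Check : Certificate → State → Set
  Child : List (Row × Certificate) → Row → State → Set

  Check (node mv children) st = Valid mv st ×
    All (λ row → ¬ Consistent row st ⊎ Child children row st) (candidates mv st)

  Child [] row st = ⊥
  Child ((r , cert) ∷ children) row st = (row ≡ r × Check cert (row ∷ st)) ⊎ Child children row st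

  row-≟ : (r s : Row) → Dec (r ≡ s)
  row-≟ = Product.≡-dec _≟_ (≡-dec _≟_)

  agree₃? : ∀ {m} (v w x : Vec ℕ m) → Dec (Agree₃ v w x)
  agree₃? [] [] [] = no λ ()
  agree₃? (a ∷ v) (b ∷ w) (c ∷ x) = ((a ≟ b) ×-dec (b ≟ c)) ⊎-dec agree₃? v w x

  pairOK? : ∀ r s → Dec (PairOK r s)
  pairOK? (c , v) (d , w) = (c ≟ d) ⊎-dec (2 ≤? agreements v w)

  tripleOK? : ∀ r s t → Dec (TripleOK r s t)
  tripleOK? (c , v) (d , w) (e , x) = (c ≟ d) ⊎-dec (c ≟ e) ⊎-dec (d ≟ e) ⊎-dec agree₃? v w x

  consistent? : ∀ row st → Dec (Consistent row st)
  consistent? row st = All.all? (pairOK? row) st ×-dec All.all? (λ r → All.all? (tripleOK? row r) st) st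

  realised? : ∀ st i a → Dec (Realised st i a)
  realised? st i a = Any.any? (λ (c , v) → Vec.lookup v i ≟ a) st

  valid? : ∀ mv st → Dec (Valid mv st)
  valid? (leave L) st = (length L ≤? budget) ×-dec All.all? (λ (i , a) → realised? st i a) L
  valid? (avoid d i as) st = (length as ≤? budget) ×-dec All.all? (realised? st i) as ×-dec
    Any.any? (λ r → proj₁ r ≟ d) st ×-dec
    Any.any? (λ (c , v) → Any.any? (λ (e , w) → ¬? (c ≟ e) ×-dec (Vec.lookup v i ≟ Vec.lookup w i)) st) st

  check? : ∀ cert st → Dec (Check cert st)
  child? : ∀ children row st → Dec (Child children row st)

  check? (node mv children) st = valid? mv st ×-dec
    All.all? (λ row → ¬? (consistent? row st) ⊎-dec child? children row st) (candidates mv st)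

  child? [] row st = no λ ()
  child? ((r , cert) ∷ children) row st = (row-≟ row r ×-dec check? cert (row ∷ st)) ⊎-dec child? children row st

  ∈-vectors : ∀ {m} (v : Vec ℕ m) as → (∀ i → Vec.lookup v i ∈ as i) → v ∈ vectors as
  ∈-vectors [] as v∈ = here refl
  ∈-vectors (a ∷ v) as v∈ = ∈-concatMap⁺ (λ a → map (a ∷_) (vectors (as ∘ suc)))
    (lose (v∈ zero) (∈-map⁺ (a ∷_) (∈-vectors v (as ∘ suc) (v∈ ∘ suc))))

  ∈-candidates : ∀ mv st row → Allowed mv row → (∀ i → Vec.lookup (proj₂ row) i < suc (fresh st i)) → row ∈ candidates mv st
  ∈-candidates mv st (c , v) (c∈ , v∉) bounded = ∈-concatMap⁺ (λ c → map (c ,_) (vectors (codes mv st)))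
    (lose c∈ (∈-map⁺ (c ,_) (∈-vectors v (codes mv st) λ i →
      ∈-filter⁺ (λ a → ¬? ((i , a) ∈? forbidden mv)) (∈-upTo⁺ (bounded i)) (v∉ i))))

  1≤agreements : ∀ {m} (v w : Vec ℕ m) i → Vec.lookup v i ≡ Vec.lookup w i → 1 ≤ agreements v w
  1≤agreements (a ∷ v) (b ∷ w) zero eq rewrite dec-true (a ≟ b) eq = s≤s z≤n
  1≤agreements (a ∷ v) (b ∷ w) (suc i) eq = ≤-trans (1≤agreements v w i eq) (m≤n+m _ _)

  2≤agreements : ∀ {m} (v w : Vec ℕ m) {i j} → j ≢ i → Vec.lookup v i ≡ Vec.lookup w i → Vec.lookup v j ≡ Vec.lookup w j →
    2 ≤ agreements v w
  2≤agreements (a ∷ v) (b ∷ w) {zero} {zero} j≢i _ _ = contradiction refl j≢i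
  2≤agreements (a ∷ v) (b ∷ w) {zero} {suc j} _ eq eq′ rewrite dec-true (a ≟ b) eq = s≤s (1≤agreements v w j eq′)
  2≤agreements (a ∷ v) (b ∷ w) {suc i} {zero} _ eq eq′ rewrite dec-true (a ≟ b) eq′ = s≤s (1≤agreements v w i eq)
  2≤agreements (a ∷ v) (b ∷ w) {suc i} {suc j} j≢i eq eq′ =
    ≤-trans (2≤agreements v w (j≢i ∘ cong suc) eq eq′) (m≤n+m _ _)

  agree₃ : ∀ {m} (v w x : Vec ℕ m) i → Vec.lookup v i ≡ Vec.lookup w i → Vec.lookup w i ≡ Vec.lookup x i → Agree₃ v w x
  agree₃ (_ ∷ _) (_ ∷ _) (_ ∷ _) zero eq eq′ = inj₁ (eq , eq′)
  agree₃ (_ ∷ v) (_ ∷ w) (_ ∷ x) (suc i) eq eq′ = inj₂ (agree₃ v w x i eq eq′)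

  fresh-above : ∀ {c v} st i → (c , v) ∈ st → Vec.lookup v i < fresh st i
  fresh-above (_ ∷ st) i (here refl) = m≤m⊔n _ (fresh st i)
  fresh-above ((_ , w) ∷ st) i (there r∈) = ≤-trans (fresh-above st i r∈) (m≤n⊔m (suc (Vec.lookup w i)) _)

  -- Soundness of certificates

  module Soundness {n k : ℕ} (cls : Fin n → Fin 3) (lab : Fin k → Fin n → Fin n)
    (inhabited : ∀ j → ∃[ z ] cls z ≡ j) (facts : Tripartite.Facts cls lab) (nocover : Labelling.NoCover cls lab 1 budget)
    (col : Fin K → Fin k) (col-onto : ∀ i → ∃[ j ] col j ≡ i) where

    open Tripartite cls lab
    open Facts facts

    Named : Set
    Named = List (Fin n × Row)

    rows : Named → State
    rows = map proj₂

    -- Codes carry only relative meaning: equality of codes has to mirror equality of classes and of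
    -- components, in both directions.
    Describes : Fin n × Row → Fin n × Row → Set
    Describes (x , (c , v)) (y , (d , w)) = (c ≡ d → cls x ≡ cls y) × (cls x ≡ cls y → c ≡ d) ×
      ∀ i → (Vec.lookup v i ≡ Vec.lookup w i → Same (col i) x y) × (Same (col i) x y → Vec.lookup v i ≡ Vec.lookup w i)

    describes-sym : ∀ p q → Describes p q → Describes q p
    describes-sym p q (cd , dc , f) = sym ∘ cd ∘ sym , sym ∘ dc ∘ sym , λ i →
      sym ∘ proj₁ (f i) ∘ sym , sym ∘ proj₂ (f i) ∘ sym

    Faithful : Named → Set
    Faithful L = ∀ {p q} → p ∈ L → q ∈ L → Describes p q

    AllClasses : Named → Set
    AllClasses L = ∀ v → Any (λ (x , (c , _)) → c < 3 × cls x ≡ cls v) L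

    code : (L : Named) → Faithful L → ∀ i w → ∃[ a ] a < suc (fresh (rows L) i) ×
      (∀ {x c v} → (x , (c , v)) ∈ L → (a ≡ Vec.lookup v i → Same (col i) w x) × (Same (col i) w x → a ≡ Vec.lookup v i))
    code L faith i w with Any.any? (λ (x , _) → same? (col i) w x) L
    ... | yes found with find found
    ... | (y , (d , u)) , y∈ , wy = Vec.lookup u i , m<n⇒m<1+n (fresh-above (rows L) i (∈-map⁺ proj₂ y∈)) ,
      λ x∈ → let f = proj₂ (proj₂ (faith y∈ x∈)) i in
        (λ eq → trans wy (proj₁ f eq)) , (λ wx → proj₂ f (trans (sym wy) wx))
    code L faith i w | no none = fresh (rows L) i , ≤-refl , λ x∈ →
      (λ eq → contradiction (fresh-above (rows L) i (∈-map⁺ proj₂ x∈)) (<-irrefl (sym eq))) ,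
      (λ wx → contradiction (lose x∈ wx) none)

    describe : (L : Named) → Faithful L → AllClasses L → ∀ w →
      ∃[ row ] (∀ i → Vec.lookup (proj₂ row) i < suc (fresh (rows L) i)) × proj₁ row < 3 ×
        (∀ {p} → p ∈ L → Describes (w , row) p)
    describe L faith all-classes w with find (all-classes w)
    ... | (y , (d , _)) , y∈ , d<3 , cls-eq = (d , Vec.tabulate as) , bounded , d<3 , desc
      where
      as : Fin K → ℕ
      as i = proj₁ (code L faith i w)
      bounded : ∀ i → Vec.lookup (Vec.tabulate as) i < suc (fresh (rows L) i)
      bounded i = subst (_< _) (sym (lookup∘tabulate as i)) (proj₁ (proj₂ (code L faith i w)))
      desc : ∀ {p} → p ∈ L → Describes (w , (d , Vec.tabulate as)) p
      desc p∈ = (λ eq → trans (sym cls-eq) (proj₁ (faith y∈ p∈) eq)) ,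
        (λ eq → proj₁ (proj₂ (faith y∈ p∈)) (trans cls-eq eq)) ,
        λ i → let f = proj₂ (proj₂ (code L faith i w)) p∈ in
          (λ eq → proj₁ f (trans (sym (lookup∘tabulate as i)) eq)) ,
          (λ s → trans (lookup∘tabulate as i) (proj₂ f s))

    extend : ∀ L w row → Faithful L → (∀ {p} → p ∈ L → Describes (w , row) p) → Faithful ((w , row) ∷ L)
    extend L w row faith desc (here refl) (here refl) = (λ _ → refl) , (λ _ → refl) , λ i → (λ _ → refl) , (λ _ → refl)
    extend L w row faith desc (here refl) (there q∈) = desc q∈
    extend L w row faith desc {p} (there p∈) (here refl) = describes-sym (w , row) p (desc p∈)
    extend L w row faith desc (there p∈) (there q∈) = faith p∈ q∈

    pair-true : ∀ {x y z} r s → Describes (x , r) (y , s) → Transversal x y z → PairOK r s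
    pair-true r s (_ , dc , f) t with shared t
    ... | i , xy , _ with shared-again t xy | col-onto i
    ... | j , j≢i , xy′ | i′ , refl with col-onto j
    ... | j′ , refl = inj₂ (2≤agreements (proj₂ r) (proj₂ s) {i′} {j′} (λ { refl → j≢i refl }) (proj₂ (f i′) xy) (proj₂ (f j′) xy′))

    third-class : ∀ {x y : Fin n} → cls x ≢ cls y → ∃[ z ] Transversal x y z
    third-class {x} {y} x≢y with shorter⇒missing (cls x ∷ cls y ∷ []) ≤-refl
    ... | j , j∉ with inhabited j
    ... | z , refl = z , transversal x≢y (j∉ ∘ there ∘ here ∘ sym) (j∉ ∘ here ∘ sym)

    consistent : ∀ L w row → AllClasses L → Faithful ((w , row) ∷ L) → Consistent row (rows L)
    consistent L w row all-classes faith = All.map⁺ (All.tabulate pair) ,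
      All.map⁺ (All.tabulate λ p∈ → All.map⁺ (All.tabulate λ q∈ → triple p∈ q∈))
      where
      pair : ∀ {p} → p ∈ L → PairOK row (proj₂ p)
      pair {p} p∈ with faith (here refl) (there p∈) | cls w Fin.≟ cls (proj₁ p)
      ... | d | yes eq = inj₁ (proj₁ (proj₂ d) eq)
      ... | d | no neq = pair-true row (proj₂ p) d (proj₂ (third-class neq))
      triple : ∀ {p q} → p ∈ L → q ∈ L → TripleOK row (proj₂ p) (proj₂ q)
      triple {p} {q} p∈ q∈ with faith (here refl) (there p∈) | faith (here refl) (there q∈) | faith (there p∈) (there q∈)
      ... | wp | wq | pq with cls w Fin.≟ cls (proj₁ p) | cls w Fin.≟ cls (proj₁ q) | cls (proj₁ p) Fin.≟ cls (proj₁ q)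
      ... | yes eq | _ | _ = inj₁ (proj₁ (proj₂ wp) eq)
      ... | no _ | yes eq | _ = inj₂ (inj₁ (proj₁ (proj₂ wq) eq))
      ... | no _ | no _ | yes eq = inj₂ (inj₂ (inj₁ (proj₁ (proj₂ pq) eq)))
      ... | no ≢p | no ≢q | no p≢q with shared (transversal ≢p p≢q ≢q)
      ... | i , a , b with col-onto i
      ... | i′ , refl = inj₂ (inj₂ (inj₂ (agree₃ (proj₂ row) _ _ i′ (proj₂ (proj₂ (proj₂ wp) i′) a) (proj₂ (proj₂ (proj₂ pq) i′) b))))

    open Labelling cls lab 1 using (Component; Misses)

    realise : ∀ L cs → All (λ (i , a) → Realised (rows L) i a) cs →
      ∃[ Ls ] length Ls ≡ length cs ×
        (∀ {i a} → (i , a) ∈ cs → ∃[ x ] ∃[ c ] ∃[ v ] (x , (c , v)) ∈ L × Vec.lookup v i ≡ a × (col i , x) ∈ Ls)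
    realise L [] [] = [] , refl , λ ()
    realise L ((i , a) ∷ cs) (real ∷ reals) with find (Any.map⁻ real) | realise L cs reals
    ... | (x , (c , v)) , x∈ , eq | Ls , len , rest = (col i , x) ∷ Ls , cong suc len , λ where
      (here refl) → x , c , v , x∈ , eq , here refl
      (there i∈) → let (x′ , c′ , v′ , x′∈ , eq′ , ∈Ls) = rest i∈ in x′ , c′ , v′ , x′∈ , eq′ , there ∈Ls

    -- For `avoid`, a vertex outside the listed components is carried into class d along its own
    -- component of colour i.
    move : ∀ {mv} L → Faithful L → AllClasses L → Valid mv (rows L) →
      ∃[ w ] (∀ row → proj₁ row < 3 → (∀ {p} → p ∈ L → Describes (w , row) p) → Allowed mv row)
    move {leave cs} L faith all-classes (short , real) with realise L cs real
    ... | Ls , len , named with nocover Ls (subst (_≤ budget) (sym len) short)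
    ... | w , miss = w , λ row c<3 desc → ∈-upTo⁺ c<3 , λ i ia∈ →
      let (x , c , v , x∈ , eq , ∈Ls) = named ia∈
      in miss _ ∈Ls (proj₁ (proj₂ (proj₂ (desc x∈)) i) (sym eq))
    move {avoid d i as} L faith all-classes (short , real , has-d , has-shared)
      with realise L (map (i ,_) as) (All.map⁺ real) | find (Any.map⁻ has-d) | find (Any.map⁻ has-shared)
    ... | Ls , len , named | (z , (.d , _)) , z∈ , refl | (x , (c , v)) , x∈ , more with find (Any.map⁻ more)
    ... | (y , (e , u)) , y∈ , c≢e , eq
      with nocover Ls (subst (_≤ budget) (sym (trans len (length-map _ as))) short)
         | third-class (c≢e ∘ proj₁ (proj₂ (faith x∈ y∈)))
    ... | v₀ , miss | _ , tri with into-class tri (proj₁ (proj₂ (proj₂ (faith x∈ y∈)) i) eq) v₀ (cls z)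
    ... | w , cls-w , same = w , λ row _ desc → here (proj₁ (proj₂ (desc z∈)) cls-w) , λ j ja∈ → off row desc j ja∈
      where
      off : ∀ row → (∀ {p} → p ∈ L → Describes (w , row) p) → ∀ j → (j , Vec.lookup (proj₂ row) j) ∉ map (i ,_) as
      off row desc j ja∈ with ∈-map⁻ (i ,_) ja∈ | named ja∈
      ... | _ , _ , refl | x , c , v , x∈ , eq , ∈Ls =
        miss _ ∈Ls (trans (sym same) (proj₁ (proj₂ (proj₂ (desc x∈)) i) (sym eq)))

    -- The certificate is followed along actual vertices. The row of the vertex found is a
    -- candidate, and consistent because it describes a real vertex, so some child must match it.
    sound : ∀ cert L → Faithful L → AllClasses L → Check cert (rows L) → ⊥
    sound-child : ∀ children L w row → Faithful ((w , row) ∷ L) → AllClasses ((w , row) ∷ L) →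
      Child children row (rows L) → ⊥

    sound (node mv children) L faith all-classes (valid , all) with move {mv} L faith all-classes valid
    ... | w , allowed with describe L faith all-classes w
    ... | row , bounded , c<3 , desc with All.lookup all (∈-candidates mv (rows L) row (allowed row c<3 desc) bounded)
    ... | inj₁ ¬cons = ¬cons (consistent L w row all-classes (extend L w row faith desc))
    ... | inj₂ child = sound-child children L w row (extend L w row faith desc) (λ v → there (all-classes v)) child

    sound-child ((_ , cert) ∷ _) L w row faith all-classes (inj₁ (refl , ok)) =
      sound cert ((w , row) ∷ L) faith all-classes ok
    sound-child (_ ∷ children) L w row faith all-classes (inj₂ child) =
      sound-child children L w row faith all-classes child

unique-full : ∀ {n} {xs : List (Fin n)} → Unique xs → length xs ≡ n → ∀ i → i ∈ xs
unique-full {n} {xs} u len i = decidable-stable (i ∈? xs) λ i∉ →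
  contradiction (unique⇒length≤ (All.¬Any⇒All¬ xs i∉ ∷ u)) (<⇒≱ (s≤s (≤-reflexive (sym len))))
  where open import Data.List.Membership.DecPropositional Fin._≟_ using (_∈?_)

-- Found by computer search. The colours are listed as: the common colour of a, b, c, then
-- the colours shared by b and c only, a and c only, a and b only, and by none.
module Certificates where

  open Refutation

  four : Certificate 4 2
  four = node (avoid 0 1F (0 ∷ 1 ∷ [])) (
    ((0 , 0 ∷ 2 ∷ 0 ∷ 0 ∷ []) , node (leave ((0F , 0) ∷ (1F , 0) ∷ [])) []) ∷
    ((0 , 0 ∷ 2 ∷ 1 ∷ 1 ∷ []) , node (avoid 1 0F (0 ∷ [])) []) ∷
    [])

  five-rainbow : Certificate 5 3
  five-rainbow = node (leave ((0F , 0) ∷ (1F , 0) ∷ (1F , 1) ∷ [])) (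
    ((1 , 1 ∷ 2 ∷ 0 ∷ 0 ∷ 2 ∷ []) , node (avoid 2 3F (0 ∷ 1 ∷ [])) (
      ((2 , 0 ∷ 0 ∷ 0 ∷ 2 ∷ 2 ∷ []) , node (avoid 0 1F (0 ∷ 1 ∷ 2 ∷ [])) (
        ((0 , 0 ∷ 3 ∷ 0 ∷ 0 ∷ 0 ∷ []) , node (leave ((0F , 0) ∷ (1F , 0) ∷ (3F , 0) ∷ [])) []) ∷
        ((0 , 0 ∷ 3 ∷ 0 ∷ 0 ∷ 1 ∷ []) , node (leave ((0F , 0) ∷ (0F , 1) ∷ (3F , 0) ∷ [])) []) ∷
        ((0 , 0 ∷ 3 ∷ 0 ∷ 0 ∷ 2 ∷ []) , node (leave ((2F , 0) ∷ (3F , 0) ∷ (4F , 2) ∷ [])) []) ∷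
        ((0 , 0 ∷ 3 ∷ 0 ∷ 0 ∷ 3 ∷ []) , node (leave ((0F , 0) ∷ (0F , 1) ∷ (3F , 0) ∷ [])) []) ∷
        ((0 , 0 ∷ 3 ∷ 1 ∷ 0 ∷ 2 ∷ []) , node (leave ((0F , 0) ∷ (0F , 1) ∷ (3F , 0) ∷ [])) []) ∷
        ((0 , 0 ∷ 3 ∷ 2 ∷ 0 ∷ 2 ∷ []) , node (leave ((0F , 0) ∷ (0F , 1) ∷ (3F , 0) ∷ [])) []) ∷
        [])) ∷
      ((2 , 0 ∷ 2 ∷ 0 ∷ 2 ∷ 1 ∷ []) , node (leave ((0F , 0) ∷ (2F , 0) ∷ (3F , 0) ∷ [])) []) ∷
      [])) ∷
    ((1 , 1 ∷ 2 ∷ 0 ∷ 1 ∷ 0 ∷ []) , node (leave ((0F , 0) ∷ (0F , 1) ∷ (2F , 0) ∷ [])) (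
      ((0 , 2 ∷ 0 ∷ 1 ∷ 1 ∷ 0 ∷ []) , node (avoid 2 0F (0 ∷ 1 ∷ 2 ∷ [])) (
        ((2 , 3 ∷ 0 ∷ 0 ∷ 0 ∷ 0 ∷ []) , node (leave ((0F , 0) ∷ (1F , 0) ∷ (4F , 0) ∷ [])) []) ∷
        ((2 , 3 ∷ 2 ∷ 1 ∷ 0 ∷ 0 ∷ []) , node (avoid 0 2F (0 ∷ 1 ∷ [])) []) ∷
        [])) ∷
      ((2 , 2 ∷ 2 ∷ 1 ∷ 0 ∷ 0 ∷ []) , node (avoid 0 2F (0 ∷ 1 ∷ [])) []) ∷
      [])) ∷
    ((2 , 1 ∷ 2 ∷ 0 ∷ 0 ∷ 1 ∷ []) , node (avoid 1 2F (0 ∷ 1 ∷ [])) (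
      ((1 , 0 ∷ 0 ∷ 2 ∷ 0 ∷ 1 ∷ []) , node (avoid 0 1F (0 ∷ 1 ∷ 2 ∷ [])) (
        ((0 , 0 ∷ 3 ∷ 0 ∷ 0 ∷ 0 ∷ []) , node (leave ((0F , 0) ∷ (1F , 0) ∷ (2F , 0) ∷ [])) []) ∷
        ((0 , 0 ∷ 3 ∷ 0 ∷ 0 ∷ 1 ∷ []) , node (leave ((2F , 0) ∷ (3F , 0) ∷ (4F , 1) ∷ [])) []) ∷
        ((0 , 0 ∷ 3 ∷ 0 ∷ 0 ∷ 2 ∷ []) , node (leave ((0F , 0) ∷ (0F , 1) ∷ (2F , 0) ∷ [])) []) ∷
        ((0 , 0 ∷ 3 ∷ 0 ∷ 0 ∷ 3 ∷ []) , node (leave ((0F , 0) ∷ (0F , 1) ∷ (2F , 0) ∷ [])) []) ∷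
        ((0 , 0 ∷ 3 ∷ 0 ∷ 1 ∷ 1 ∷ []) , node (leave ((0F , 0) ∷ (0F , 1) ∷ (2F , 0) ∷ [])) []) ∷
        ((0 , 0 ∷ 3 ∷ 0 ∷ 2 ∷ 1 ∷ []) , node (leave ((0F , 0) ∷ (0F , 1) ∷ (2F , 0) ∷ [])) []) ∷
        [])) ∷
      ((1 , 0 ∷ 2 ∷ 2 ∷ 0 ∷ 2 ∷ []) , node (leave ((0F , 0) ∷ (2F , 0) ∷ (3F , 0) ∷ [])) []) ∷
      [])) ∷
    ((2 , 1 ∷ 2 ∷ 1 ∷ 0 ∷ 0 ∷ []) , node (leave ((0F , 0) ∷ (0F , 1) ∷ (3F , 0) ∷ [])) (
      ((0 , 2 ∷ 0 ∷ 1 ∷ 1 ∷ 0 ∷ []) , node (avoid 1 0F (0 ∷ 1 ∷ 2 ∷ [])) (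
        ((1 , 3 ∷ 0 ∷ 0 ∷ 0 ∷ 0 ∷ []) , node (leave ((0F , 0) ∷ (1F , 0) ∷ (4F , 0) ∷ [])) []) ∷
        ((1 , 3 ∷ 2 ∷ 0 ∷ 1 ∷ 0 ∷ []) , node (avoid 0 2F (0 ∷ 1 ∷ [])) []) ∷
        [])) ∷
      ((1 , 2 ∷ 2 ∷ 0 ∷ 1 ∷ 0 ∷ []) , node (avoid 0 2F (0 ∷ 1 ∷ [])) []) ∷
      [])) ∷
    [])

  five-double : Certificate 5 3
  five-double = node (leave ((0F , 0) ∷ (1F , 0) ∷ (1F , 1) ∷ [])) (
    ((0 , 1 ∷ 2 ∷ 0 ∷ 0 ∷ 0 ∷ []) , node (avoid 1 4F (0 ∷ 1 ∷ [])) (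
      ((1 , 0 ∷ 0 ∷ 0 ∷ 0 ∷ 2 ∷ []) , node (leave ((0F , 0) ∷ (1F , 0) ∷ (3F , 0) ∷ [])) []) ∷
      ((1 , 0 ∷ 1 ∷ 0 ∷ 0 ∷ 2 ∷ []) , node (leave ((0F , 0) ∷ (2F , 0) ∷ (3F , 0) ∷ [])) []) ∷
      ((1 , 0 ∷ 2 ∷ 0 ∷ 0 ∷ 2 ∷ []) , node (leave ((0F , 0) ∷ (2F , 0) ∷ (3F , 0) ∷ [])) []) ∷
      ((1 , 0 ∷ 2 ∷ 1 ∷ 0 ∷ 2 ∷ []) , node (leave ((0F , 0) ∷ (1F , 2) ∷ (3F , 0) ∷ [])) []) ∷
      ((1 , 0 ∷ 2 ∷ 2 ∷ 0 ∷ 2 ∷ []) , node (leave ((0F , 0) ∷ (0F , 1) ∷ (3F , 0) ∷ [])) []) ∷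
      ((1 , 0 ∷ 3 ∷ 0 ∷ 0 ∷ 2 ∷ []) , node (leave ((0F , 0) ∷ (2F , 0) ∷ (3F , 0) ∷ [])) []) ∷
      ((1 , 1 ∷ 0 ∷ 1 ∷ 0 ∷ 2 ∷ []) , node (leave ((1F , 0) ∷ (3F , 0) ∷ (4F , 0) ∷ [])) []) ∷
      ((1 , 1 ∷ 1 ∷ 0 ∷ 0 ∷ 2 ∷ []) , node (leave ((0F , 1) ∷ (2F , 0) ∷ (3F , 0) ∷ [])) []) ∷
      ((1 , 2 ∷ 1 ∷ 0 ∷ 0 ∷ 2 ∷ []) , node (leave ((0F , 0) ∷ (2F , 0) ∷ (3F , 0) ∷ [])) []) ∷
      [])) ∷
    ((0 , 1 ∷ 2 ∷ 0 ∷ 1 ∷ 1 ∷ []) , node (avoid 1 0F (0 ∷ 1 ∷ [])) (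
      ((1 , 2 ∷ 1 ∷ 0 ∷ 0 ∷ 1 ∷ []) , node (leave ((2F , 0) ∷ (3F , 0) ∷ (4F , 1) ∷ [])) []) ∷
      ((1 , 2 ∷ 2 ∷ 0 ∷ 0 ∷ 0 ∷ []) , node (leave ((2F , 0) ∷ (4F , 0) ∷ (4F , 1) ∷ [])) []) ∷
      ((1 , 2 ∷ 2 ∷ 1 ∷ 0 ∷ 1 ∷ []) , node (avoid 2 2F (0 ∷ 1 ∷ [])) []) ∷
      [])) ∷
    ((1 , 1 ∷ 2 ∷ 0 ∷ 0 ∷ 0 ∷ []) , node (leave ((0F , 0) ∷ (0F , 1) ∷ (3F , 0) ∷ [])) (
      ((0 , 2 ∷ 0 ∷ 0 ∷ 1 ∷ 0 ∷ []) , node (leave ((1F , 0) ∷ (2F , 0) ∷ (4F , 0) ∷ [])) []) ∷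
      ((0 , 2 ∷ 0 ∷ 0 ∷ 2 ∷ 0 ∷ []) , node (leave ((1F , 0) ∷ (2F , 0) ∷ (4F , 0) ∷ [])) []) ∷
      ((0 , 2 ∷ 2 ∷ 0 ∷ 1 ∷ 1 ∷ []) , node (leave ((2F , 0) ∷ (4F , 0) ∷ (4F , 1) ∷ [])) []) ∷
      ((2 , 2 ∷ 1 ∷ 0 ∷ 1 ∷ 0 ∷ []) , node (leave ((1F , 1) ∷ (2F , 0) ∷ (4F , 0) ∷ [])) []) ∷
      ((2 , 2 ∷ 1 ∷ 0 ∷ 2 ∷ 0 ∷ []) , node (leave ((1F , 1) ∷ (2F , 0) ∷ (4F , 0) ∷ [])) []) ∷
      ((2 , 2 ∷ 2 ∷ 1 ∷ 1 ∷ 0 ∷ []) , node (leave ((2F , 0) ∷ (2F , 1) ∷ (4F , 0) ∷ [])) []) ∷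
      [])) ∷
    ((1 , 1 ∷ 2 ∷ 1 ∷ 0 ∷ 1 ∷ []) , node (avoid 2 0F (0 ∷ 1 ∷ [])) (
      ((2 , 2 ∷ 0 ∷ 1 ∷ 0 ∷ 0 ∷ []) , node (leave ((0F , 0) ∷ (2F , 1) ∷ (3F , 0) ∷ [])) []) ∷
      ((2 , 2 ∷ 2 ∷ 0 ∷ 0 ∷ 0 ∷ []) , node (leave ((2F , 0) ∷ (2F , 1) ∷ (3F , 0) ∷ [])) []) ∷
      ((2 , 2 ∷ 2 ∷ 1 ∷ 1 ∷ 0 ∷ []) , node (avoid 0 3F (0 ∷ 1 ∷ [])) []) ∷
      [])) ∷
    ((2 , 1 ∷ 2 ∷ 0 ∷ 0 ∷ 0 ∷ []) , node (leave ((0F , 0) ∷ (0F , 1) ∷ (4F , 0) ∷ [])) (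
      ((0 , 2 ∷ 0 ∷ 0 ∷ 0 ∷ 1 ∷ []) , node (leave ((1F , 0) ∷ (2F , 0) ∷ (3F , 0) ∷ [])) []) ∷
      ((0 , 2 ∷ 0 ∷ 0 ∷ 0 ∷ 2 ∷ []) , node (leave ((1F , 0) ∷ (2F , 0) ∷ (3F , 0) ∷ [])) []) ∷
      ((0 , 2 ∷ 2 ∷ 0 ∷ 1 ∷ 1 ∷ []) , node (leave ((2F , 0) ∷ (3F , 0) ∷ (3F , 1) ∷ [])) []) ∷
      ((1 , 2 ∷ 1 ∷ 0 ∷ 0 ∷ 1 ∷ []) , node (leave ((1F , 1) ∷ (2F , 0) ∷ (3F , 0) ∷ [])) []) ∷
      ((1 , 2 ∷ 1 ∷ 0 ∷ 0 ∷ 2 ∷ []) , node (leave ((1F , 1) ∷ (2F , 0) ∷ (3F , 0) ∷ [])) []) ∷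
      ((1 , 2 ∷ 2 ∷ 1 ∷ 0 ∷ 1 ∷ []) , node (leave ((2F , 0) ∷ (2F , 1) ∷ (3F , 0) ∷ [])) []) ∷
      [])) ∷
    ((2 , 1 ∷ 2 ∷ 1 ∷ 1 ∷ 0 ∷ []) , node (avoid 1 0F (0 ∷ 1 ∷ [])) (
      ((1 , 2 ∷ 0 ∷ 1 ∷ 0 ∷ 0 ∷ []) , node (leave ((0F , 0) ∷ (2F , 1) ∷ (4F , 0) ∷ [])) []) ∷
      ((1 , 2 ∷ 2 ∷ 0 ∷ 0 ∷ 0 ∷ []) , node (leave ((2F , 0) ∷ (2F , 1) ∷ (4F , 0) ∷ [])) []) ∷
      ((1 , 2 ∷ 2 ∷ 1 ∷ 0 ∷ 1 ∷ []) , node (avoid 0 3F (0 ∷ 1 ∷ [])) []) ∷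
      [])) ∷
    [])

  start₄ : State 4 2
  start₄ = (0 , 0 ∷ 1 ∷ 0 ∷ 0 ∷ []) ∷ (1 , 0 ∷ 0 ∷ 1 ∷ 0 ∷ []) ∷ (2 , 0 ∷ 0 ∷ 0 ∷ 1 ∷ []) ∷ []

  start-rainbow : State 5 3
  start-rainbow = (0 , 0 ∷ 1 ∷ 0 ∷ 0 ∷ 0 ∷ []) ∷ (1 , 0 ∷ 0 ∷ 1 ∷ 0 ∷ 1 ∷ []) ∷ (2 , 0 ∷ 0 ∷ 0 ∷ 1 ∷ 2 ∷ []) ∷ []

  start-double : State 5 3
  start-double = (0 , 0 ∷ 1 ∷ 1 ∷ 0 ∷ 0 ∷ []) ∷ (1 , 0 ∷ 0 ∷ 0 ∷ 1 ∷ 0 ∷ []) ∷ (2 , 0 ∷ 0 ∷ 0 ∷ 0 ∷ 1 ∷ []) ∷ []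

  four-ok : Check 4 2 four start₄
  four-ok = toWitness {a? = check? 4 2 four start₄} _

  five-rainbow-ok : Check 5 3 five-rainbow start-rainbow
  five-rainbow-ok = toWitness {a? = check? 5 3 five-rainbow start-rainbow} _

  five-double-ok : Check 5 3 five-double start-double
  five-double-ok = toWitness {a? = check? 5 3 five-double start-double} _

-- Three, four and five colours

module FewColours {n k : ℕ} (cls : Fin n → Fin 3) (lab : Fin k → Fin n → Fin n)
  (inhabited : ∀ j → ∃[ z ] cls z ≡ j) (facts : Tripartite.Facts cls lab) where

  open Tripartite cls lab
  open Facts facts
  open OneShared
  open Labelling cls lab 1 using (NoCover)

  Split : Fin n → Fin n → Fin n → Fin k → ℕ → ℕ → ℕ → Set
  Split a b c i x y z =
    ((x ≡ y → Same i a b) × (Same i a b → x ≡ y)) ×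
    ((y ≡ z → Same i b c) × (Same i b c → y ≡ z)) ×
    ((x ≡ z → Same i a c) × (Same i a c → x ≡ z))

  module _ {a b c : Fin n} {i : Fin k} where

    split-all : Same i a b → Same i b c → Split a b c i 0 0 0
    split-all ab bc = ((λ _ → ab) , λ _ → refl) , ((λ _ → bc) , λ _ → refl) , ((λ _ → trans ab bc) , λ _ → refl)

    split-bc : Same i b c → ¬ Same i a b → Split a b c i 1 0 0
    split-bc bc ¬ab = ((λ ()) , λ ab → contradiction ab ¬ab) , ((λ _ → bc) , λ _ → refl) ,
      ((λ ()) , λ ac → contradiction (trans ac (sym bc)) ¬ab)

    split-ac : Same i a c → ¬ Same i a b → Split a b c i 0 1 0
    split-ac ac ¬ab = ((λ ()) , λ ab → contradiction ab ¬ab) , ((λ ()) , λ bc → contradiction (trans ac (sym bc)) ¬ab) ,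
      ((λ _ → ac) , λ _ → refl)

    split-ab : Same i a b → ¬ Same i b c → Split a b c i 0 0 1
    split-ab ab ¬bc = ((λ _ → ab) , λ _ → refl) , ((λ ()) , λ bc → contradiction bc ¬bc) ,
      ((λ ()) , λ ac → contradiction (trans (sym ab) ac) ¬bc)

    split-none : ¬ Same i a b → ¬ Same i b c → ¬ Same i a c → Split a b c i 0 1 2
    split-none ¬ab ¬bc ¬ac = ((λ ()) , λ s → contradiction s ¬ab) , ((λ ()) , λ s → contradiction s ¬bc) ,
      ((λ ()) , λ s → contradiction s ¬ac)

  module Refute {K budget a b c} (tri : Transversal a b c) (nocover : NoCover budget) (cols : List (Fin k))
    (len : length cols ≡ K) (full : ∀ i → i ∈ cols) where

    open Refutation K budget

    col : Fin K → Fin k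
    col j = List.lookup cols (subst Fin (sym len) j)

    col-onto : ∀ i → ∃[ j ] col j ≡ i
    col-onto i = subst Fin len (Any.index (full i)) ,
      trans (cong (List.lookup cols) (subst-sym-subst len)) (sym (Any.lookup-index (full i)))

    open Soundness cls lab inhabited facts nocover col col-onto

    refute : ∀ cert u v w → (∀ i → Split a b c (col i) (Vec.lookup u i) (Vec.lookup v i) (Vec.lookup w i)) →
      Check cert ((0 , u) ∷ (1 , v) ∷ (2 , w) ∷ []) → ⊥
    refute cert u v w splits = sound cert L faithful all-classes
      where
      L : List (Fin n × Row)
      L = (a , (0 , u)) ∷ (b , (1 , v)) ∷ (c , (2 , w)) ∷ []
      self : ∀ {x d s} → Describes (x , (d , s)) (x , (d , s))
      self = (λ _ → refl) , (λ _ → refl) , λ i → (λ _ → refl) , (λ _ → refl)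
      ab : Describes (a , (0 , u)) (b , (1 , v))
      ab = (λ ()) , (λ eq → contradiction eq (a≢b tri)) , λ i → proj₁ (splits i)
      bc : Describes (b , (1 , v)) (c , (2 , w))
      bc = (λ ()) , (λ eq → contradiction eq (b≢c tri)) , λ i → proj₁ (proj₂ (splits i))
      ac : Describes (a , (0 , u)) (c , (2 , w))
      ac = (λ ()) , (λ eq → contradiction eq (a≢c tri)) , λ i → proj₂ (proj₂ (splits i))
      faithful : Faithful L
      faithful (here refl) (here refl) = self {s = u}
      faithful (here refl) (there (here refl)) = ab
      faithful (here refl) (there (there (here refl))) = ac
      faithful (there (here refl)) (here refl) = describes-sym (a , (0 , u)) (b , (1 , v)) ab
      faithful (there (here refl)) (there (here refl)) = self {s = v}
      faithful (there (here refl)) (there (there (here refl))) = bc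
      faithful (there (there (here refl))) (here refl) = describes-sym (a , (0 , u)) (c , (2 , w)) ac
      faithful (there (there (here refl))) (there (here refl)) = describes-sym (b , (1 , v)) (c , (2 , w)) bc
      faithful (there (there (here refl))) (there (there (here refl))) = self {s = w}
      all-classes : AllClasses L
      all-classes z with some-class tri z
      ... | inj₁ eq = here (s≤s z≤n , sym eq)
      ... | inj₂ (inj₁ eq) = there (here (s≤s (s≤s z≤n) , sym eq))
      ... | inj₂ (inj₂ eq) = there (there (here (s≤s (s≤s (s≤s z≤n)) , sym eq)))

  record Pairs (a b c : Fin n) (o : Fin k) : Set where
    field
      one : OneShared a b c o
      bc-col ac-col ab-col : Fin k
      bc-same : Same bc-col b c
      ac-same : Same ac-col a c
      ab-same : Same ab-col a b
      bc≢o : bc-col ≢ o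
      ac≢o : ac-col ≢ o
      ab≢o : ab-col ≢ o

    bc¬ab : ∀ {i} → i ≢ o → Same i b c → ¬ Same i a b
    bc¬ab i≢o bc ab = i≢o (only one ab bc)

    ac¬ab : ∀ {i} → i ≢ o → Same i a c → ¬ Same i a b
    ac¬ab i≢o ac ab = i≢o (only one ab (trans (sym ab) ac))

    ab¬bc : ∀ {i} → i ≢ o → Same i a b → ¬ Same i b c
    ab¬bc i≢o ab bc = i≢o (only one ab bc)

    four-unique : Unique (o ∷ bc-col ∷ ac-col ∷ ab-col ∷ [])
    four-unique = (≢-sym bc≢o ∷ ≢-sym ac≢o ∷ ≢-sym ab≢o ∷ []) ∷
      ((λ eq → ac¬ab ac≢o ac-same (trans ac-same (sym (subst (λ i → Same i b c) eq bc-same)))) ∷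
       (λ eq → ab¬bc ab≢o ab-same (subst (λ i → Same i b c) eq bc-same)) ∷ []) ∷
      ((λ eq → ac¬ab ac≢o ac-same (subst (λ i → Same i a b) (sym eq) ab-same)) ∷ []) ∷ [] ∷ []

  pairs : ∀ {a b c o} → OneShared a b c o → Pairs a b c o
  pairs M with shared-again (rotate (trans′ M)) (o-bc M)
             | shared-again (rotate (rotate (trans′ M))) (sym (trans (o-ab M) (o-bc M)))
             | shared-again (trans′ M) (o-ab M)
  ... | p , p≢o , bc | q , q≢o , ca | s , s≢o , ab = record
    { one = M ; bc-col = p ; ac-col = q ; ab-col = s ; bc-same = bc ; ac-same = sym ca ; ab-same = ab
    ; bc≢o = p≢o ; ac≢o = q≢o ; ab≢o = s≢o }

  rotate-pairs : ∀ {a b c o} → Pairs a b c o → Pairs b c a o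
  rotate-pairs P = record
    { one = rotate₁ one ; bc-col = ac-col ; ac-col = ab-col ; ab-col = bc-col
    ; bc-same = sym ac-same ; ac-same = sym ab-same ; ab-same = bc-same
    ; bc≢o = ac≢o ; ac≢o = ab≢o ; ab≢o = bc≢o }
    where open Pairs P

  -- The common colour and one further colour for each pair are already four distinct colours.
  three-colours : ∀ {a b c o} → k ≡ 3 → OneShared a b c o → ⊥
  three-colours refl M = contradiction (unique⇒length≤ (Pairs.four-unique (pairs M))) λ { (s≤s (s≤s (s≤s ()))) }

  four-colours : ∀ {a b c o} → k ≡ 4 → NoCover 2 → OneShared a b c o → ⊥
  four-colours {o = o} refl nocover M =
    Refute.refute (trans′ M) nocover (o ∷ bc-col ∷ ac-col ∷ ab-col ∷ []) refl (unique-full four-unique refl)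
      Certificates.four _ _ _ splits Certificates.four-ok
    where
    open Pairs (pairs M)
    splits : ∀ (i : Fin 4) → _
    splits 0F = split-all (o-ab M) (o-bc M)
    splits 1F = split-bc bc-same (bc¬ab bc≢o bc-same)
    splits 2F = split-ac ac-same (ac¬ab ac≢o ac-same)
    splits 3F = split-ab ab-same (ab¬bc ab≢o ab-same)

  module _ (k≡5 : k ≡ 5) (nocover : NoCover 3) where

    -- The fifth colour joins b and c as well; rotating the triple brings the other two pairs into
    -- this position.
    double : ∀ {a b c o} (P : Pairs a b c o) (x : Fin k) →
      x ≢ o → x ≢ Pairs.bc-col P → Same x b c → ⊥
    double {a} {b} {c} {o} P x x≢o x≢bc bc-x =
      Refute.refute (trans′ one) nocover (o ∷ bc-col ∷ x ∷ ac-col ∷ ab-col ∷ []) refl (unique-full (uniq four-unique) (sym k≡5))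
        Certificates.five-double _ _ _ splits Certificates.five-double-ok
      where
      open Pairs P
      uniq : Unique (o ∷ bc-col ∷ ac-col ∷ ab-col ∷ []) → Unique (o ∷ bc-col ∷ x ∷ ac-col ∷ ab-col ∷ [])
      uniq ((o₁ ∷ o₂ ∷ o₃ ∷ []) ∷ (p₁ ∷ p₂ ∷ []) ∷ rest) =
        (o₁ ∷ ≢-sym x≢o ∷ o₂ ∷ o₃ ∷ []) ∷ (≢-sym x≢bc ∷ p₁ ∷ p₂ ∷ []) ∷
        ((λ { refl → ac¬ab ac≢o ac-same (trans ac-same (sym bc-x)) }) ∷ (λ { refl → ab¬bc ab≢o ab-same bc-x }) ∷ []) ∷ rest
      splits : ∀ (i : Fin 5) → _
      splits 0F = split-all (o-ab one) (o-bc one)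
      splits 1F = split-bc bc-same (bc¬ab bc≢o bc-same)
      splits 2F = split-bc bc-x (bc¬ab x≢o bc-x)
      splits 3F = split-ac ac-same (ac¬ab ac≢o ac-same)
      splits 4F = split-ab ab-same (ab¬bc ab≢o ab-same)

    five-colours : ∀ {a b c o} → OneShared a b c o → ⊥
    five-colours {a} {b} {c} {o} M
      with shorter⇒missing (o ∷ Pairs.bc-col (pairs M) ∷ Pairs.ac-col (pairs M) ∷ Pairs.ab-col (pairs M) ∷ []) (≤-reflexive (sym k≡5))
    ... | x , x∉ = by-cases (same? x a b) (same? x b c) (same? x a c)
      where
      P : Pairs a b c o
      P = pairs M
      open Pairs P
      by-cases : Dec (Same x a b) → Dec (Same x b c) → Dec (Same x a c) → ⊥
      by-cases _ (yes bc) _ = double P x (x∉ ∘ here) (x∉ ∘ there ∘ here) bc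
      by-cases _ _ (yes ac) = double (rotate-pairs P) x (x∉ ∘ here) (x∉ ∘ there ∘ there ∘ here) (sym ac)
      by-cases (yes ab) _ _ =
        double (rotate-pairs (rotate-pairs P)) x (x∉ ∘ here) (x∉ ∘ there ∘ there ∘ there ∘ here) ab
      by-cases (no ¬ab) (no ¬bc) (no ¬ac) =
        Refute.refute (trans′ M) nocover (o ∷ bc-col ∷ ac-col ∷ ab-col ∷ x ∷ []) refl (unique-full (uniq four-unique) (sym k≡5))
          Certificates.five-rainbow _ _ _ splits Certificates.five-rainbow-ok
        where
        uniq : Unique (o ∷ bc-col ∷ ac-col ∷ ab-col ∷ []) → Unique (o ∷ bc-col ∷ ac-col ∷ ab-col ∷ x ∷ [])
        uniq ((o₁ ∷ o₂ ∷ o₃ ∷ []) ∷ (p₁ ∷ p₂ ∷ []) ∷ (q₁ ∷ []) ∷ rest) =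
          (o₁ ∷ o₂ ∷ o₃ ∷ (x∉ ∘ here ∘ sym) ∷ []) ∷ (p₁ ∷ p₂ ∷ (x∉ ∘ there ∘ here ∘ sym) ∷ []) ∷
          (q₁ ∷ (x∉ ∘ there ∘ there ∘ here ∘ sym) ∷ []) ∷ ((x∉ ∘ there ∘ there ∘ there ∘ here ∘ sym) ∷ []) ∷ [] ∷ []
        splits : ∀ (i : Fin 5) → _
        splits 0F = split-all (o-ab M) (o-bc M)
        splits 1F = split-bc bc-same (bc¬ab bc≢o bc-same)
        splits 2F = split-ac ac-same (ac¬ab ac≢o ac-same)
        splits 3F = split-ab ab-same (ab¬bc ab≢o ab-same)
        splits 4F = split-none ¬ab ¬bc ¬ac

-- Edges as transversals for r = 3 and ℓ = 1

module ThreeClasses {n k : ℕ} (cls : Fin n → Fin 3) (lab : Fin k → Fin n → Fin n)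
  (inhabited : ∀ j → ∃[ z ] cls z ≡ j)
  (edge-mono : Labelling.EveryEdgeMono cls lab 1) (spanning : Labelling.SpanningLabels cls lab 1) where

  open Labelling cls lab 1

  open Tripartite cls lab

  3≤3 : 3 ≤ 3
  3≤3 = ≤-refl

  transversal⇒edge : ∀ {a b c} → Transversal a b c → Edge (a ∷ b ∷ c ∷ [])
  transversal⇒edge {a} {b} {c} t = refl , AllPairs.map (λ neq → neq ∘ cong cls) distinct , λ j →
    at-most-one (AllPairs.filter⁺ (λ v → cls v Fin.≟ j) distinct) (All.all-filter (λ v → cls v Fin.≟ j) (a ∷ b ∷ c ∷ []))
    where
    distinct : AllPairs (λ x y → cls x ≢ cls y) (a ∷ b ∷ c ∷ [])
    distinct = (a≢b t ∷ a≢c t ∷ []) ∷ (b≢c t ∷ []) ∷ [] ∷ []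
    at-most-one : ∀ {j xs} → AllPairs (λ x y → cls x ≢ cls y) xs → All (λ x → cls x ≡ j) xs → length xs ≤ 1
    at-most-one [] _ = z≤n
    at-most-one (_ ∷ []) _ = ≤-refl
    at-most-one ((x≢y ∷ _) ∷ _ ∷ _) (px ∷ py ∷ _) = contradiction (trans px (sym py)) x≢y

  edge⇒transversal : ∀ {a b c} → Edge (a ∷ b ∷ c ∷ []) → Transversal a b c
  edge⇒transversal {a} {b} {c} E@(_ , u@((a≢b ∷ a≢c ∷ []) ∷ (b≢c ∷ []) ∷ _) , le) = transversal
    (different (here refl) (there (here refl)) a≢b)
    (different (there (here refl)) (there (there (here refl))) b≢c)
    (different (here refl) (there (there (here refl))) a≢c)
    where
    different : ∀ {x y} → x ∈ a ∷ b ∷ c ∷ [] → y ∈ a ∷ b ∷ c ∷ [] → x ≢ y → cls x ≢ cls y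
    different {x} {y} x∈ y∈ x≢y eq = <⇒≱ (s≤s (le (cls x)))
      (unique-⊆⇒length≤ {xs = x ∷ y ∷ []} {ys = fibre (a ∷ b ∷ c ∷ []) (cls x)} ((x≢y ∷ []) ∷ [] ∷ []) λ where
        (here refl) → ∈-fibre⁺ x∈
        (there (here refl)) → subst (λ j → y ∈ fibre (a ∷ b ∷ c ∷ []) j) (sym eq) (∈-fibre⁺ y∈))

  -- An edge has three vertices with at most one in each class, so one of them is in neither the
  -- class of a nor that of b.
  meets : ∀ {a b c e} → Transversal a b c → Edge e → ∃[ w ] w ∈ e × cls w ≡ cls c
  meets {a} {b} {c} {e} t (len , _ , le) with larger-fibre e (a ∷ b ∷ []) (≤-reflexive (sym len))
  ... | j , lt with fibre e j in eq
  ... | w ∷ _ with ∈-fibre⁻ {xs = e} {j} (subst (w ∈_) (sym eq) (here refl))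
  ... | w∈ , refl with some-class t w
  ... | inj₂ (inj₂ wc) = w , w∈ , wc
  ... | inj₁ wa = contradiction lt (≤⇒≯ (≤-trans (subst (λ l → length l ≤ 1) eq (le (cls w)))
    (subst (λ j → 1 ≤ length (fibre (a ∷ b ∷ []) j)) (sym wa) (∈-length (∈-fibre⁺ {xs = a ∷ b ∷ []} (here refl))))))
  ... | inj₂ (inj₁ wb) = contradiction lt (≤⇒≯ (≤-trans (subst (λ l → length l ≤ 1) eq (le (cls w)))
    (subst (λ j → 1 ≤ length (fibre (a ∷ b ∷ []) j)) (sym wb) (∈-length (∈-fibre⁺ {xs = a ∷ b ∷ []} (there (here refl)))))))

  meets-class : ∀ {a b c e} → Transversal a b c → Edge e → ∀ j → ∃[ w ] w ∈ e × cls w ≡ j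
  meets-class t E j with inhabited j
  ... | z , refl with some-class t z
  ... | inj₁ za = let (w , w∈ , eq) = meets (rotate t) E in w , w∈ , trans eq (sym za)
  ... | inj₂ (inj₁ zb) = let (w , w∈ , eq) = meets (rotate (rotate t)) E in w , w∈ , trans eq (sym zb)
  ... | inj₂ (inj₂ zc) = let (w , w∈ , eq) = meets t E in w , w∈ , trans eq (sym zc)

  facts : NoCover 1 → Facts
  facts nocover₁ = record
    { shared = λ t → let (i , m) = edge-mono (transversal⇒edge t)
                     in i , m (here refl) (there (here refl)) , m (there (here refl)) (there (there (here refl)))
    ; shared-again = again
    ; into-class = λ {a} {b} t ab x j →
        let (e , E , x∈ , m) = spanning ab (a≢b t ∘ cong cls) x
            (w , w∈ , eq) = meets-class t E j
        in w , eq , m w∈ x∈ }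
    where
    open NoSingleComponent edge-mono spanning 3≤3 nocover₁
    again : ∀ {a b c i} → Transversal a b c → Same i a b → ∃[ j ] j ≢ i × Same j a b
    again {a} {b} {c} {i} t ab with escape (transversal⇒edge (rotate (rotate t))) m
      where
      m : Mono i (a ∷ b ∷ [])
      m (here refl) (here refl) = refl
      m (here refl) (there (here refl)) = ab
      m (there (here refl)) (here refl) = sym ab
      m (there (here refl)) (there (here refl)) = refl
    ... | w , Ew , far with edge-mono Ew
    ... | j , mj = j , (λ { refl → far (here refl) (mj (here refl) (there (here refl))) }) ,
      mj (there (here refl)) (there (there (here refl)))

  module _ (3≤k : 3 ≤ k) (nocover : NoCover (k ∸ 2)) where

    k≤ : k ≤ 3 + (k ∸ 3) * 1
    k≤ = ≤-reflexive (trans (sym (m+[n∸m]≡n 3≤k)) (cong (3 +_) (sym (*-identityʳ (k ∸ 3)))))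

    nocover′ : NoCover (suc (k ∸ 3))
    nocover′ = subst NoCover (+-∸-assoc 1 3≤k) nocover

    nocover₁ : NoCover 1
    nocover₁ = NoCover-≤ (s≤s z≤n) nocover′

    open NoSingleComponent edge-mono spanning 3≤3 nocover₁
    open General.Counting cls lab 1 edge-mono spanning 3≤3 ≤-refl (s≤s z≤n) (k ∸ 3) k≤ nocover′

    -- The general counting still excludes a minimal edge with two common colours, here with q equal
    -- to `k ∸ 3`; only the case of a single common colour needs its own argument.
    with-one-shared : (∀ {a b c o} → OneShared a b c o → ⊥) → ⊥
    with-one-shared impossible =
      minimal-edge (transversal-edge ≤-refl (proj₁ ∘ inhabited) (proj₂ ∘ inhabited)) λ M → from-list M (proj₁ (proj₁ M)) (one-common M)
      where
      from-list : ∀ {e} → Minimal e → length e ≡ 3 → (∃[ o ] common e ≡ o ∷ []) → ⊥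
      from-list {a ∷ b ∷ c ∷ []} (E , _) refl (o , eq) = impossible record
        { trans′ = edge⇒transversal E
        ; o-ab = m (here refl) (there (here refl))
        ; o-bc = m (there (here refl)) (there (there (here refl)))
        ; only = λ ab bc → is-o (∈-common⁺ {xs = e} (mono ab bc)) }
        where
        e : List V
        e = a ∷ b ∷ c ∷ []
        m : Mono o e
        m = ∈-common⁻ e (subst (o ∈_) (sym eq) (here refl))
        is-o : ∀ {i} → i ∈ common e → i ≡ o
        is-o i∈ with subst (_ ∈_) eq i∈
        ... | here i≡o = i≡o
        mono : ∀ {i} → Same i a b → Same i b c → Mono i e
        mono {i} ab bc x∈ y∈ = trans (to-b x∈) (sym (to-b y∈))
          where
          to-b : ∀ {x} → x ∈ e → Same i x b
          to-b (here refl) = ab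
          to-b (there (here refl)) = refl
          to-b (there (there (here refl))) = sym bc

  few-colours : 3 ≤ k → k ≤ 5 → NoCover (k ∸ 2) → ⊥
  few-colours 3≤k k≤5 nocover = with-one-shared 3≤k nocover (cases (k ≟ 3) (k ≟ 4))
    where
    open FewColours cls lab inhabited (facts (nocover₁ 3≤k nocover))
    cases : Dec (k ≡ 3) → Dec (k ≡ 4) → ∀ {a b c o} → OneShared a b c o → ⊥
    cases (yes k≡3) _ = three-colours k≡3
    cases (no _) (yes k≡4) = four-colours k≡4 (subst (λ k → NoCover (k ∸ 2)) k≡4 nocover)
    cases (no k≢3) (no k≢4) = five-colours k≡5 (subst (λ k → NoCover (k ∸ 2)) k≡5 nocover)
      where
      k≡5 : k ≡ 5
      k≡5 = ≤-antisym k≤5 (≤∧≢⇒< (≤∧≢⇒< 3≤k (≢-sym k≢3)) (≢-sym k≢4))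

  -- The extra component is what allows one component to be prescribed in every colour but p. It
  -- also allows two of the same colour, as k ≥ 3.
  any-colours : 3 ≤ k → NoCover (k ∸ 1) → ⊥
  any-colours 3≤k nocover = with-one-shared 3≤k nocover₋ (AlmostAllColours.impossible (facts (nocover₁ 3≤k nocover₋)) almost-all two)
    where
    open Removal {A = Fin k} Fin._≟_ using () renaming (_∖_ to _-_; ∖-↭ to -↭; ∈-∖⁺ to ∈-⁺)
    nocover₋ : NoCover (k ∸ 2)
    nocover₋ = NoCover-≤ (∸-monoʳ-≤ k (s≤s z≤n)) nocover
    almost-all : ∀ p (choice : Fin k → Fin n) → ∃[ v ] ∀ i → i ≢ p → ¬ Same i v (choice i)
    almost-all p choice with nocover (map (λ i → i , choice i) (allFin k - p)) (≤-reflexive (begin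
        length (map (λ i → i , choice i) (allFin k - p)) ≡⟨ length-map _ (allFin k - p) ⟩
        length (allFin k - p)                            ≡⟨ cong pred (↭-length (-↭ (Unique.allFin⁺ k) (∈-allFin p))) ⟨
        pred (length (allFin k))                         ≡⟨ cong pred (length-tabulate {n = k} id) ⟩
        k ∸ 1                                            ∎))
      where
      open ≡-Reasoning
    ... | v , miss = v , λ i i≢p → miss _ (∈-map⁺ (λ i → i , choice i) (∈-⁺ {xs = allFin k} (∈-allFin i) i≢p))
    two : ∀ i x y → ∃[ v ] ¬ Same i v x × ¬ Same i v y
    two i x y with nocover ((i , x) ∷ (i , y) ∷ []) (∸-monoˡ-≤ 1 3≤k)
    ... | v , miss = v , miss _ (here refl) , miss _ (there (here refl))

-- From colourings to labels

elements : ∀ {n} → Subset n → List (Fin n)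
elements [] = []
elements (inside ∷ p) = zero ∷ map suc (elements p)
elements (outside ∷ p) = map suc (elements p)

∈-elements⁺ : ∀ {n} {p : Subset n} {x} → x ∈ₛ p → x ∈ elements p
∈-elements⁺ {p = inside ∷ p} Vec.here = here refl
∈-elements⁺ {p = inside ∷ p} (Vec.there x∈) = there (∈-map⁺ suc (∈-elements⁺ x∈))
∈-elements⁺ {p = outside ∷ p} (Vec.there x∈) = ∈-map⁺ suc (∈-elements⁺ x∈)

∈-elements⁻ : ∀ {n} (p : Subset n) {x} → x ∈ elements p → x ∈ₛ p
∈-elements⁻ (inside ∷ p) (here refl) = Vec.here
∈-elements⁻ (inside ∷ p) (there x∈) with ∈-map⁻ suc x∈
... | y , y∈ , refl = Vec.there (∈-elements⁻ p y∈)
∈-elements⁻ (outside ∷ p) x∈ with ∈-map⁻ suc x∈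
... | y , y∈ , refl = Vec.there (∈-elements⁻ p y∈)

elements-unique : ∀ {n} (p : Subset n) → Unique (elements p)
elements-unique [] = []
elements-unique (inside ∷ p) =
  All.map⁺ (All.tabulate λ _ ()) ∷ Unique.map⁺ Fin.suc-injective (elements-unique p)
elements-unique (outside ∷ p) = Unique.map⁺ Fin.suc-injective (elements-unique p)

length-elements : ∀ {n} (p : Subset n) → length (elements p) ≡ ∣ p ∣
length-elements [] = refl
length-elements (inside ∷ p) = cong suc (trans (length-map suc (elements p)) (length-elements p))
length-elements (outside ∷ p) = trans (length-map suc (elements p)) (length-elements p)

subset-of : ∀ {n} {P : Fin n → Set} → (∀ x → Dec (P x)) → Subset n
subset-of P? = Vec.tabulate (does ∘ P?)

∈-subset-of⁺ : ∀ {n} {P : Fin n → Set} (P? : ∀ x → Dec (P x)) {x} → P x → x ∈ₛ subset-of P?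
∈-subset-of⁺ P? {x} px = lookup⇒[]= x _ (trans (lookup∘tabulate (does ∘ P?) x) (dec-true (P? x) px))

∈-subset-of⁻ : ∀ {n} {P : Fin n → Set} (P? : ∀ x → Dec (P x)) {x} → x ∈ₛ subset-of P? → P x
∈-subset-of⁻ P? {x} x∈ with P? x | trans (sym (lookup∘tabulate (does ∘ P?) x)) ([]=⇒lookup x∈)
... | yes px | _ = px
... | no _ | ()

fromList : ∀ {n} → List (Fin n) → Subset n
fromList xs = subset-of (_∈? xs)
  where open import Data.List.Membership.DecPropositional Fin._≟_ using (_∈?_)

module _ {n : ℕ} {xs : List (Fin n)} where

  open import Data.List.Membership.DecPropositional {A = Fin n} Fin._≟_ using (_∈?_)

  ∈-fromList⁺ : ∀ {x} → x ∈ xs → x ∈ₛ fromList xs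
  ∈-fromList⁺ = ∈-subset-of⁺ (_∈? xs)

  ∈-fromList⁻ : ∀ {x} → x ∈ₛ fromList xs → x ∈ xs
  ∈-fromList⁻ = ∈-subset-of⁻ (_∈? xs)

  ∣fromList∣ : Unique xs → ∣ fromList xs ∣ ≡ length xs
  ∣fromList∣ u = trans (sym (length-elements (fromList xs))) (≤-antisym
    (unique-⊆⇒length≤ (elements-unique (fromList xs)) (∈-fromList⁻ ∘ ∈-elements⁻ (fromList xs)))
    (unique-⊆⇒length≤ u (∈-elements⁺ ∘ ∈-fromList⁺)))

module _ {n r : ℕ} (P : Partition n r) where

  open Partition P

  open Fibres classOf

  length-fibre-elements : ∀ e j → length (fibre (elements e) j) ≡ ∣ e ∩ class j ∣
  length-fibre-elements e j = trans (≤-antisym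
      (unique-⊆⇒length≤ (Unique.filter⁺ _ (elements-unique e)) to)
      (unique-⊆⇒length≤ (elements-unique (e ∩ class j)) from))
    (length-elements (e ∩ class j))
    where
    to : fibre (elements e) j ⊆ elements (e ∩ class j)
    to x∈ with ∈-fibre⁻ {xs = elements e} x∈
    ... | x∈e , eq = ∈-elements⁺ (x∈p∩q⁺ (∈-elements⁻ e x∈e , ∈-subset-of⁺ (λ v → classOf v Fin.≟ j) eq))
    from : elements (e ∩ class j) ⊆ fibre (elements e) j
    from x∈ with x∈p∩q⁻ e (class j) (∈-elements⁻ (e ∩ class j) x∈)
    ... | x∈e , x∈j with ∈-subset-of⁻ (λ v → classOf v Fin.≟ j) x∈j
    ... | refl = ∈-fibre⁺ (∈-elements⁺ x∈e)

  module _ {k ℓ : ℕ} {lab : Fin k → Fin n → Fin n} where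

    open Labelling classOf lab ℓ using (Edge)

    edge-elements : ∀ {e} → CompletePartite ℓ P e → Edge (elements e)
    edge-elements {e} (size , le) = trans (length-elements e) size , elements-unique e ,
      λ j → ≤-trans (≤-reflexive (length-fibre-elements e j)) (le j)

    edge-fromList : ∀ {xs} → Edge xs → CompletePartite ℓ P (fromList xs)
    edge-fromList {xs} (len , u , le) = trans (∣fromList∣ u) len , λ j → begin
      ∣ fromList xs ∩ class j ∣                 ≡⟨ length-fibre-elements (fromList xs) j ⟨
      length (fibre (elements (fromList xs)) j) ≤⟨ unique-⊆⇒length≤ (Unique.filter⁺ _ (elements-unique (fromList xs))) (sub j) ⟩
      length (fibre xs j)                       ≤⟨ le j ⟩
      ℓ                                         ∎
      where
      open ≤-Reasoning
      sub : ∀ j → fibre (elements (fromList xs)) j ⊆ fibre xs j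
      sub j x∈ with ∈-fibre⁻ {xs = elements (fromList xs)} x∈
      ... | x∈e , refl = ∈-fibre⁺ (∈-fromList⁻ {xs = xs} (∈-elements⁻ (fromList xs) x∈e))

-- Merging labels edge by edge makes connectedness decidable.
module Components {n : ℕ} where

  label : List (Fin n × Fin n) → Fin n → Fin n
  label [] x = x
  label ((a , b) ∷ L) x = if does (label L x Fin.≟ label L b) then label L a else label L x

  label-edge : ∀ L {a b} → (a , b) ∈ L → label L a ≡ label L b
  label-edge ((a , b) ∷ L) (here refl) with label L a Fin.≟ label L b | label L b Fin.≟ label L b
  ... | yes _ | yes _ = refl
  ... | no _ | yes _ = refl
  ... | _ | no neq = contradiction refl neq
  label-edge ((a , b) ∷ L) {x} {y} (there xy∈) =
    cong (λ l → if does (l Fin.≟ label L b) then label L a else l) (label-edge L xy∈)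

  module _ {R : Fin n → Fin n → Set} (R-sym : ∀ {x y} → R x y → R y x) where

    label-sound : ∀ L → (∀ {x y} → (x , y) ∈ L → R x y) → ∀ {x y} → label L x ≡ label L y → Star R x y
    label-sound [] _ refl = ε
    label-sound ((a , b) ∷ L) edges {x} {y} eq with label L x Fin.≟ label L b | label L y Fin.≟ label L b
    ... | yes p | yes q = label-sound L (edges ∘ there) (trans p (sym q))
    ... | no _ | no _ = label-sound L (edges ∘ there) eq
    ... | yes p | no _ = label-sound L (edges ∘ there) p ◅◅ R-sym (edges (here refl)) ◅
      label-sound L (edges ∘ there) eq
    ... | no _ | yes q = label-sound L (edges ∘ there) eq ◅◅ edges (here refl) ◅
      label-sound L (edges ∘ there) (sym q)

    module _ (R? : ∀ x y → Dec (R x y)) where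

      edge-list : List (Fin n × Fin n)
      edge-list = filter (λ (x , y) → R? x y) (cartesianProduct (allFin n) (allFin n))

      component-label : Fin n → Fin n
      component-label = label edge-list

      connected⇒same : ∀ {x y} → Star R x y → component-label x ≡ component-label y
      connected⇒same ε = refl
      connected⇒same {x} (_◅_ {j = y} xy path) = trans
        (label-edge edge-list (∈-filter⁺ (λ (x , y) → R? x y)
          (∈-cartesianProduct⁺ {xs = allFin n} {ys = allFin n} (∈-allFin x) (∈-allFin y)) xy))
        (connected⇒same path)

      same⇒connected : ∀ {x y} → component-label x ≡ component-label y → Star R x y
      same⇒connected = label-sound edge-list λ xy∈ →
        proj₂ (∈-filter⁻ (λ (x , y) → R? x y) {xs = cartesianProduct (allFin n) (allFin n)} xy∈)

-- This bounded search turns the refutation of `NoCover` into an actual cover.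
short-list? : ∀ {k n} m {P : List (Fin k × Fin n) → Set} → (∀ L → Dec (P L)) →
  Dec (∃[ L ] length L ≤ m × P L)
short-list? zero P? = map′ (λ p → [] , z≤n , p) (λ { ([] , _ , p) → p }) (P? [])
short-list? (suc m) P? = map′
  (λ { (inj₁ p) → [] , z≤n , p ; (inj₂ (i , x , L , le , p)) → (i , x) ∷ L , s≤s le , p })
  (λ { ([] , _ , p) → inj₁ p ; ((i , x) ∷ L , s≤s le , p) → inj₂ (i , x , L , le , p) })
  (P? [] ⊎-dec Fin.any? λ i → Fin.any? λ x → short-list? m λ L → P? ((i , x) ∷ L))

module _ {r ℓ k m : ℕ}
  (uncoverable : ∀ {n} (cls : Fin n → Fin r) (lab : Fin k → Fin n → Fin n) → (∀ j → ∃[ z ] cls z ≡ j) →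
    Labelling.EveryEdgeMono cls lab ℓ → Labelling.SpanningLabels cls lab ℓ → Labelling.NoCover cls lab ℓ m → ⊥) where

  always-coverable : AlwaysCoverableBy≤ r ℓ k m
  always-coverable {n} P c spanning = conclude (short-list? m covers?)
    where
    open Partition P
    H : Hypergraph n
    H = CompletePartite ℓ P
    H? : ∀ e → Dec (H e)
    H? e = (∣ e ∣ ≟ r) ×-dec Fin.all? (λ j → ∣ e ∩ class j ∣ ≤? ℓ)
    coloured? : ∀ i e → Dec (OfColour c i e)
    coloured? i e with H? e
    ... | no ¬h = no (¬h ∘ proj₁)
    -- The colour does not depend on the proof of `H e`, so deciding it at h settles it for every
    -- proof.
    ... | yes h = map′ (h ,_) proj₂ (c e h Fin.≟ i)
    R : Fin k → Fin n → Fin n → Set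
    R i = ShareEdge (OfColour c i)
    R-sym : ∀ i {x y} → R i x y → R i y x
    R-sym i (e , h , x∈ , y∈) = e , h , y∈ , x∈
    R? : ∀ i x y → Dec (R i x y)
    R? i x y = anySubset? λ e → coloured? i e ×-dec x ∈ₛ? e ×-dec y ∈ₛ? e
    lab : Fin k → Fin n → Fin n
    lab i = Components.component-label (R-sym i) (R? i)
    connected⇒same : ∀ {i x y} → Star (R i) x y → lab i x ≡ lab i y
    connected⇒same {i} = Components.connected⇒same (R-sym i) (R? i)
    same⇒connected : ∀ {i x y} → lab i x ≡ lab i y → Star (R i) x y
    same⇒connected {i} = Components.same⇒connected (R-sym i) (R? i)
    open Labelling classOf lab ℓ
    edge-mono : EveryEdgeMono
    edge-mono {e} E = c (fromList e) h , λ x∈ y∈ →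
      connected⇒same ((fromList e , (h , refl) , ∈-fromList⁺ x∈ , ∈-fromList⁺ y∈) ◅ ε)
      where
      h : H (fromList e)
      h = edge-fromList P {lab = lab} E
    spanning-labels : SpanningLabels
    spanning-labels {i} same u≢v w with same⇒connected {i} same
    -- A path between distinct vertices starts with an edge of colour i, so i is a colour in use and
    -- must span.
    ... | ε = contradiction refl u≢v
    ... | (e , col , _) ◅ _ with spanning i (e , col) w
    ... | f , w∈ , h , eq = elements f , edge-elements P {lab = lab} {e = f} h , ∈-elements⁺ w∈ , λ x∈ y∈ →
      connected⇒same ((f , (h , eq) , ∈-elements⁻ f x∈ , ∈-elements⁻ f y∈) ◅ ε)
    inhabited : ∀ j → ∃[ z ] classOf z ≡ j
    inhabited j with class-nonempty j
    ... | z , z∈ = z , ∈-subset-of⁻ (λ v → classOf v Fin.≟ j) z∈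
    Covers : List Component → Set
    Covers L = ∀ v → Any (λ (i , x) → lab i v ≡ lab i x) L
    covers? : ∀ L → Dec (Covers L)
    covers? L = Fin.all? λ v → Any.any? (λ (i , x) → lab i v Fin.≟ lab i x) L
    component : Component → Subset n
    component (i , x) = subset-of (λ v → lab i v Fin.≟ lab i x)
    monochromatic : ∀ p → MonochromaticComponent c (component p)
    monochromatic (i , x) = i , x , λ y → mk⇔
      (λ y∈ → same⇒connected (sym (∈-subset-of⁻ (λ v → lab i v Fin.≟ lab i x) y∈)))
      (λ path → ∈-subset-of⁺ (λ v → lab i v Fin.≟ lab i x) (sym (connected⇒same path)))
    conclude : Dec (∃[ L ] length L ≤ m × Covers L) → CoverableBy≤ c m
    conclude (yes (L , le , cover)) = map component L , subst (_≤ m) (sym (length-map component L)) le ,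
      All.map⁺ (All.tabulate λ {p} _ → monochromatic p) ,
      λ v → Any.map⁺ (Any.map (λ {(i , x)} → ∈-subset-of⁺ (λ v → lab i v Fin.≟ lab i x)) (cover v))
    conclude (no none) = ⊥-elim (uncoverable classOf lab inhabited edge-mono spanning-labels λ L le → missed L le)
      where
      missed : NoCover m
      missed L le with Fin.any? (λ v → ¬? (Any.any? (λ (i , x) → lab i v Fin.≟ lab i x) L))
      ... | yes (v , ¬any) = v , λ p p∈ eq → ¬any (lose p∈ eq)
      ... | no all = contradiction (L , le , λ v → decidable-stable (Any.any? (λ (i , x) → lab i v Fin.≟ lab i x) L) λ ¬any → all (v , ¬any)) none

-- The lower bound

-- Pads the colours of at most q components to a choice of exactly q, as carried by a vertex.
fill : ∀ {A : Set} q (xs : List A) → A → length xs ≤ q → ∃[ f ] (∀ {x} → x ∈ xs → x ∈ List.tabulate {n = q} f)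
fill q [] d _ = (λ _ → d) , λ ()
fill (suc q) (x ∷ xs) d (s≤s le) with fill q xs d le
... | f , has = (λ { zero → x ; (suc i) → f i }) , λ { (here refl) → here refl ; (there x∈) → there (has x∈) }

module Construction (r ℓ k q : ℕ) (3≤r : 3 ≤ r) (1≤ℓ : 1 ≤ ℓ) (q-bound : q * ℓ + suc r ≤ k + ℓ)
  (c₀ : Fin r) (k₀ : Fin k) where

  -- One vertex for each combination of class, blob, choice of q colours and tag, so that every
  -- vertex the argument asks for exists. There is one blob more than the q components that are to
  -- be defeated.
  N : ℕ
  N = r * (suc q * (k ^ q * k))

  V : Set
  V = Fin N

  abstract

    rest₁ : V → Fin (suc q * (k ^ q * k))
    rest₁ v = proj₂ (remQuot {r} (suc q * (k ^ q * k)) v)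

    rest₂ : V → Fin (k ^ q * k)
    rest₂ v = proj₂ (remQuot {suc q} (k ^ q * k) (rest₁ v))

    cls : V → Fin r
    cls v = proj₁ (remQuot {r} (suc q * (k ^ q * k)) v)

    blob : V → Fin (suc q)
    blob v = proj₁ (remQuot {suc q} (k ^ q * k) (rest₁ v))

    choice : V → Fin q → Fin k
    choice v = finToFun (proj₁ (remQuot {k ^ q} k (rest₂ v)))

    tag : V → Fin k
    tag v = proj₂ (remQuot {k ^ q} k (rest₂ v))

    vertex : Fin r → Fin (suc q) → (Fin q → Fin k) → Fin k → V
    vertex j b f t = combine j (combine b (combine (funToFin f) t))

    cls-vertex : ∀ j b f t → cls (vertex j b f t) ≡ j
    cls-vertex j b f t = cong proj₁ (Fin.remQuot-combine j _)

    rest₁-vertex : ∀ j b f t → rest₁ (vertex j b f t) ≡ combine b (combine (funToFin f) t)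
    rest₁-vertex j b f t = cong proj₂ (Fin.remQuot-combine j _)

    rest₂-vertex : ∀ j b f t → rest₂ (vertex j b f t) ≡ combine (funToFin f) t
    rest₂-vertex j b f t = trans (cong (proj₂ ∘ remQuot {suc q} (k ^ q * k)) (rest₁-vertex j b f t)) (cong proj₂ (Fin.remQuot-combine b _))

    blob-vertex : ∀ j b f t → blob (vertex j b f t) ≡ b
    blob-vertex j b f t = trans (cong (proj₁ ∘ remQuot {suc q} (k ^ q * k)) (rest₁-vertex j b f t))
      (cong proj₁ (Fin.remQuot-combine b (combine (funToFin f) t)))

    choice-vertex : ∀ j b f t x → choice (vertex j b f t) x ≡ f x
    choice-vertex j b f t x = trans
      (cong (λ w → finToFun (proj₁ (remQuot {k ^ q} k w)) x) (rest₂-vertex j b f t))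
      (trans (cong (λ w → finToFun (proj₁ w) x) (Fin.remQuot-combine (funToFin f) t)) (Fin.finToFun-funToFin f x))

    tag-vertex : ∀ j b f t → tag (vertex j b f t) ≡ t
    tag-vertex j b f t = trans (cong (proj₂ ∘ remQuot {k ^ q} k) (rest₂-vertex j b f t)) (cong proj₂ (Fin.remQuot-combine (funToFin f) t))

  -- In colour i the vertices killing i lie in small components, one inside each blob, and
  -- all others in a single component. Only vertices of class c₀ kill up to q colours, so
  -- that every edge leaves some colour unkilled.
  kills : V → List (Fin k)
  kills v = if does (cls v Fin.≟ c₀) then List.tabulate (choice v) else List.take 1 (List.tabulate (choice v))

  kills-c₀ : ∀ {v} → cls v ≡ c₀ → kills v ≡ List.tabulate (choice v)
  kills-c₀ {v} eq with cls v Fin.≟ c₀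
  ... | yes _ = refl
  ... | no neq = contradiction eq neq

  kills⊆ : ∀ v {i} → i ∈ kills v → i ∈ List.tabulate (choice v)
  kills⊆ v i∈ with cls v Fin.≟ c₀
  ... | yes _ = i∈
  kills⊆ v i∈ | no _ with List.tabulate (choice v) | i∈
  ... | _ ∷ _ | here eq = here eq

  -- A constant choice is used because outside class c₀ only its first entry counts.
  kills-const : ∀ v {i} → 1 ≤ q → (∀ x → choice v x ≡ i) → i ∈ kills v
  kills-const v (s≤s _) const with cls v Fin.≟ c₀
  ... | yes _ = here (sym (const zero))
  ... | no _ = here (sym (const zero))

  kills-short : ∀ v → length (kills v) ≤ q
  kills-short v with cls v Fin.≟ c₀
  ... | yes _ = ≤-reflexive (length-tabulate (choice v))
  ... | no _ = ≤-trans (≤-reflexive (length-take 1 (List.tabulate (choice v))))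
    (≤-trans (m⊓n≤n 1 _) (≤-reflexive (length-tabulate (choice v))))

  kills≤1 : ∀ v → cls v ≢ c₀ → length (kills v) ≤ 1
  kills≤1 v neq with cls v Fin.≟ c₀
  ... | yes eq = contradiction eq neq
  ... | no _ = ≤-trans (≤-reflexive (length-take 1 (List.tabulate (choice v)))) (m⊓n≤m 1 _)

  -- The labels are irrelevant for Edge.
  open Labelling {k = k} cls (λ _ v → v) ℓ using (Edge; fibre; fibre-∷-≡; fibre-∷-≢; transversal-edge)

  kills-total : ∀ e → sumOf (length ∘ kills) e ≤ length e + length (fibre e c₀) * (q ∸ 1)
  kills-total [] = z≤n
  kills-total (x ∷ e) = by-cases (cls x Fin.≟ c₀)
    where
    open ≤-Reasoning
    open +-*-Solver
    F : ℕ
    F = length (fibre e c₀)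
    by-cases : Dec (cls x ≡ c₀) →
      length (kills x) + sumOf (length ∘ kills) e ≤ suc (length e) + length (fibre (x ∷ e) c₀) * (q ∸ 1)
    by-cases (yes eq) = begin
      length (kills x) + sumOf (length ∘ kills) e           ≤⟨ +-mono-≤ (≤-trans (kills-short x) (m≤n+m∸n q 1)) (kills-total e) ⟩
      (1 + (q ∸ 1)) + (length e + F * (q ∸ 1))              ≡⟨ cong suc (solve 3 (λ a b c → a :+ (b :+ c) := b :+ (a :+ c)) refl (q ∸ 1) (length e) (F * (q ∸ 1))) ⟩
      suc (length e) + suc F * (q ∸ 1)                      ≡⟨ cong (λ f → suc (length e) + f * (q ∸ 1)) (fibre-∷-≡ e eq) ⟨
      suc (length e) + length (fibre (x ∷ e) c₀) * (q ∸ 1)  ∎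
    by-cases (no neq) = begin
      length (kills x) + sumOf (length ∘ kills) e           ≤⟨ +-mono-≤ (kills≤1 x neq) (kills-total e) ⟩
      suc (length e) + F * (q ∸ 1)                          ≡⟨ cong (λ f → suc (length e) + f * (q ∸ 1)) (fibre-∷-≢ e neq) ⟨
      suc (length e) + length (fibre (x ∷ e) c₀) * (q ∸ 1)  ∎

  -- At most ℓ vertices of an edge lie in class c₀, so for positive q it kills at most r + ℓ (q - 1)
  -- colours, and `q-bound` makes this less than k.
  spared : ∀ {e} → Edge e → ∃[ i ] i ∉ List.concatMap kills e
  spared {e} (len , _ , le) = shorter⇒missing (List.concatMap kills e)
    (subst (_< k) (sym (length-concatMap kills e)) (total q refl))
    where
    open ≤-Reasoning
    total : ∀ q′ → q′ ≡ q → sumOf (length ∘ kills) e < k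
    -- For q = 0 the estimate `kills-total` is too weak, since it charges a colour to every vertex;
    -- but then no vertex kills anything.
    total zero refl = ≤-<-trans (sumOf-mono e (λ {v} _ → kills-short v)) (subst (_< k) (sym (zeros e)) (≤-<-trans z≤n (Fin.toℕ<n k₀)))
      where
      zeros : (xs : List V) → sumOf (λ _ → 0) xs ≡ 0
      zeros [] = refl
      zeros (_ ∷ xs) = zeros xs
    total (suc p) refl = +-cancelʳ-< ℓ _ _ (begin-strict
      sumOf (length ∘ kills) e + ℓ              ≤⟨ +-monoˡ-≤ ℓ (kills-total e) ⟩
      length e + length (fibre e c₀) * p + ℓ    ≤⟨ +-monoˡ-≤ ℓ (+-mono-≤ (≤-reflexive len) (*-monoˡ-≤ p (le c₀))) ⟩
      r + ℓ * p + ℓ                             <⟨ ≤-reflexive (solve 3 (λ r ℓ p → con 1 :+ (r :+ ℓ :* p :+ ℓ) := (con 1 :+ p) :* ℓ :+ (con 1 :+ r)) refl r ℓ p) ⟩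
      suc p * ℓ + suc r                         ≤⟨ q-bound ⟩
      k + ℓ                                     ∎)
      where
      open +-*-Solver

  open import Data.List.Membership.DecPropositional {A = Fin k} Fin._≟_ using (_∈?_)

  -- A safe colour can be given to an edge without joining the parts of different blobs to each
  -- other or to the large component.
  Unkilled AllKilled Safe Tagged : Subset N → Fin k → Set
  Unkilled e i = ∀ v → v ∈ₛ e → i ∉ kills v
  AllKilled e i = ∃[ b ] ∀ v → v ∈ₛ e → i ∈ kills v × blob v ≡ b
  Safe e i = Unkilled e i ⊎ AllKilled e i
  Tagged e i = ∃[ v ] v ∈ₛ e × (∀ w → w ∈ₛ e → w ≢ v → tag w ≡ i)

  unkilled? : ∀ e i → Dec (Unkilled e i)
  unkilled? e i = Fin.all? λ v → (v ∈ₛ? e) →-dec ¬? (i ∈? kills v)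

  safe? : ∀ e i → Dec (Safe e i)
  safe? e i = unkilled? e i ⊎-dec Fin.any? λ b → Fin.all? λ v → (v ∈ₛ? e) →-dec ((i ∈? kills v) ×-dec (blob v Fin.≟ b))

  tagged? : ∀ e i → Dec (Tagged e i)
  tagged? e i = Fin.any? λ v → (v ∈ₛ? e) ×-dec Fin.all? λ w → (w ∈ₛ? e) →-dec (¬? (w Fin.≟ v) →-dec (tag w Fin.≟ i))

  some-unkilled : Subset N → Fin k
  some-unkilled e with Fin.any? (unkilled? e)
  ... | yes (i , _) = i
  -- By `spared` this default is never reached on an edge.
  ... | no _ = k₀

  -- Tags make the colouring spanning: a transversal on which all vertices but one carry the
  -- tag i gets colour i if this is safe, and for 3 ≤ r such a tag is unique.
  colour : Subset N → Fin k
  colour e with Fin.any? (λ i → safe? e i ×-dec tagged? e i)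
  ... | yes (i , _) = i
  ... | no _ = some-unkilled e

  partition : Partition N r
  partition = record
    { classOf = cls
    ; class-nonempty = λ j → vertex j zero (λ _ → k₀) k₀ ,
        ∈-subset-of⁺ (λ v → cls v Fin.≟ j) (cls-vertex j zero (λ _ → k₀) k₀) }

  H : Hypergraph N
  H = CompletePartite ℓ partition

  edge : ∀ e → H e → Edge (elements e)
  edge e h = edge-elements partition {k = k} {lab = λ _ v → v} {e = e} h

  colour-safe : ∀ {e} → H e → Safe e (colour e)
  colour-safe {e} h with Fin.any? (λ i → safe? e i ×-dec tagged? e i)
  ... | yes (_ , safe , _) = safe
  ... | no _ with Fin.any? (unkilled? e)
  ... | yes (_ , unkilled) = inj₁ unkilled
  ... | no none with spared {elements e} (edge e h)
  ... | i , i∉ = contradiction (i , λ v v∈ i∈ → i∉ (∈-concatMap⁺ kills (lose (∈-elements⁺ v∈) i∈))) none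

  -- Each tag has one exceptional vertex, so a third vertex carries both tags.
  tag-unique : ∀ {e i j} → H e → Tagged e i → Tagged e j → i ≡ j
  tag-unique {e} h (v , _ , all) (v′ , _ , all′)
    with ∃∈∉ {xs = v ∷ v′ ∷ []} (elements-unique e) (subst (3 ≤_) (sym (proj₁ (edge e h))) 3≤r)
  ... | w , w∈ , w∉ = trans (sym (all w (∈-elements⁻ e w∈) (w∉ ∘ here))) (all′ w (∈-elements⁻ e w∈) (w∉ ∘ there ∘ here))

  colour-tagged : ∀ {e i} → H e → Safe e i → Tagged e i → colour e ≡ i
  colour-tagged {e} {i} h safe tagged with Fin.any? (λ i → safe? e i ×-dec tagged? e i)
  ... | yes (_ , _ , tagged′) = tag-unique h tagged′ tagged
  ... | no none = contradiction (i , safe , tagged) none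

  colouring : Colouring H k
  colouring e _ = colour e

  -- The edge is a transversal through v whose other vertices lie in the blob of v, carry the tag i
  -- and kill i exactly if v does. It is therefore safe and tagged for i.
  through : ∀ v i → (f : Fin q → Fin k) →
    (i ∈ kills v × (∀ j → i ∈ kills (vertex j (blob v) f i))) ⊎ (i ∉ kills v × (∀ j → i ∉ kills (vertex j (blob v) f i))) →
    ∃[ e ] v ∈ₛ e × OfColour colouring i e
  through v i f alike = e , v∈ , h , colour-tagged h (safe alike) (v , v∈ , tags)
    where
    u : Fin r → V
    u j = if does (j Fin.≟ cls v) then v else vertex j (blob v) f i
    u-cases : ∀ j → u j ≡ v ⊎ u j ≡ vertex j (blob v) f i
    u-cases j with j Fin.≟ cls v
    ... | yes _ = inj₁ refl
    ... | no _ = inj₂ refl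
    cls-u : ∀ j → cls (u j) ≡ j
    cls-u j with j Fin.≟ cls v
    ... | yes eq = sym eq
    ... | no _ = cls-vertex j (blob v) f i
    e : Subset N
    e = fromList (List.tabulate u)
    h : H e
    h = edge-fromList partition {k = k} {lab = λ _ v → v} (transversal-edge 1≤ℓ u cls-u)
    u-v : u (cls v) ≡ v
    u-v with cls v Fin.≟ cls v
    ... | yes _ = refl
    ... | no neq = contradiction refl neq
    v∈ : v ∈ₛ e
    v∈ = ∈-fromList⁺ (subst (_∈ List.tabulate u) u-v (∈-tabulate⁺ {f = u} (cls v)))
    members : ∀ w → w ∈ₛ e → w ≡ v ⊎ ∃[ j ] w ≡ vertex j (blob v) f i
    members w w∈ with ∈-tabulate⁻ {f = u} (∈-fromList⁻ {xs = List.tabulate u} w∈)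
    ... | j , refl with u-cases j
    ... | inj₁ eq = inj₁ eq
    ... | inj₂ eq = inj₂ (j , eq)
    tags : ∀ w → w ∈ₛ e → w ≢ v → tag w ≡ i
    tags w w∈ w≢v with members w w∈
    ... | inj₁ eq = contradiction eq w≢v
    ... | inj₂ (j , refl) = tag-vertex j (blob v) f i
    safe : _ → Safe e i
    safe (inj₁ (v-kills , others)) = inj₂ (blob v , λ w w∈ → by-cases (members w w∈))
      where
      by-cases : ∀ {w} → w ≡ v ⊎ (∃[ j ] w ≡ vertex j (blob v) f i) → i ∈ kills w × blob w ≡ blob v
      by-cases (inj₁ refl) = v-kills , refl
      by-cases (inj₂ (j , refl)) = others j , blob-vertex j (blob v) f i
    safe (inj₂ (v-spares , others)) = inj₁ λ w w∈ → by-cases (members w w∈)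
      where
      by-cases : ∀ {w} → w ≡ v ⊎ (∃[ j ] w ≡ vertex j (blob v) f i) → i ∉ kills w
      by-cases (inj₁ refl) = v-spares
      by-cases (inj₂ (j , refl)) = others j

  2≤k : 1 ≤ q → 2 ≤ k
  2≤k 1≤q = +-cancelʳ-≤ ℓ 2 k (begin
    2 + ℓ              ≡⟨ +-comm 2 ℓ ⟩
    ℓ + 2              ≤⟨ +-mono-≤ (≤-trans (≤-reflexive (sym (*-identityˡ ℓ))) (*-monoˡ-≤ ℓ 1≤q)) (≤-trans (s≤s (s≤s z≤n)) (≤-trans 3≤r (n≤1+n r))) ⟩
    q * ℓ + suc r      ≤⟨ q-bound ⟩
    k + ℓ              ∎)
    where open ≤-Reasoning

  avoiding : ∀ i → ∃[ f ] (∀ (x : Fin q) → f x ≢ i)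
  -- A second colour is guaranteed only for q ≥ 1; for q = 0 the function has an empty domain.
  avoiding i with 1 ≤? q
  ... | no q≮1 = (λ _ → i) , λ x → contradiction (≤-trans (s≤s z≤n) (Fin.toℕ<n x)) q≮1
  ... | yes 1≤q with shorter⇒missing (i ∷ []) (2≤k 1≤q)
  ... | d , d∉ = (λ _ → d) , λ _ → d∉ ∘ here

  spanning : Spanning colouring
  spanning i _ v with i ∈? kills v
  ... | yes i∈ = through v i (λ _ → i) (inj₁ (i∈ , λ j →
    kills-const (vertex j (blob v) (λ _ → i) i) (≤-trans (∈-length i∈) (kills-short v)) (choice-vertex j (blob v) (λ _ → i) i)))
  ... | no i∉ with avoiding i
  ... | f , f≢ = through v i f (inj₂ (i∉ , λ j i∈ → let w = vertex j (blob v) f i in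
    let (x , eq) = ∈-tabulate⁻ {f = choice w} (kills⊆ w i∈) in f≢ x (trans (sym (choice-vertex j (blob v) f i x)) (sym eq))))

  -- An edge of colour i with a vertex that kills i is not unkilled, so by safety all its vertices
  -- kill i and lie in one blob. This propagates back along the path.
  stays-in-blob : ∀ {i x y} → ConnectedTo (OfColour colouring i) x y → i ∈ kills y → i ∈ kills x × blob x ≡ blob y
  stays-in-blob ε i∈ = i∈ , refl
  stays-in-blob {x = x} (_◅_ {j = z} (e , (h , refl) , x∈ , z∈) path) i∈ with stays-in-blob path i∈ | colour-safe h
  ... | z-kills , eq | inj₁ unkilled = contradiction z-kills (unkilled z z∈)
  ... | z-kills , eq | inj₂ (b , all) = proj₁ (all x x∈) ,
    trans (proj₂ (all x x∈)) (trans (sym (proj₂ (all z z∈))) eq)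

  roots : ∀ {Cs} → All (MonochromaticComponent colouring) Cs → ∃[ D ] length D ≡ length Cs ×
    (∀ {C v} → C ∈ Cs → v ∈ₛ C → ∃[ i ] ∃[ x ] (i , x) ∈ D × ConnectedTo (OfColour colouring i) x v)
  roots [] = [] , refl , λ ()
  roots ((i , x , comp) ∷ monos) with roots monos
  ... | D , len , root = (i , x) ∷ D , cong suc len , λ
    { (here refl) v∈ → i , x , here refl , Function.Equivalence.to (comp _) v∈
    ; (there C∈) v∈ → let (i′ , x′ , ∈D , path) = root C∈ v∈ in i′ , x′ , there ∈D , path }

  -- At most q components have their roots in at most q blobs. In a remaining blob, the vertex of
  -- class c₀ that kills all their colours lies in none of them.
  more-than-q : ∀ m → AlwaysCoverableBy≤ r ℓ k m → suc q ≤ m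
  more-than-q m always with always partition colouring spanning
  ... | Cs , len , monos , cover with roots monos
  ... | D , lenD , root = ≮⇒≥ λ m<1+q → uncovered (≤-trans (≤-reflexive lenD) (≤-trans len (s≤s⁻¹ m<1+q)))
    where
    uncovered : length D ≤ q → ⊥
    uncovered short with shorter⇒missing (map (blob ∘ proj₂) D) (s≤s (≤-trans (≤-reflexive (length-map _ D)) short))
                       | fill q (map proj₁ D) k₀ (≤-trans (≤-reflexive (length-map proj₁ D)) short)
    ... | b , b∉ | f , has with find (cover (vertex c₀ b f k₀))
    ... | C , C∈ , v∈ with root C∈ v∈
    ... | i , x , ∈D , path = b∉ (subst (_∈ map (blob ∘ proj₂) D)
        (trans (proj₂ (stays-in-blob path killed)) (blob-vertex c₀ b f k₀)) (∈-map⁺ (blob ∘ proj₂) ∈D))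
      where
      killed : i ∈ kills (vertex c₀ b f k₀)
      killed with ∈-tabulate⁻ {f = f} (has (∈-map⁺ proj₁ ∈D))
      ... | y , refl = subst (f y ∈_) (sym (kills-c₀ (cls-vertex c₀ b f k₀)))
        (subst (_∈ List.tabulate (choice (vertex c₀ b f k₀))) (choice-vertex c₀ b f k₀ y)
          (∈-tabulate⁺ {f = choice (vertex c₀ b f k₀)} y))

-- The quotient and the assembly of the bounds

module Bounds (r ℓ k : ℕ) .{{_ : NonZero ℓ}} (3≤r : 3 ≤ r) (ℓ≤r : ℓ ≤ r) (k≥ : k ≥ 1 + r ∸ ℓ) where

  q : ℕ
  q = quot r ℓ k

  1≤ℓ : 1 ≤ ℓ
  1≤ℓ = >-nonZero⁻¹ ℓ

  1≤k : 1 ≤ k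
  1≤k = ≤-trans (m<n⇒0<n∸m (s≤s ℓ≤r)) k≥

  room : suc r ≤ k + ℓ
  room = ≤-trans (m≤n+m∸n (suc r) ℓ) (≤-trans (+-monoʳ-≤ ℓ k≥) (≤-reflexive (+-comm ℓ k)))

  dividend : k + ℓ ∸ r ∸ 1 ≡ k + ℓ ∸ suc r
  dividend = trans (∸-+-assoc (k + ℓ) r 1) (cong (k + ℓ ∸_) (+-comm r 1))

  dividend+ : k + ℓ ∸ r ∸ 1 + suc r ≡ k + ℓ
  dividend+ = trans (cong (_+ suc r) dividend) (m∸n+n≡m room)

  -- The two sides of the floor: this one drops the remainder and feeds the construction, while
  -- `q-upper` bounds the remainder by ℓ and feeds the counting.
  q-lower : q * ℓ + suc r ≤ k + ℓ
  q-lower = ≤-trans (+-monoˡ-≤ (suc r) (m/n*n≤m (k + ℓ ∸ r ∸ 1) ℓ)) (≤-reflexive dividend+)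

  q-upper : k ≤ r + q * ℓ
  q-upper = +-cancelʳ-≤ ℓ k (r + q * ℓ) (s≤s⁻¹ (begin-strict
    k + ℓ                       ≡⟨ dividend+ ⟨
    k + ℓ ∸ r ∸ 1 + suc r       ≡⟨ cong (_+ suc r) (m≡m%n+[m/n]*n (k + ℓ ∸ r ∸ 1) ℓ) ⟩
    (k + ℓ ∸ r ∸ 1) % ℓ + q * ℓ + suc r
                                <⟨ +-monoˡ-< (suc r) (+-monoˡ-< (q * ℓ) (m%n<n (k + ℓ ∸ r ∸ 1) ℓ)) ⟩
    (ℓ + q * ℓ) + suc r         ≡⟨ solve 3 (λ a b c → (a :+ b) :+ (con 1 :+ c) := con 1 :+ (c :+ b :+ a)) refl ℓ (q * ℓ) r ⟩
    suc (r + q * ℓ + ℓ)         ∎))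
    where
    open ≤-Reasoning
    open +-*-Solver

  lower : (1 + q) ≤cov[ r , ℓ , k ]
  lower = Construction.more-than-q r ℓ k q 3≤r 1≤ℓ q-lower (fromℕ< (≤-trans (s≤s z≤n) 3≤r)) (fromℕ< 1≤k)

  upper : 4 ≤ r ⊎ 2 ≤ ℓ → cov[ r , ℓ , k ]≤ (1 + q)
  upper big = always-coverable λ cls lab inhabited edge-mono spanning nocover →
    General.Counting.not-uncoverable cls lab ℓ edge-mono spanning 3≤r 1≤ℓ ℓ≤r q q-upper nocover big
      (Labelling.transversal-edge {k = k} cls lab ℓ 1≤ℓ (proj₁ ∘ inhabited) (proj₂ ∘ inhabited))

cov≤-mono : ∀ {r ℓ k m m′} → m ≤ m′ → cov[ r , ℓ , k ]≤ m → cov[ r , ℓ , k ]≤ m′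
cov≤-mono m≤ cov≤ P c spanning with cov≤ P c spanning
... | Cs , len , rest = Cs , ≤-trans len m≤ , rest

module _ {k : ℕ} (3≤k : 3 ≤ k) where

  quot-3-1 : quot 3 1 k ≡ k ∸ 3
  quot-3-1 = begin
    (k + 1 ∸ 3 ∸ 1) / 1   ≡⟨ n/1≡n (k + 1 ∸ 3 ∸ 1) ⟩
    k + 1 ∸ 3 ∸ 1         ≡⟨ ∸-+-assoc (k + 1) 3 1 ⟩
    k + 1 ∸ 4             ≡⟨ cong (_∸ 4) (+-comm k 1) ⟩
    k ∸ 3                 ∎
    where open ≡-Reasoning

  few-coverable : k ≤ 5 → cov[ 3 , 1 , k ]≤ (1 + quot 3 1 k)
  few-coverable k≤5 = subst (cov[ 3 , 1 , k ]≤_) (sym (trans (cong suc quot-3-1) (sym (+-∸-assoc 1 3≤k))))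
    (always-coverable λ cls lab inhabited edge-mono spanning →
      ThreeClasses.few-colours cls lab inhabited edge-mono spanning 3≤k k≤5)

  many-coverable : cov[ 3 , 1 , k ]≤ (2 + quot 3 1 k)
  many-coverable = subst (cov[ 3 , 1 , k ]≤_) (sym (trans (cong (2 +_) quot-3-1) (sym (+-∸-assoc 2 3≤k))))
    (always-coverable λ cls lab inhabited edge-mono spanning →
      ThreeClasses.any-colours cls lab inhabited edge-mono spanning 3≤k)

theorem3p5 : (r ℓ k : ℕ) .{{_ : NonZero ℓ}} → r ≥ 3 → ℓ ≤ r → k ≥ 1 + r ∸ ℓ →
    (¬ (ℓ ≡ 1 × k ≥ 2 * r) → cov[ r , ℓ , k ]≡ (1 + quot r ℓ k)) ×
    (ℓ ≡ 1 × k ≥ 2 * r →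
    ((1 + quot r ℓ k) ≤cov[ r , ℓ , k ]) × (cov[ r , ℓ , k ]≤ (2 + quot r ℓ k)))
theorem3p5 r ℓ k 3≤r ℓ≤r k≥ = by-cases (r ≟ 3) (ℓ ≟ 1)
  where
  open Bounds r ℓ k 3≤r ℓ≤r k≥
  Goal : Set
  Goal = (¬ (ℓ ≡ 1 × k ≥ 2 * r) → cov[ r , ℓ , k ]≡ (1 + quot r ℓ k)) ×
    (ℓ ≡ 1 × k ≥ 2 * r → ((1 + quot r ℓ k) ≤cov[ r , ℓ , k ]) × (cov[ r , ℓ , k ]≤ (2 + quot r ℓ k)))
  general : 4 ≤ r ⊎ 2 ≤ ℓ → Goal
  -- For these r and ℓ the sharp bound holds for every k; the second half of the goal merely weakens
  -- it.
  general big = (λ _ → upper big , lower) , λ _ → lower , cov≤-mono (n≤1+n (1 + q)) (upper big)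
  by-cases : Dec (r ≡ 3) → Dec (ℓ ≡ 1) → Goal
  by-cases (no r≢3) _ = general (inj₁ (≤∧≢⇒< 3≤r (≢-sym r≢3)))
  by-cases (yes _) (no ℓ≢1) = general (inj₂ (≤∧≢⇒< 1≤ℓ (≢-sym ℓ≢1)))
  by-cases (yes refl) (yes refl) =
    -- With r = 3 the threshold 2 * r is 6, which leaves k ≤ 5 for the case analysis.
    (λ k≱6 → few-coverable k≥ (s≤s⁻¹ (≰⇒> λ 6≤k → k≱6 (refl , 6≤k))) , lower) ,
    λ _ → lower , many-coverable k≥
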